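{- There exists a randomized two-party communication protocol that, given an $n$-vertex graph $G$ with maximum degree $\Delta$ whose edges are partitioned (adversarially) between Alice and Bob, finds a $(\Delta+1)$-vertex coloring of $G$ using $O(n)$ bits of communication in expectation, and completes in $O(\log\log n\cdot\log \Delta)$ rounds in the worst case.
   Context: Two-party edge-partition model: $G=(V,E)$ is a finite simple undirected graph with $n$ vertices and maximum degree $\Delta$. The vertex set $V$ and the numbers $n,\Delta$ are known to both parties. The edge set is partitioned adversarially as $E=E_A\sqcup E_B$; Alice receives $E_A$, Bob receives $E_B$. The parties may use public (shared) randomness. In one round, Alice and Bob may each simultaneously send one message to the other. Communication is the total number of bits exchanged. A $(\Delta+1)$-vertex coloring is an assignment of colors from $[\Delta+1]=\{1,\dots,\Delta+1\}$ to vertices with adjacent vertices receiving different colors; both Alice and Bob must output the colors of all vertices. The protocol is Las Vegas: its output is always a proper coloring. The bounds are for every input graph and every edge partition, and the expectation is over the randomness of the protocol. The hidden constants are absolute; in the bounds, $\log\Delta$ is read as $\log(\Delta+1)$, and $\log\log n$ as $\max\{1,\log\log n\}$. -}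

module Defs where

open import Algebra.Properties.Semiring.Sum using (sum)
open import Data.Bool.Base using (Bool)
open import Data.Fin.Base using (Fin)
open import Data.Fin.Subset using (Subset; _∈_; _∉_; _∪_; _∩_; ∣_∣; Empty)
open import Data.Integer.Base using (+_)
open import Data.List.Base using (List; length; map; allFin)
open import Data.List.Extrema.Nat using (max)
open import Data.List.Relation.Binary.Prefix.Heterogeneous using (Prefix)
open import Data.Nat.Base using (ℕ; zero; suc; _+_; NonZero)
open import Data.Nat.Properties using (+-*-semiring)
open import Data.Product.Base using (_×_)
open import Data.Rational.Base using (ℚ; _/_)
open import Relation.Binary.PropositionalEquality using (_≡_; _≢_; _≗_)

private
  variable
    n k : ℕ
    A B O P : Set

------------------------------------------------------------------------
-- Finite simple graphs

-- Since the vertex set is fixed, this type also serves for edge sets.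
record Graph (n : ℕ) : Set where
  field
    neighbours : Fin n → Subset n
    symmetric  : ∀ {u v} → v ∈ neighbours u → u ∈ neighbours v
    loopless   : ∀ {v} → v ∉ neighbours v

open Graph public

degree : Graph n → Fin n → ℕ
degree G v = ∣ neighbours G v ∣

maxDegree : Graph n → ℕ
maxDegree {n} G = max 0 (map (degree G) (allFin n))

record EdgePartition (G E₁ E₂ : Graph n) : Set where
  field
    covers   : ∀ v → neighbours G v ≡ neighbours E₁ v ∪ neighbours E₂ v
    disjoint : ∀ v → Empty (neighbours E₁ v ∩ neighbours E₂ v)

Coloring : ℕ → ℕ → Set
Coloring n k = Fin n → Fin k

Proper : Graph n → Coloring n k → Set
Proper G c = ∀ {u v} → v ∈ neighbours G u → c u ≢ c v

------------------------------------------------------------------------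
-- Two-party protocols

-- Messages may have variable length, but must be self-delimiting: otherwise
-- the end of a message would carry information that is not paid for in bits.
PrefixFree : (P → List Bool) → Set
PrefixFree message = ∀ x y → Prefix _≡_ (message x) (message y) → message x ≡ message y

-- Deterministic protocols with inputs in A (Alice) and B (Bob), in which each
-- party outputs an element of O.  The rest of the protocol is indexed by the
-- two messages of the current round, so a message or an output depends only
-- on the sender's own input and on the messages of the previous rounds.
data Protocol (A B O : Set) : Set where
  output : (alice : A → O) (bob : B → O) → Protocol A B O
  round  : (alice : A → List Bool) (bob : B → List Bool) →
           PrefixFree alice → PrefixFree bob →
           (next : List Bool → List Bool → Protocol A B O) →
           Protocol A B O

rounds : Protocol A B O → A → B → ℕ
rounds (output _ _)               x y = zero
rounds (round alice bob _ _ next) x y = suc (rounds (next (alice x) (bob y)) x y)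

bits : Protocol A B O → A → B → ℕ
bits (output _ _)               x y = zero
bits (round alice bob _ _ next) x y =
  length (alice x) + length (bob y) + bits (next (alice x) (bob y)) x y

outputAlice : Protocol A B O → A → B → O
outputAlice (output alice _)           x y = alice x
outputAlice (round alice bob _ _ next) x y = outputAlice (next (alice x) (bob y)) x y

outputBob : Protocol A B O → A → B → O
outputBob (output _ bob)             x y = bob y
outputBob (round alice bob _ _ next) x y = outputBob (next (alice x) (bob y)) x y

-- The public randomness is a uniformly distributed element of Fin size; for
-- each of its values the parties run a deterministic protocol.
record RandomizedProtocol (A B O : Set) : Set where
  field
    size         : ℕ
    {{nonEmpty}} : NonZero size
    protocol     : Fin size → Protocol A B O

open RandomizedProtocol public

-- Expectation with respect to the uniform distribution on Fin k.
𝔼 : .{{_ : NonZero k}} → (Fin k → ℕ) → ℚ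
𝔼 {k} X = + sum +-*-semiring X / k

expectedBits : RandomizedProtocol A B O → A → B → ℚ
expectedBits R x y = 𝔼 (λ ω → bits (protocol R ω) x y)

-- Both parties output the same proper coloring of G.
Solves : Graph n → Protocol A B (Coloring n k) → A → B → Set
Solves G Π x y = Proper G (outputAlice Π x y) × outputAlice Π x y ≗ outputBob Π x y

{-# OPTIONS --safe #-}

-- All vertices are coloured by random colour trials.  In a trial every uncoloured
-- vertex v draws public random colours, and the two parties look for one of them
-- that is unused around v; an active vertex (active with probability 1/2) keeps
-- the colour found unless an active neighbour has found the same one.  The search
-- has the draws at the leaves of a tree of constant depth and descends into any
-- child where the numbers of leaves forbidden by Alice's and by Bob's edges add
-- up to less than the number of leaves; so it needs only constantly many rounds.
--
-- Let s be Δ + 1 minus the number of coloured neighbours of v.  By Chebyshev, k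
-- draws suffice with failure probability O((Δ + 1)/(s √k)).  The colour found is
-- uniform among the available ones, of which there are at least s, more than the
-- uncoloured neighbours, half of them active; so v stays uncoloured with
-- probability at most 3/4 plus the failure probability.  Neighbours are coloured
-- only when active, whence the expectation of 1/s grows by a factor at most 3 per
-- trial.  Letting k grow geometrically over the stages at a sufficient rate, and
-- the tree be deep enough for the cost of a trial to grow by less than 4/3,
-- a[v uncoloured] + b/s with suitable a and b pays for all trials.
--
-- After O(log Δ + log log n) trials so few vertices are left, in expectation, that
-- the parties can afford Δ names of O(log n) bits for each of them, which
-- reveals their neighbourhoods; the rest is coloured greedily without communication.

module Submission where

open import Defs
open import Data.Bool.Base using (Bool; true; false; _∧_; _∨_; not; T; if_then_else_)
open import Data.Bool.Properties using (∨-zeroʳ; ∧-zeroʳ)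
open import Data.Fin.Base using (Fin; zero; suc; toℕ; remQuot; _↑ˡ_; _↑ʳ_)
open import Data.Fin.Permutation using (Permutation; _⟨$⟩ʳ_; transpose)
open import Data.Fin.Properties using (_≟_; splitAt-↑ˡ; splitAt-↑ʳ; toℕ-injective; toℕ<n)
open import Data.Fin.Subset using (Subset; ∣_∣) renaming (_∈_ to _∈ₛ_)
open import Data.Fin.Subset.Properties using (x∈p∩q⁺)
import Data.Integer.Base as ℤ
import Data.Integer.Properties as ℤ
open import Data.List.Base as List using (List; []; _∷_; length; allFin; replicate; _++_)
open import Data.List.Extrema.Nat using (xs≤max)
open import Data.List.Membership.Propositional using (_∈_)
open import Data.List.Membership.Propositional.Properties using (∈-map⁺; ∈-map⁻; ∈-allFin)
open import Data.List.Properties using (length-++; length-map; length-replicate)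
open import Data.List.Relation.Binary.Prefix.Heterogeneous using (Prefix; []; _∷_)
import Data.List.Relation.Unary.All as All
open import Data.List.Relation.Unary.Any using (here; there)
open import Data.Maybe.Base using (Maybe; just; nothing; fromMaybe)
open import Data.Maybe.Properties using (just-injective)
open import Data.Nat.Base hiding (_/_)
import Data.Nat.Base as ℕ
open import Data.Nat.Divisibility using (∣-trans; m∣m*n; m≤n⇒m!∣n!)
open import Data.Nat.DivMod using (m*[n/m]≡n; /-monoʳ-≤)
open import Data.Nat.Induction using (<-rec)
open import Data.Nat.Logarithm
  using (⌊log₂_⌋; ⌊log₂⌋-mono-≤; ⌊log₂⌊n/2⌋⌋≡⌊log₂n⌋∸1; ⌊log₂[2^n]⌋≡n)
open import Data.Nat.Properties hiding (_≟_)
open import Data.Nat.Solver using (module +-*-Solver)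
open import Data.Product.Base using (_×_; _,_; proj₁; proj₂; Σ-syntax; ∃-syntax; uncurry)
open import Data.Rational.Base using (_/_) renaming (_≤_ to _≤ℚ_)
import Data.Rational.Properties as ℚ
import Data.Rational.Unnormalised.Base as ℚᵘ
import Data.Rational.Unnormalised.Properties as ℚᵘ
open import Data.Sum.Base using (_⊎_; inj₁; inj₂)
open import Data.Unit.Base using (⊤; tt)
open import Data.Vec.Base as Vec using (Vec; []; _∷_; lookup; tabulate; _[_]≔_; toList)
open import Data.Vec.Properties
  using ( []=⇒lookup; lookup⇒[]=; length-toList; lookup-map; lookup-replicate; lookup-zipWith
        ; lookup∘tabulate; lookup∘update; lookup∘update′; map-cong; map-∘; tabulate-cong )
open import Function.Base using (_∘_; id; case_of_)
open import Relation.Binary.PropositionalEquality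
open import Relation.Nullary using (yes; no; does; contradiction)
open import Relation.Nullary.Decidable using (dec-true; dec-false)

open import Algebra.Properties.Semiring.Sum +-*-semiring
  using (sum; sum-cong-≗; ∑-distrib-+; ∑-comm; *-distribˡ-sum; sum-permute)
open +-*-Solver using (solve; con; _:+_; _:*_; _:=_)

-- Every seed leads to a proper colouring, so randomness affects only the cost, and nothing is ever
-- conditioned on a good event. Conditioning would be of little use anyway: a search is cheap only
-- where the slack `s` is a good fraction of `Δ + 1`, and no lower bound on `s` survives the trials,
-- only an expectation of `1/s`. This is why failure probabilities are kept linear in `1/s` and why
-- a linear potential per vertex, summed over the vertices, does all the accounting. Depth separates
-- draws from bits: a tree with `k` leaves and depth `L` costs about `L * k^(1/L)` counts. A stage
-- of trials may multiply the expected `1/s` by a large constant, and `1/√k` has to fall faster than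
-- that from stage to stage, while the bits per trial may grow only as slowly as open vertices
-- disappear. A large constant `L` reconciles the two. All inequalities are between natural numbers.
-- Three denominators are cleared throughout: the size of the sample space, `m !` for the
-- reciprocals of slacks, and a power `Q` of `P` for the charges.

private
  variable
    U V X Y : Set
    k n κ : ℕ

-- Finite sums and sample spaces

𝟙 : Bool → ℕ
𝟙 false = 0
𝟙 true  = 1

sum-mono : {f g : Fin n → ℕ} → (∀ i → f i ≤ g i) → sum f ≤ sum g
sum-mono {n = zero}  f≤g = z≤n
sum-mono {n = suc n} f≤g = +-mono-≤ (f≤g zero) (sum-mono (f≤g ∘ suc))

sum-const : ∀ n c → sum {n} (λ _ → c) ≡ n * c
sum-const zero    c = refl
sum-const (suc n) c = cong (c +_) (sum-const n c)

term≤sum : (f : Fin n → ℕ) (i : Fin n) → f i ≤ sum f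
term≤sum f zero    = m≤m+n _ _
term≤sum f (suc i) = ≤-trans (term≤sum (f ∘ suc) i) (m≤n+m _ _)

sum-remQuot : ∀ m n (f : Fin m × Fin n → ℕ) →
              sum (f ∘ remQuot {m} n) ≡ sum (λ i → sum (λ j → f (i , j)))
sum-remQuot zero    n f = refl
sum-remQuot (suc m) n f = begin
  sum (f ∘ remQuot {suc m} n)
    ≡⟨ sum-split n (f ∘ remQuot {suc m} n) ⟩
  sum (λ j → f (remQuot {suc m} n (j ↑ˡ m * n))) + sum (λ j → f (remQuot {suc m} n (n ↑ʳ j)))
    ≡⟨ cong₂ _+_ (sum-cong-≗ first) (sum-cong-≗ rest) ⟩
  sum (λ j → f (zero , j)) + sum ((λ (i , j) → f (suc i , j)) ∘ remQuot {m} n)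
    ≡⟨ cong (sum (λ j → f (zero , j)) +_) (sum-remQuot m n (λ (i , j) → f (suc i , j))) ⟩
  sum (λ i → sum (λ j → f (i , j))) ∎
  where
  open ≡-Reasoning
  sum-split : ∀ k {l} (g : Fin (k + l) → ℕ) →
              sum g ≡ sum (λ i → g (i ↑ˡ l)) + sum (λ i → g (k ↑ʳ i))
  sum-split zero    g = refl
  sum-split (suc k) g = trans (cong (g zero +_) (sum-split k (g ∘ suc)))
    (sym (+-assoc (g zero) _ _))
  first : ∀ j → f (remQuot {suc m} n (j ↑ˡ m * n)) ≡ f (zero , j)
  first j rewrite splitAt-↑ˡ n j (m * n) = refl
  rest : ∀ j → f (remQuot {suc m} n (n ↑ʳ j)) ≡ f
         (suc (proj₁ (remQuot {m} n j)) , proj₂ (remQuot {m} n j))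
  rest j rewrite splitAt-↑ʳ n (m * n) j = refl

-- A finite sample space, given by an enumeration of its outcomes with
-- multiplicities; expectations are kept unnormalised, as sums ∑ S f to be
-- compared with multiples of card S.
record Space (X : Set) : Set where
  field
    card : ℕ
    at   : Fin card → X

open Space

uniform : ∀ n → Space (Fin n)
uniform n = record { card = n ; at = id }

image : (X → Y) → Space X → Space Y
image f S = record { card = card S ; at = f ∘ at S }

infixr 5 _⊗_
_⊗_ : Space X → Space Y → Space (X × Y)
S ⊗ T = record { card = card S * card T ; at = λ i → at S (proj₁ (remQuot {card S} (card T) i)) , at
  T (proj₂ (remQuot {card S} (card T) i)) }

point : X → Space X
point x = record { card = 1 ; at = λ _ → x }

power : Space X → ∀ n → Space (Vec X n)
power S zero    = point []
power S (suc n) = image (uncurry _∷_) (S ⊗ power S n)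

opaque
  ∑ : Space X → (X → ℕ) → ℕ
  ∑ S f = sum (f ∘ at S)

  ∑-cong : (S : Space X) {f g : X → ℕ} → (∀ x → f x ≡ g x) → ∑ S f ≡ ∑ S g
  ∑-cong S f≗g = sum-cong-≗ (f≗g ∘ at S)

  ∑-mono : (S : Space X) {f g : X → ℕ} → (∀ x → f x ≤ g x) → ∑ S f ≤ ∑ S g
  ∑-mono S f≤g = sum-mono (f≤g ∘ at S)

  ∑-const : (S : Space X) (c : ℕ) → ∑ S (λ _ → c) ≡ card S * c
  ∑-const S = sum-const (card S)

  ∑-+ : (S : Space X) (f g : X → ℕ) → ∑ S (λ x → f x + g x) ≡ ∑ S f + ∑ S g
  ∑-+ S f g = ∑-distrib-+ (f ∘ at S) (g ∘ at S)

  ∑-* : (S : Space X) (c : ℕ) (f : X → ℕ) → ∑ S (λ x → c * f x) ≡ c * ∑ S f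
  ∑-* S c f = sym (*-distribˡ-sum c (f ∘ at S))

  ∑-swap : (S : Space X) (T : Space Y) (f : X → Y → ℕ) →
           ∑ S (λ x → ∑ T (f x)) ≡ ∑ T (λ y → ∑ S (λ x → f x y))
  ∑-swap S T f = ∑-comm (λ i j → f (at S i) (at T j))

  ∑-⊗ : (S : Space X) (T : Space Y) (f : X × Y → ℕ) →
        ∑ (S ⊗ T) f ≡ ∑ S (λ x → ∑ T (λ y → f (x , y)))
  ∑-⊗ S T f = sum-remQuot (card S) (card T) (λ (i , j) → f (at S i , at T j))

  ∑-power : (S : Space X) (f : Vec X (suc n) → ℕ) →
            ∑ (power S (suc n)) f ≡ ∑ S (λ x → ∑ (power S n) (λ xs → f (x ∷ xs)))
  ∑-power S f = ∑-⊗ S (power S _) (f ∘ uncurry _∷_)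

  ∑-point : (x : X) (f : X → ℕ) → ∑ (point x) f ≡ f x
  ∑-point x f = +-identityʳ (f x)

  ∑-uniform : (f : Fin n → ℕ) → ∑ (uniform n) f ≡ sum f
  ∑-uniform f = refl

  ∑≡sum : (S : Space X) (f : X → ℕ) → ∑ S f ≡ sum (f ∘ at S)
  ∑≡sum S f = refl

  term≤∑ : (f : Fin n → ℕ) (i : Fin n) → f i ≤ ∑ (uniform n) f
  term≤∑ = term≤sum

  ∑-empty : (f : Fin 0 → ℕ) → ∑ (uniform 0) f ≡ 0
  ∑-empty f = refl

  ∑-suc : (f : Fin (suc n) → ℕ) → ∑ (uniform (suc n)) f ≡ f zero + ∑ (uniform n) (f ∘ suc)
  ∑-suc f = refl

  ∑-permute : (f : Fin n → ℕ) (π : Permutation n n) →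
              ∑ (uniform n) (f ∘ (π ⟨$⟩ʳ_)) ≡ ∑ (uniform n) f
  ∑-permute f π = sym (sum-permute f π)

-- Redrawing one coordinate does not change a product distribution. This replaces conditional
-- expectation: the seeds of all other vertices are frozen while the seed of one vertex is averaged.
resample : (S : Space X) (i : Fin n) (f : Vec X n → ℕ) →
           card S * ∑ (power S n) f ≡ ∑ (power S n) (λ ω → ∑ S (λ x → f (ω [ i ]≔ x)))
resample {n = suc n} S zero f = begin
  card S * ∑ (power S (suc n)) f
    ≡⟨ cong (card S *_) (∑-power S f) ⟩
  card S * ∑ S (λ x → ∑ (power S n) (λ ω → f (x ∷ ω)))
    ≡⟨ ∑-const S _ ⟨
  ∑ S (λ _ → ∑ S (λ x → ∑ (power S n) (λ ω → f (x ∷ ω))))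
    ≡⟨ ∑-cong S (λ _ → ∑-swap S (power S n) _) ⟩
  ∑ S (λ _ → ∑ (power S n) (λ ω → ∑ S (λ x → f (x ∷ ω))))
    ≡⟨ ∑-power S _ ⟨
  ∑ (power S (suc n)) (λ ω → ∑ S (λ x → f (ω [ zero ]≔ x))) ∎
  where open ≡-Reasoning
resample {n = suc n} S (suc i) f = begin
  card S * ∑ (power S (suc n)) f
    ≡⟨ cong (card S *_) (∑-power S f) ⟩
  card S * ∑ S (λ x → ∑ (power S n) (λ ω → f (x ∷ ω)))
    ≡⟨ ∑-* S (card S) _ ⟨
  ∑ S (λ x → card S * ∑ (power S n) (λ ω → f (x ∷ ω)))
    ≡⟨ ∑-cong S (λ x → resample S i (f ∘ (x ∷_))) ⟩
  ∑ S (λ x → ∑ (power S n) (λ ω → ∑ S (λ y → f (x ∷ (ω [ i ]≔ y)))))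
    ≡⟨ ∑-power S _ ⟨
  ∑ (power S (suc n)) (λ ω → ∑ S (λ x → f (ω [ suc i ]≔ x))) ∎
  where open ≡-Reasoning

marginal : (S : Space X) (i : Fin n) (f : X → ℕ) →
           card S * ∑ (power S n) (λ ω → f (lookup ω i)) ≡ card (power S n) * ∑ S f
marginal S i f = trans (resample S i _) (trans
  (∑-cong (power S _) (λ ω → ∑-cong S (λ x → cong f (lookup∘update i ω x))))
  (∑-const (power S _) _))

∑-power-map : (S : Space X) (φ : X → X) → (∀ f → ∑ S (f ∘ φ) ≡ ∑ S f) →
              ∀ n f → ∑ (power S n) (f ∘ Vec.map φ) ≡ ∑ (power S n) f
∑-power-map S φ inv zero    f = trans (∑-point [] (f ∘ Vec.map φ)) (sym (∑-point [] f))
∑-power-map S φ inv (suc n) f = begin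
  ∑ (power S (suc n)) (f ∘ Vec.map φ)
    ≡⟨ ∑-power S _ ⟩
  ∑ S (λ x → ∑ (power S n) (λ ω → f (φ x ∷ Vec.map φ ω)))
    ≡⟨ ∑-cong S (λ x → ∑-power-map S φ inv n (f ∘ (φ x ∷_))) ⟩
  ∑ S (λ x → ∑ (power S n) (λ ω → f (φ x ∷ ω)))
    ≡⟨ inv (λ x → ∑ (power S n) (λ ω → f (x ∷ ω))) ⟩
  ∑ S (λ x → ∑ (power S n) (λ ω → f (x ∷ ω)))
    ≡⟨ ∑-power S f ⟨
  ∑ (power S (suc n)) f ∎
  where open ≡-Reasoning

T⇒true : ∀ {b} → T b → b ≡ true
T⇒true {true} _ = refl

true⇒T : ∀ {b} → b ≡ true → T b
true⇒T refl = _

𝟙≤1 : ∀ b → 𝟙 b ≤ 1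
𝟙≤1 false = z≤n
𝟙≤1 true  = s≤s z≤n

-- The first index satisfying `P`, or the last index if there is none, so that a failed search needs
-- no separate value.
choose : (Fin (suc k) → Bool) → Fin (suc k)
choose {zero}  P = zero
choose {suc k} P = if P zero then zero else suc (choose (P ∘ suc))

choose-sound : (P : Fin (suc k) → Bool) (i : Fin (suc k)) → P i ≡ true → P (choose P) ≡ true
choose-sound {zero}  P zero    p = p
choose-sound {suc k} P i       p with P zero in eq
choose-sound {suc k} P i       p | true  = eq
choose-sound {suc k} P zero    p | false with () ← trans (sym p) eq
choose-sound {suc k} P (suc i) p | false = choose-sound (P ∘ suc) i p

choose-cong : {P Q : Fin (suc k) → Bool} → (∀ i → P i ≡ Q i) → choose P ≡ choose Q
choose-cong {zero}  P≗Q = refl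
choose-cong {suc k} P≗Q rewrite P≗Q zero | choose-cong (P≗Q ∘ suc) = refl

-- Second moments

2xy≤x²+y² : ∀ x y → 2 * (x * y) ≤ x * x + y * y
2xy≤x²+y² x y with ≤-total x y
... | inj₁ x≤y with d , refl ← m≤n⇒∃[o]m+o≡n x≤y =
  ≤-trans (m≤m+n _ (d * d)) (≤-reflexive (square x d))
  where
  square : ∀ x d → 2 * (x * (x + d)) + d * d ≡ x * x + (x + d) * (x + d)
  square = solve 2 (λ x d → con 2 :* (x :* (x :+ d)) :+ d :* d := x :* x :+ (x :+ d) :* (x :+ d))
    refl
... | inj₂ y≤x with d , refl ← m≤n⇒∃[o]m+o≡n y≤x =
  ≤-trans (m≤m+n _ (d * d)) (≤-reflexive (square y d))
  where
  square : ∀ y d → 2 * ((y + d) * y) + d * d ≡ (y + d) * (y + d) + y * y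
  square = solve 2 (λ y d → con 2 :* ((y :+ d) :* y) :+ d :* d := (y :+ d) :* (y :+ d) :+ y :* y)
    refl

-- f has mean μ/m and variance at most v/m².
record Moments (m : ℕ) (S : Space X) (f : X → ℕ) (μ v : ℕ) : Set where
  field
    first  : m * ∑ S f ≡ card S * μ
    second : m * m * ∑ S (λ x → f x * f x) ≤ card S * (μ * μ + v)

open Moments

-- Means and variances of independent copies add. The cross term of the square is a product of two
-- means, which is why `first` has to be an equation whereas `second` may be an inequality.
moments-power : ∀ {m μ v} {S : Space X} {f : X → ℕ} → Moments m S f μ v →
                ∀ n → Moments m (power S n) (Vec.sum ∘ Vec.map f) (n * μ) (n * v)
moments-power {m = m} M zero .first = trans (cong (m *_) (∑-point [] _)) (*-zeroʳ m)
moments-power {m = m} M zero .second =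
  ≤-reflexive (trans (cong (m * m *_) (∑-point [] _)) (*-zeroʳ (m * m)))
moments-power {m = m} {μ} {v} {S} {f} M (suc n) = record { first = eq₁ ; second = le₂ }
  where
  P = power S n
  F = Vec.sum ∘ Vec.map f
  N = card S
  R = card P
  ih = moments-power M n
  eq₁ : m * ∑ (power S (suc n)) (Vec.sum ∘ Vec.map f) ≡ N * R * (μ + n * μ)
  eq₁ = begin
    m * ∑ (power S (suc n)) (Vec.sum ∘ Vec.map f)
      ≡⟨ cong (m *_) (∑-power S _) ⟩
    m * ∑ S (λ x → ∑ P (λ xs → f x + F xs))
      ≡⟨ cong (m *_) (∑-cong S (λ x → trans (∑-+ P _ _) (cong (_+ ∑ P F) (∑-const P (f x))))) ⟩
    m * ∑ S (λ x → R * f x + ∑ P F)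
      ≡⟨ cong (m *_) (trans (∑-+ S _ _) (cong₂ _+_ (∑-* S R f) (∑-const S _))) ⟩
    m * (R * ∑ S f + N * ∑ P F)
      ≡⟨ ring m R (∑ S f) N (∑ P F) ⟩
    R * (m * ∑ S f) + N * (m * ∑ P F)
      ≡⟨ cong₂ (λ a b → R * a + N * b) (first M) (first ih) ⟩
    R * (N * μ) + N * (R * (n * μ))
      ≡⟨ ring′ R N μ (n * μ) ⟩
    N * R * (μ + n * μ) ∎
    where
    open ≡-Reasoning
    ring : ∀ m R a N b → m * (R * a + N * b) ≡ R * (m * a) + N * (m * b)
    ring = solve 5 (λ m R a N b → m :* (R :* a :+ N :* b) := R :* (m :* a) :+ N :* (m :* b)) refl
    ring′ : ∀ R N a b → R * (N * a) + N * (R * b) ≡ N * R * (a + b)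
    ring′ = solve 4 (λ R N a b → R :* (N :* a) :+ N :* (R :* b) := N :* R :* (a :+ b)) refl
  F² = λ xs → F xs * F xs
  f² = λ x → f x * f x
  eq₂ : ∑ (power S (suc n)) (λ xs → Vec.sum (Vec.map f xs) * Vec.sum (Vec.map f xs))
        ≡ R * ∑ S f² + 2 * (∑ S f * ∑ P F) + N * ∑ P F²
  eq₂ = begin
    ∑ (power S (suc n)) (λ xs → Vec.sum (Vec.map f xs) * Vec.sum (Vec.map f xs))
      ≡⟨ ∑-power S _ ⟩
    ∑ S (λ x → ∑ P (λ xs → (f x + F xs) * (f x + F xs)))
      ≡⟨ ∑-cong S (λ x → ∑-cong P (λ xs → expand (f x) (F xs))) ⟩
    ∑ S (λ x → ∑ P (λ xs → f² x + 2 * f x * F xs + F² xs))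
      ≡⟨ ∑-cong S (λ x → trans (∑-+ P _ F²) (cong (_+ ∑ P F²) (trans (∑-+ P _ _)
           (cong₂ _+_ (∑-const P (f² x)) (∑-* P (2 * f x) F))))) ⟩
    ∑ S (λ x → R * f² x + 2 * f x * ∑ P F + ∑ P F²)
      ≡⟨ trans (∑-+ S _ _)
           (cong₂ _+_ (trans (∑-+ S _ _) (cong (_+ ∑ S (λ x → 2 * f x * ∑ P F)) (∑-* S R f²)))
           (∑-const S _)) ⟩
    R * ∑ S f² + ∑ S (λ x → 2 * f x * ∑ P F) + N * ∑ P F²
      ≡⟨ cong (λ z → R * ∑ S f² + z + N * ∑ P F²) cross ⟩
    R * ∑ S f² + 2 * (∑ S f * ∑ P F) + N * ∑ P F² ∎
    where
    open ≡-Reasoning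
    expand : ∀ a b → (a + b) * (a + b) ≡ a * a + 2 * a * b + b * b
    expand = solve 2 (λ a b → (a :+ b) :* (a :+ b) := a :* a :+ con 2 :* a :* b :+ b :* b) refl
    comm : ∀ a b → 2 * a * b ≡ 2 * b * a
    comm = solve 2 (λ a b → con 2 :* a :* b := con 2 :* b :* a) refl
    comm′ : ∀ a b → 2 * a * b ≡ 2 * (b * a)
    comm′ = solve 2 (λ a b → con 2 :* a :* b := con 2 :* (b :* a)) refl
    cross : ∑ S (λ x → 2 * f x * ∑ P F) ≡ 2 * (∑ S f * ∑ P F)
    cross = trans (∑-cong S (λ x → comm (f x) (∑ P F)))
      (trans (∑-* S (2 * ∑ P F) f) (comm′ (∑ P F) (∑ S f)))
  le₂ : m * m * ∑ (power S (suc n)) (λ xs → Vec.sum (Vec.map f xs) * Vec.sum (Vec.map f xs))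
        ≤ N * R * ((μ + n * μ) * (μ + n * μ) + (v + n * v))
  le₂ = begin
    m * m * ∑ (power S (suc n)) (λ xs → Vec.sum (Vec.map f xs) * Vec.sum (Vec.map f xs))
      ≡⟨ cong (m * m *_) eq₂ ⟩
    m * m * (R * ∑ S f² + 2 * (∑ S f * ∑ P F) + N * ∑ P F²)
      ≡⟨ ring m R (∑ S f²) (∑ S f) (∑ P F) N (∑ P F²) ⟩
    R * (m * m * ∑ S f²) + 2 * ((m * ∑ S f) * (m * ∑ P F)) + N * (m * m * ∑ P F²)
      ≡⟨ cong (λ z → R * (m * m * ∑ S f²) + 2 * z + N * (m * m * ∑ P F²))
           (cong₂ _*_ (first M) (first ih)) ⟩
    R * (m * m * ∑ S f²) + 2 * ((N * μ) * (R * (n * μ))) + N * (m * m * ∑ P F²)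
      ≤⟨ +-mono-≤ (+-monoˡ-≤ (2 * ((N * μ) * (R * (n * μ)))) (*-monoʳ-≤ R (second M)))
           (*-monoʳ-≤ N (second ih)) ⟩
    R * (N * (μ * μ + v)) + 2 * ((N * μ) * (R * (n * μ))) + N * (R * (n * μ * (n * μ) + n * v))
      ≡⟨ ring′ R N μ v (n * μ) (n * v) ⟩
    N * R * ((μ + n * μ) * (μ + n * μ) + (v + n * v)) ∎
    where
    open ≤-Reasoning
    ring : ∀ m R a b c N d →
           m * m * (R * a + 2 * (b * c) + N * d) ≡ R * (m * m * a) + 2 * ((m * b) * (m * c)) + N *
           (m * m * d)
    ring = solve 7 (λ m R a b c N d → m :* m :* (R :* a :+ con 2 :* (b :* c) :+ N :* d) :=
      R :* (m :* m :* a) :+ con 2 :* ((m :* b) :* (m :* c)) :+ N :* (m :* m :* d)) refl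
    ring′ : ∀ R N a v b w →
            R * (N * (a * a + v)) + 2 * ((N * a) * (R * b)) + N * (R * (b * b + w)) ≡ N * R *
            ((a + b) * (a + b) + (v + w))
    ring′ = solve 6 (λ R N a v b w → R :* (N :* (a :* a :+ v)) :+ con 2 :* ((N :* a) :* (R :* b)) :+
      N :* (R :* (b :* b :+ w)) := N :* R :* ((a :+ b) :* (a :+ b) :+ (v :+ w))) refl

-- Markov's inequality for the square of `m * f x − μ`, with the mixed term moved to the left so
-- that nothing is subtracted: pointwise, `d²` on the bad event plus `2μ(m f)` is at most
-- `(m f)² + μ²`.
chebyshev : ∀ {m μ v} {S : Space X} {f : X → ℕ} → Moments m S f μ v →
            ∀ t d → μ + d ≤ m * t → ∑ S (λ x → 𝟙 (t ≤ᵇ f x)) * (d * d) ≤ card S * v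
chebyshev {m = m} {μ} {v} {S} {f} M t d gap = +-cancelʳ-≤ (card S * (2 * (μ * μ))) _ _ (begin
  bad * (d * d) + card S * (2 * (μ * μ))
    ≡⟨ cong (bad * (d * d) +_) (trans (ring₁ (card S) μ) (cong (2 * μ *_) (sym (first M)))) ⟩
  bad * (d * d) + 2 * μ * (m * ∑ S f)
    ≡⟨ cong₂ _+_ (trans (*-comm bad _) (sym (∑-* S (d * d) _)))
         (trans (sym (*-assoc (2 * μ) m _)) (sym (∑-* S (2 * μ * m) f))) ⟩
  ∑ S (λ x → d * d * 𝟙 (t ≤ᵇ f x)) + ∑ S (λ x → 2 * μ * m * f x)
    ≡⟨ ∑-+ S _ _ ⟨
  ∑ S (λ x → d * d * 𝟙 (t ≤ᵇ f x) + 2 * μ * m * f x)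
    ≤⟨ ∑-mono S pointwise ⟩
  ∑ S (λ x → m * m * (f x * f x) + μ * μ)
    ≡⟨ trans (∑-+ S _ _) (cong₂ _+_ (∑-* S (m * m) _) (∑-const S _)) ⟩
  m * m * ∑ S (λ x → f x * f x) + card S * (μ * μ)
    ≤⟨ +-monoˡ-≤ (card S * (μ * μ)) (second M) ⟩
  card S * (μ * μ + v) + card S * (μ * μ)
    ≡⟨ ring₂ (card S) μ v ⟩
  card S * v + card S * (2 * (μ * μ)) ∎)
  where
  open ≤-Reasoning
  bad = ∑ S (λ x → 𝟙 (t ≤ᵇ f x))
  ring₁ : ∀ N a → N * (2 * (a * a)) ≡ 2 * a * (N * a)
  ring₁ = solve 2 (λ N a → N :* (con 2 :* (a :* a)) := con 2 :* a :* (N :* a)) refl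
  ring₂ : ∀ N a v → N * (a * a + v) + N * (a * a) ≡ N * v + N * (2 * (a * a))
  ring₂ = solve 3 (λ N a v → N :* (a :* a :+ v) :+ N :* (a :* a) :=
    N :* v :+ N :* (con 2 :* (a :* a))) refl
  ring₃ : ∀ a m y → 2 * a * m * y ≡ 2 * (m * y * a)
  ring₃ = solve 3 (λ a m y → con 2 :* a :* m :* y := con 2 :* (m :* y :* a)) refl
  ring₄ : ∀ m y a → m * y * (m * y) + a * a ≡ m * m * (y * y) + a * a
  ring₄ = solve 3 (λ m y a → m :* y :* (m :* y) :+ a :* a := m :* m :* (y :* y) :+ a :* a) refl
  ring₅ : ∀ a d e → d * d * 1 + 2 * ((a + d + e) * a) + (2 * d * e + e * e) ≡ (a + d + e) *
          (a + d + e) + a * a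
  ring₅ = solve 3 (λ a d e → d :* d :* con 1 :+ con 2 :* ((a :+ d :+ e) :* a) :+
    (con 2 :* d :* e :+ e :* e) := (a :+ d :+ e) :* (a :+ d :+ e) :+ a :* a) refl
  big : ∀ p → μ + d ≤ p → d * d * 1 + 2 * (p * μ) ≤ p * p + μ * μ
  big p le with e , refl ← m≤n⇒∃[o]m+o≡n le =
    ≤-trans (m≤m+n _ (2 * d * e + e * e)) (≤-reflexive (ring₅ μ d e))
  pointwise : ∀ x → d * d * 𝟙 (t ≤ᵇ f x) + 2 * μ * m * f x ≤ m * m * (f x * f x) + μ * μ
  pointwise x rewrite ring₃ μ m (f x) | sym (ring₄ m (f x) μ) with t ≤ᵇ f x in eq
  ... | true  = big (m * f x) (≤-trans gap (*-monoʳ-≤ m (≤ᵇ⇒≤ t (f x) (true⇒T eq))))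
  ... | false rewrite *-zeroʳ (d * d) = 2xy≤x²+y² (m * f x) μ

∧-true : ∀ {a b} → a ≡ true → b ≡ true → a ∧ b ≡ true
∧-true refl refl = refl

_==_ : Fin n → Fin n → Bool
i == j = does (i ≟ j)

==-refl : (i : Fin n) → (i == i) ≡ true
==-refl i = dec-true (i ≟ i) refl

==⇒≡ : {i j : Fin n} → (i == j) ≡ true → i ≡ j
==⇒≡ {i = i} {j} eq with i ≟ j
... | yes i≡j = i≡j

sum-== : (i : Fin n) → ∑ (uniform n) (λ j → 𝟙 (i == j)) ≡ 1
sum-== {suc n} zero    = trans (∑-suc _) (cong suc (trans (∑-const (uniform n) 0) (*-zeroʳ n)))
sum-== {suc n} (suc i) = trans (∑-suc _) (sum-== i)

small-entry : (f : X → ℕ) (L : ℕ) (xs : Vec X k) →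
              Vec.sum (Vec.map f xs) < k * L → ∃[ i ] f (lookup xs i) < L
small-entry f L (x ∷ xs) lt with f x <? L
... | yes fx<L = zero , fx<L
... | no  fx≮L = case small-entry f L xs (+-cancelˡ-< L _ _ (≤-<-trans (+-monoˡ-≤ _ (≮⇒≥ fx≮L)) lt))
  of
  λ (i , p) → suc i , p

-- Search trees of colours

-- m colours at the leaves, branching suc g.
module Trees (m g : ℕ) where

  Tree : ℕ → Set
  Tree zero    = Fin m
  Tree (suc ℓ) = Vec (Tree ℓ) (suc g)

  trees : ∀ ℓ → Space (Tree ℓ)
  trees zero    = uniform m
  trees (suc ℓ) = power (trees ℓ) (suc g)

  count : ∀ ℓ → (Fin m → ℕ) → Tree ℓ → ℕ
  count zero    x c  = x c
  count (suc ℓ) x ts = Vec.sum (Vec.map (count ℓ x) ts)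

  below : ∀ ℓ → (x y : Fin m → Bool) → Tree (suc ℓ) → Fin (suc g) → Bool
  below ℓ x y ts i = count ℓ (𝟙 ∘ x) (lookup ts i) + count ℓ (𝟙 ∘ y) (lookup ts i) <ᵇ suc g ^ ℓ

  -- x and y are the colours forbidden by Alice's and by Bob's edges.  If fewer
  -- leaves are forbidden (counting twice what both forbid) than there are
  -- leaves, the same is true of some child, and so on down to an allowed leaf.
  find : ∀ ℓ → (x y : Fin m → Bool) → Tree ℓ → Fin m
  find zero    x y c  = c
  find (suc ℓ) x y ts = find ℓ x y (lookup ts (choose (below ℓ x y ts)))

  count-+ : ∀ ℓ x y t → count ℓ (λ c → x c + y c) t ≡ count ℓ x t + count ℓ y t
  count-+ zero    x y c  = refl
  count-+ (suc ℓ) x y ts = go ts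
    where
    ring : ∀ a b c d → (a + b) + (c + d) ≡ (a + c) + (b + d)
    ring = solve 4 (λ a b c d → (a :+ b) :+ (c :+ d) := (a :+ c) :+ (b :+ d)) refl
    go : ∀ {k} (ts : Vec (Tree ℓ) k) → Vec.sum (Vec.map (count ℓ (λ c → x c + y c)) ts) ≡
         Vec.sum (Vec.map (count ℓ x) ts) + Vec.sum (Vec.map (count ℓ y) ts)
    go []       = refl
    go (t ∷ ts) = trans (cong₂ _+_ (count-+ ℓ x y t) (go ts)) (ring (count ℓ x t) _ _ _)

  count-≤ : ∀ ℓ x → (∀ c → x c ≤ 1) → ∀ t → count ℓ x t ≤ suc g ^ ℓ
  count-≤ zero    x x≤1 c  = x≤1 c
  count-≤ (suc ℓ) x x≤1 ts = go ts
    where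
    go : ∀ {k} (ts : Vec (Tree ℓ) k) → Vec.sum (Vec.map (count ℓ x) ts) ≤ k * suc g ^ ℓ
    go []       = z≤n
    go (t ∷ ts) = +-mono-≤ (count-≤ ℓ x x≤1 t) (go ts)

  find-allowed : ∀ ℓ x y t → count ℓ (𝟙 ∘ x) t + count ℓ (𝟙 ∘ y) t < suc g ^ ℓ →
                 x (find ℓ x y t) ≡ false × y (find ℓ x y t) ≡ false
  find-allowed zero x y c lt with x c | y c
  ... | false | false = refl , refl
  ... | true  | _     with s≤s () ← lt
  ... | false | true  with s≤s () ← lt
  find-allowed (suc ℓ) x y ts lt =
    find-allowed ℓ x y (lookup ts (choose (below ℓ x y ts)))
      (<ᵇ⇒< _ _ (true⇒T (choose-sound (below ℓ x y ts) (proj₁ small)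
        (T⇒true (<⇒<ᵇ (proj₂ small))))))
    where
    small : ∃[ i ] count ℓ (𝟙 ∘ x) (lookup ts i) + count ℓ (𝟙 ∘ y) (lookup ts i) < suc g ^ ℓ
    small with i , p ← small-entry (count ℓ (λ c → 𝟙 (x c) + 𝟙 (y c))) (suc g ^ ℓ) ts
                         (subst (_< suc g ^ suc ℓ) (sym (count-+ (suc ℓ) (𝟙 ∘ x) (𝟙 ∘ y) ts)) lt)
      = i , subst (_< suc g ^ ℓ) (count-+ ℓ (𝟙 ∘ x) (𝟙 ∘ y) (lookup ts i)) p

  -- A leaf may be forbidden by both parties, hence the bound 2 on `x`. The second moment of a
  -- single leaf, at most 4, serves as a crude bound on its variance; independence of the leaves
  -- does the rest.
  count-moments : ∀ ℓ (x : Fin m → ℕ) → (∀ c → x c ≤ 2) →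
                  Moments m (trees ℓ) (count ℓ x) (suc g ^ ℓ * ∑ (uniform m) x)
                    (suc g ^ ℓ * (4 * m * m))
  count-moments zero x x≤2 = record
    { first  = cong (m *_) (sym (+-identityʳ _))
    ; second = begin
        m * m * ∑ (uniform m) (λ c → x c * x c)
          ≤⟨ *-monoʳ-≤ (m * m) (∑-mono (uniform m) (λ c → *-mono-≤ (x≤2 c) (x≤2 c))) ⟩
        m * m * ∑ (uniform m) (λ _ → 4)
          ≡⟨ cong (m * m *_) (∑-const (uniform m) 4) ⟩
        m * m * (m * 4)
          ≡⟨ ring m ⟩
        m * (4 * m * m + 0)
          ≤⟨ *-monoʳ-≤ m (m≤n+m (4 * m * m + 0) ((∑ (uniform m) x + 0) * (∑ (uniform m) x + 0))) ⟩
        m * ((∑ (uniform m) x + 0) * (∑ (uniform m) x + 0) + (4 * m * m + 0)) ∎ }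
    where
    open ≤-Reasoning
    ring : ∀ m → m * m * (m * 4) ≡ m * (4 * m * m + 0)
    ring = solve 1 (λ m → m :* m :* (m :* con 4) := m :* (con 4 :* m :* m :+ con 0)) refl
  count-moments (suc ℓ) x x≤2 = subst₂ (Moments m (trees (suc ℓ)) (count (suc ℓ) x))
    (sym (*-assoc (suc g) (suc g ^ ℓ) _)) (sym (*-assoc (suc g) (suc g ^ ℓ) _))
    (moments-power (count-moments ℓ x x≤2) (suc g))

  overfull : ∀ ℓ → (x y : Fin m → Bool) → Tree ℓ → Bool
  overfull ℓ x y t = suc g ^ ℓ ≤ᵇ count ℓ (𝟙 ∘ x) t + count ℓ (𝟙 ∘ y) t

  ¬overfull⇒allowed : ∀ ℓ x y t → overfull ℓ x y t ≡ false →
                      x (find ℓ x y t) ≡ false × y (find ℓ x y t) ≡ false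
  ¬overfull⇒allowed ℓ x y t eq = find-allowed ℓ x y t (≰⇒> λ le →
    case trans (sym (T⇒true (≤⇒≤ᵇ le))) eq of λ ())

  -- With `K * K` leaves, Chebyshev's inequality bounds the failure probability by the square of
  -- `2m/(K s)`. If this ratio is below 1, the square is at most the ratio itself; otherwise the
  -- claim is trivial. The first power is the useful form, since only the expectation of `1/s` is
  -- tracked.
  overfull-rare : ∀ ℓ x y s K → .{{_ : NonZero K}} → K * K ≡ suc g ^ ℓ →
                  ∑ (uniform m) (λ c → 𝟙 (x c) + 𝟙 (y c)) + s ≤ m →
                  ∑ (trees ℓ) (𝟙 ∘ overfull ℓ x y) * (K * s) ≤ card (trees ℓ) * (2 * m)
  overfull-rare ℓ x y s K K² room with K * s ≤? 2 * m
  ... | yes le = *-mono-≤ bad≤N le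
    where
    bad≤N : ∑ (trees ℓ) (𝟙 ∘ overfull ℓ x y) ≤ card (trees ℓ)
    bad≤N = ≤-trans (∑-mono (trees ℓ) (λ t → 𝟙≤1 (overfull ℓ x y t)))
                    (≤-reflexive (trans (∑-const (trees ℓ) 1) (*-identityʳ _)))
  ... | no  ≰ = *-cancelʳ-≤ _ _ (K * s) {{>-nonZero (≤-<-trans z≤n (≰⇒> ≰))}} (begin
    bad * (K * s) * (K * s)
      ≤⟨ *-cancelʳ-≤ _ _ (K * K) {{m*n≢0 K K}} main ⟩
    N * (2 * m) * (2 * m)
      ≤⟨ *-monoʳ-≤ (N * (2 * m)) (<⇒≤ (≰⇒> ≰)) ⟩
    N * (2 * m) * (K * s) ∎)
    where
    open ≤-Reasoning
    N = card (trees ℓ)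
    bad = ∑ (trees ℓ) (𝟙 ∘ overfull ℓ x y)
    z = λ c → 𝟙 (x c) + 𝟙 (y c)
    Sz = ∑ (uniform m) z
    ring₁ : ∀ b K s → b * (K * s) * (K * s) * (K * K) ≡ b * (K * K * s * (K * K * s))
    ring₁ = solve 3 (λ b K s → b :* (K :* s) :* (K :* s) :* (K :* K) :=
      b :* (K :* K :* s :* (K :* K :* s))) refl
    ring₂ : ∀ N k m → N * (k * (4 * m * m)) ≡ N * (2 * m) * (2 * m) * k
    ring₂ = solve 3 (λ N k m → N :* (k :* (con 4 :* m :* m)) :=
      N :* (con 2 :* m) :* (con 2 :* m) :* k) refl
    gap : suc g ^ ℓ * Sz + K * K * s ≤ m * suc g ^ ℓ
    gap = begin
      suc g ^ ℓ * Sz + K * K * s        ≡⟨ cong (λ k → suc g ^ ℓ * Sz + k * s) K² ⟩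
      suc g ^ ℓ * Sz + suc g ^ ℓ * s    ≡⟨ *-distribˡ-+ (suc g ^ ℓ) Sz s ⟨
      suc g ^ ℓ * (Sz + s)              ≤⟨ *-monoʳ-≤ (suc g ^ ℓ) room ⟩
      suc g ^ ℓ * m                     ≡⟨ *-comm (suc g ^ ℓ) m ⟩
      m * suc g ^ ℓ                     ∎
    main : bad * (K * s) * (K * s) * (K * K) ≤ N * (2 * m) * (2 * m) * (K * K)
    main = begin
      bad * (K * s) * (K * s) * (K * K)
        ≡⟨ ring₁ bad K s ⟩
      bad * (K * K * s * (K * K * s))
        ≡⟨ cong (_* (K * K * s * (K * K * s)))
             (∑-cong (trees ℓ) (λ t →
             cong (λ v → 𝟙 (suc g ^ ℓ ≤ᵇ v)) (count-+ ℓ (𝟙 ∘ x) (𝟙 ∘ y) t))) ⟨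
      ∑ (trees ℓ) (λ t → 𝟙 (suc g ^ ℓ ≤ᵇ count ℓ z t)) * (K * K * s * (K * K * s))
        ≤⟨ chebyshev (count-moments ℓ z (λ c → +-mono-≤ (𝟙≤1 (x c)) (𝟙≤1 (y c)))) (suc g ^ ℓ)
             (K * K * s) gap ⟩
      N * (suc g ^ ℓ * (4 * m * m))
        ≡⟨ ring₂ N (suc g ^ ℓ) m ⟩
      N * (2 * m) * (2 * m) * suc g ^ ℓ
        ≡⟨ cong (N * (2 * m) * (2 * m) *_) K² ⟨
      N * (2 * m) * (2 * m) * (K * K) ∎

  relabel : (Fin m → Fin m) → ∀ ℓ → Tree ℓ → Tree ℓ
  relabel φ zero    c  = φ c
  relabel φ (suc ℓ) ts = Vec.map (relabel φ ℓ) ts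

  count-relabel : ∀ φ (x : Fin m → Bool) → (∀ c → x (φ c) ≡ x c) →
                  ∀ ℓ t → count ℓ (𝟙 ∘ x) (relabel φ ℓ t) ≡ count ℓ (𝟙 ∘ x) t
  count-relabel φ x inv zero    c  = cong 𝟙 (inv c)
  count-relabel φ x inv (suc ℓ) ts = cong Vec.sum
    (trans (sym (map-∘ (count ℓ (𝟙 ∘ x)) (relabel φ ℓ) ts)) (map-cong (count-relabel φ x inv ℓ) ts))

  -- The descent reads only numbers of forbidden leaves. A map preserving both forbidden sets
  -- preserves these numbers, so the same children are chosen and only the colour at the leaf is
  -- renamed.
  find-relabel : ∀ φ x y → (∀ c → x (φ c) ≡ x c) → (∀ c → y (φ c) ≡ y c) →
                 ∀ ℓ t → find ℓ x y (relabel φ ℓ t) ≡ φ (find ℓ x y t)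
  find-relabel φ x y xφ yφ zero    c  = refl
  find-relabel φ x y xφ yφ (suc ℓ) ts = begin
    find ℓ x y (lookup (Vec.map (relabel φ ℓ) ts) (choose (below ℓ x y (relabel φ (suc ℓ) ts))))
      ≡⟨ cong (λ i → find ℓ x y (lookup (Vec.map (relabel φ ℓ) ts) i)) (choose-cong below-eq) ⟩
    find ℓ x y (lookup (Vec.map (relabel φ ℓ) ts) i₀)
      ≡⟨ cong (find ℓ x y) (lookup-map i₀ (relabel φ ℓ) ts) ⟩
    find ℓ x y (relabel φ ℓ (lookup ts i₀))
      ≡⟨ find-relabel φ x y xφ yφ ℓ (lookup ts i₀) ⟩
    φ (find ℓ x y (lookup ts i₀)) ∎
    where
    open ≡-Reasoning
    i₀ = choose (below ℓ x y ts)
    below-eq : ∀ i → below ℓ x y (relabel φ (suc ℓ) ts) i ≡ below ℓ x y ts i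
    below-eq i rewrite lookup-map i (relabel φ ℓ) ts =
      cong (_<ᵇ suc g ^ ℓ) (cong₂ _+_ (count-relabel φ x xφ ℓ (lookup ts i))
        (count-relabel φ y yφ ℓ (lookup ts i)))

  ∑-relabel : (π : Permutation m m) → ∀ ℓ f → ∑ (trees ℓ) (f ∘ relabel (π ⟨$⟩ʳ_) ℓ) ≡ ∑ (trees ℓ) f
  ∑-relabel π zero    f = ∑-permute f π
  ∑-relabel π (suc ℓ) f = ∑-power-map (trees ℓ) (relabel (π ⟨$⟩ʳ_) ℓ) (∑-relabel π ℓ) (suc g) f

  allowed : (x y : Fin m → Bool) → Fin m → Bool
  allowed x y c = not (x c) ∧ not (y c)

  hits : ∀ ℓ → (x y : Fin m → Bool) → Fin m → ℕ
  hits ℓ x y c = ∑ (trees ℓ) (λ t → 𝟙 (find ℓ x y t == c))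

  -- Transposing two allowed colours preserves x and y.
  hits-uniform : ∀ ℓ x y c d → allowed x y c ≡ true → allowed x y d ≡ true →
                 hits ℓ x y c ≡ hits ℓ x y d
  hits-uniform ℓ x y c d ac ad = begin
    ∑ (trees ℓ) (λ t → 𝟙 (find ℓ x y t == c))
      ≡⟨ ∑-cong (trees ℓ) (λ t →
           cong 𝟙 (trans (swapped (find ℓ x y t))
           (cong (_== d) (sym (find-relabel φ x y xφ yφ ℓ t))))) ⟩
    ∑ (trees ℓ) (λ t → 𝟙 (find ℓ x y (relabel φ ℓ t) == d))
      ≡⟨ ∑-relabel (transpose c d) ℓ (λ t → 𝟙 (find ℓ x y t == d)) ⟩
    ∑ (trees ℓ) (λ t → 𝟙 (find ℓ x y t == d)) ∎
    where
    open ≡-Reasoning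
    φ = transpose c d ⟨$⟩ʳ_
    unused : ∀ {a b} → not a ∧ not b ≡ true → a ≡ false × b ≡ false
    unused {false} {false} _ = refl , refl
    xc = proj₁ (unused ac)
    xd = proj₁ (unused ad)
    yc = proj₂ (unused {x c} ac)
    yd = proj₂ (unused {x d} ad)
    inv : ∀ (z : Fin m → Bool) → z c ≡ false → z d ≡ false → ∀ e → z (φ e) ≡ z e
    inv z zc zd e with e ≟ c
    ... | yes refl = trans zd (sym zc)
    ... | no _ with e ≟ d
    ...   | yes refl = trans zc (sym zd)
    ...   | no _     = refl
    xφ = inv x xc xd
    yφ = inv y yc yd
    swapped : ∀ e → (e == c) ≡ (φ e == d)
    swapped e with e ≟ c
    ... | yes refl = sym (==-refl d)
    ... | no e≢c with e ≟ d
    ...   | yes refl = sym (dec-false (c ≟ e) (e≢c ∘ sym))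
    ...   | no e≢d   = sym (dec-false (e ≟ d) e≢d)

  -- All allowed colours are found equally often, and together at most once per tree. Overfull trees
  -- are included in the count, so no conditioning on a successful search is needed.
  hits-≤ : ∀ ℓ x y s c → allowed x y c ≡ true → s ≤ ∑ (uniform m) (𝟙 ∘ allowed x y) →
           s * hits ℓ x y c ≤ card (trees ℓ)
  hits-≤ ℓ x y s c ac s≤ = begin
    s * hits ℓ x y c
      ≤⟨ *-monoˡ-≤ (hits ℓ x y c) s≤ ⟩
    ∑ (uniform m) (𝟙 ∘ allowed x y) * hits ℓ x y c
      ≡⟨ trans (*-comm _ (hits ℓ x y c)) (sym (∑-* (uniform m) (hits ℓ x y c) _)) ⟩
    ∑ (uniform m) (λ d → hits ℓ x y c * 𝟙 (allowed x y d))
      ≤⟨ ∑-mono (uniform m) pointwise ⟩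
    ∑ (uniform m) (λ d → hits ℓ x y d)
      ≡⟨ ∑-swap (uniform m) (trees ℓ) _ ⟩
    ∑ (trees ℓ) (λ t → ∑ (uniform m) (λ d → 𝟙 (find ℓ x y t == d)))
      ≡⟨ ∑-cong (trees ℓ) (λ t → sum-== (find ℓ x y t)) ⟩
    ∑ (trees ℓ) (λ _ → 1)
      ≡⟨ trans (∑-const (trees ℓ) 1) (*-identityʳ _) ⟩
    card (trees ℓ) ∎
    where
    open ≤-Reasoning
    pointwise : ∀ d → hits ℓ x y c * 𝟙 (allowed x y d) ≤ hits ℓ x y d
    pointwise d with allowed x y d in ad
    ... | false = ≤-trans (≤-reflexive (*-zeroʳ (hits ℓ x y c))) z≤n
    ... | true  = ≤-reflexive (trans (*-identityʳ _) (hits-uniform ℓ x y c d ac ad))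

  room⇒allowed : ∀ x y s → ∑ (uniform m) (λ c → 𝟙 (x c) + 𝟙 (y c)) + s ≤ m →
                 s ≤ ∑ (uniform m) (𝟙 ∘ allowed x y)
  room⇒allowed x y s room = +-cancelˡ-≤ (∑ (uniform m) (λ c → 𝟙 (x c) + 𝟙 (y c))) s _ (begin
    ∑ (uniform m) (λ c → 𝟙 (x c) + 𝟙 (y c)) + s
      ≤⟨ room ⟩
    m
      ≡⟨ trans (∑-const (uniform m) 1) (*-identityʳ m) ⟨
    ∑ (uniform m) (λ _ → 1)
      ≤⟨ ∑-mono (uniform m) (λ c → split (x c) (y c)) ⟩
    ∑ (uniform m) (λ c → 𝟙 (x c) + 𝟙 (y c) + 𝟙 (allowed x y c))
      ≡⟨ ∑-+ (uniform m) _ _ ⟩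
    ∑ (uniform m) (λ c → 𝟙 (x c) + 𝟙 (y c)) + ∑ (uniform m) (𝟙 ∘ allowed x y) ∎)
    where
    open ≤-Reasoning
    split : ∀ a b → 1 ≤ 𝟙 a + 𝟙 b + 𝟙 (not a ∧ not b)
    split false false = s≤s z≤n
    split false true  = s≤s z≤n
    split true  _     = s≤s z≤n

-- The expected reciprocal of the slack

-- m !/s, an integral multiple of 1/s for 1 ≤ s ≤ m (and 0 for s = 0).
share : ℕ → ℕ → ℕ
share m zero    = 0
share m (suc s) = m ! ℕ./ suc s

*-share : ∀ {m s} → 1 ≤ s → s ≤ m → s * share m s ≡ m !
*-share {m} {suc s} _ s≤m = m*[n/m]≡n {suc s} (∣-trans (m∣m*n (s !)) (m≤n⇒m!∣n! s≤m))

share-antitone : ∀ m {s t} → 1 ≤ s → s ≤ t → share m t ≤ share m s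
share-antitone m {suc s} {suc t} _ s≤t = /-monoʳ-≤ (m !) s≤t

module _ {X : Set} (S : Space X) (active : X → Bool) (N : ℕ)
         (fair : ∀ f → ∑ S (f ∘ active) ≡ N * (f false + f true)) where

  actives : (Fin n → Bool) → Vec X n → ℕ
  actives mask ω = ∑ (uniform _) (λ u → 𝟙 (mask u ∧ active (lookup ω u)))

  fair-card : card S ≡ N * 2
  fair-card = trans (sym (*-identityʳ (card S))) (trans (sym (∑-const S 1)) (fair (λ _ → 1)))

  -- The induction on n needs 1/(s − 2u/3) in place of 1/s, where u is the number
  -- of vertices in the mask; here s = u + suc e.
  harmonic : ∀ m n (mask : Fin n → Bool) e → ∑ (uniform n) (𝟙 ∘ mask) + suc e ≤ m →
             ∑ (power S n) (λ ω → share m (∑ (uniform n) (𝟙 ∘ mask) + suc e ∸ actives mask ω))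
               * (∑ (uniform n) (𝟙 ∘ mask) + 3 * suc e)
             ≤ 3 * (card (power S n) * m !)
  harmonic m zero mask e s≤m
    rewrite ∑-point [] (λ ω → share m (∑ (uniform zero) (𝟙 ∘ mask) + suc e ∸ actives mask ω))
          | ∑-empty (𝟙 ∘ mask) | ∑-empty (λ u → 𝟙 (mask u ∧ active (lookup [] u))) =
    ≤-reflexive (trans (ring (share m (suc e)) (suc e))
      (cong (3 *_) (trans (*-share (s≤s z≤n) s≤m) (sym (+-identityʳ _)))))
    where
    ring : ∀ a s → a * (3 * s) ≡ 3 * (s * a)
    ring = solve 2 (λ a s → a :* (con 3 :* s) := con 3 :* (s :* a)) refl
  harmonic m (suc n) mask e s≤m =
    go (mask zero) (∑ (uniform (suc n)) (𝟙 ∘ mask)) refl (∑-suc (𝟙 ∘ mask)) s≤m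
    where
    open ≤-Reasoning
    mask′ = mask ∘ suc
    u = ∑ (uniform n) (𝟙 ∘ mask′)
    α = actives mask′
    P = power S n
    f : ℕ → Bool → ℕ
    f s b = ∑ P (λ ω → share m (s ∸ (𝟙 b + α ω)))
    unfold : ∀ s b → mask zero ≡ b →
             ∑ (power S (suc n)) (λ ω → share m (s ∸ actives mask ω)) ≡ ∑ S (λ x →
               f s (b ∧ active x))
    unfold s b eq = trans (∑-power S _) (∑-cong S λ x → ∑-cong P λ ω → cong (λ a → share m (s ∸ a))
      (trans (∑-suc _) (cong (λ b → 𝟙 (b ∧ active x) + α ω) eq)))
    go : ∀ b w → mask zero ≡ b → w ≡ 𝟙 (mask zero) + u → w + suc e ≤ m →
         ∑ (power S (suc n)) (λ ω → share m (w + suc e ∸ actives mask ω)) * (w + 3 * suc e)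
         ≤ 3 * (card S * card P * m !)
    go false w eq w≡ s≤m rewrite eq | w≡ | unfold (u + suc e) false eq = begin
      ∑ S (λ x → f (u + suc e) false) * (u + 3 * suc e)
        ≡⟨ cong (_* (u + 3 * suc e)) (∑-const S (f (u + suc e) false)) ⟩
      card S * f (u + suc e) false * (u + 3 * suc e)
        ≡⟨ *-assoc (card S) _ _ ⟩
      card S * (f (u + suc e) false * (u + 3 * suc e))
        ≤⟨ *-monoʳ-≤ (card S) (harmonic m n mask′ e s≤m) ⟩
      card S * (3 * (card P * m !))
        ≡⟨ ring (card S) (card P) (m !) ⟩
      3 * (card S * card P * m !) ∎
      where
      ring : ∀ a b c → a * (3 * (b * c)) ≡ 3 * (a * b * c)
      ring = solve 3 (λ a b c → a :* (con 3 :* (b :* c)) := con 3 :* (a :* b :* c)) refl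
    go true w eq w≡ s≤m rewrite eq | w≡ | unfold (suc u + suc e) true eq = begin
      ∑ S (λ x → f s (active x)) * (suc u + 3 * suc e)
        ≡⟨ cong (_* (suc u + 3 * suc e)) (fair (f s)) ⟩
      N * (f s false + f s true) * (suc u + 3 * suc e)
        ≡⟨ *-assoc N _ _ ⟩
      N * ((f s false + f s true) * (suc u + 3 * suc e))
        ≤⟨ *-monoʳ-≤ N (combine (f s false) (f s true) (u + 3 * suc e) Z
             (≤-trans (*-monoʳ-≤ 3 (s≤s z≤n)) (m≤n+m (3 * suc e) u)) ih₀ ih₁) ⟩
      N * (2 * Z)
        ≡⟨ ring N (card P) (m !) ⟩
      3 * (N * 2 * card P * m !)
        ≡⟨ cong (λ a → 3 * (a * card P * m !)) fair-card ⟨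
      3 * (card S * card P * m !) ∎
      where
      s = suc u + suc e
      Z = 3 * (card P * m !)
      ring : ∀ a b c → a * (2 * (3 * (b * c))) ≡ 3 * (a * 2 * b * c)
      ring = solve 3 (λ a b c → a :* (con 2 :* (con 3 :* (b :* c))) :=
        con 3 :* (a :* con 2 :* b :* c)) refl
      ring₀ : ∀ u e → u + 3 * (1 + (1 + e)) ≡ u + 3 * (1 + e) + 3
      ring₀ = solve 2 (λ u e → u :+ con 3 :* (con 1 :+ (con 1 :+ e)) :=
        u :+ con 3 :* (con 1 :+ e) :+ con 3) refl
      -- An inactive vertex leaves the mask but not the slack, so `e` grows by one and the weight by
      -- 3; an active one lowers the slack too, and `e` stays.
      ih₀ : f s false * (u + 3 * suc e + 3) ≤ Z
      ih₀ = subst₂ (λ s c → ∑ P (λ ω → share m (s ∸ α ω)) * c ≤ Z) (+-suc u (suc e)) (ring₀ u e)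
              (harmonic m n mask′ (suc e) (subst (_≤ m) (sym (+-suc u (suc e))) s≤m))
      ih₁ : f s true * (u + 3 * suc e) ≤ Z
      ih₁ = harmonic m n mask′ e (≤-trans (n≤1+n _) s≤m)
      -- With `p` the weight in the active case, this is `1/(p + 3) + 1/p ≤ 2/(p + 1)`, which is
      -- equivalent to `3 ≤ p`. The multiple `3 * suc e` in the weight guarantees exactly that.
      combine : ∀ a b p Z → 3 ≤ p → a * (p + 3) ≤ Z → b * p ≤ Z → (a + b) * suc p ≤ 2 * Z
      combine a b _ Z (s≤s (s≤s (s≤s {n = p} z≤n))) ha hb =
        *-cancelʳ-≤ _ _ ((3 + p) * (6 + p)) (begin
        (a + b) * (4 + p) * ((3 + p) * (6 + p))
          ≡⟨ ring₁ a b p ⟩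
        a * ((3 + p) + 3) * ((3 + p) * (4 + p)) + b * (3 + p) * ((4 + p) * (6 + p))
          ≤⟨ +-mono-≤ (*-monoˡ-≤ ((3 + p) * (4 + p)) ha) (*-monoˡ-≤ ((4 + p) * (6 + p)) hb) ⟩
        Z * ((3 + p) * (4 + p)) + Z * ((4 + p) * (6 + p))
          ≤⟨ m≤m+n _ (Z * p) ⟩
        Z * ((3 + p) * (4 + p)) + Z * ((4 + p) * (6 + p)) + Z * p
          ≡⟨ ring₂ Z p ⟩
        2 * Z * ((3 + p) * (6 + p)) ∎)
        where
        ring₁ : ∀ a b p → (a + b) * (4 + p) * ((3 + p) * (6 + p)) ≡ a * ((3 + p) + 3) *
                ((3 + p) * (4 + p)) + b * (3 + p) * ((4 + p) * (6 + p))
        ring₁ = solve 3 (λ a b p → (a :+ b) :* (con 4 :+ p) :* ((con 3 :+ p) :* (con 6 :+ p)) :=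
          a :* ((con 3 :+ p) :+ con 3) :* ((con 3 :+ p) :* (con 4 :+ p)) :+ b :* (con 3 :+ p) :*
          ((con 4 :+ p) :* (con 6 :+ p))) refl
        ring₂ : ∀ Z p → Z * ((3 + p) * (4 + p)) + Z * ((4 + p) * (6 + p)) + Z * p ≡ 2 * Z *
                ((3 + p) * (6 + p))
        ring₂ = solve 2 (λ Z p →
          Z :* ((con 3 :+ p) :* (con 4 :+ p)) :+ Z :* ((con 4 :+ p) :* (con 6 :+ p)) :+ Z :* p :=
          con 2 :* Z :* ((con 3 :+ p) :* (con 6 :+ p))) refl

  -- For `s = u + suc e` the weight `u + 3 * suc e` in `harmonic` is at least `s`, so the corrected
  -- reciprocal is traded for the plain one at the price of the factor 3.
  harmonic-share : ∀ {m} n (mask : Fin n → Bool) s → ∑ (uniform n) (𝟙 ∘ mask) < s → s ≤ m →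
                   ∑ (power S n) (λ ω → share m (s ∸ actives mask ω)) ≤ 3 *
                     (card (power S n) * share m s)
  harmonic-share {m} n mask s u<s s≤m with e , refl ← m≤n⇒∃[o]m+o≡n u<s =
    *-cancelʳ-≤ _ _ (suc u + e) (begin
    F * (suc u + e)
      ≤⟨ *-monoʳ-≤ F (≤-trans (≤-reflexive (sym (+-suc u e))) (+-monoʳ-≤ u (m≤n*m (suc e) 3))) ⟩
    F * (u + 3 * suc e)
      ≡⟨ cong (λ s → ∑ (power S n) (λ ω → share m (s ∸ actives mask ω)) * (u + 3 * suc e))
           (+-suc u e) ⟨
    ∑ (power S n) (λ ω → share m (u + suc e ∸ actives mask ω)) * (u + 3 * suc e)
      ≤⟨ harmonic m n mask e (subst (_≤ m) (sym (+-suc u e)) s≤m) ⟩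
    3 * (card (power S n) * m !)
      ≡⟨ cong (λ h → 3 * (card (power S n) * h)) (*-share (s≤s z≤n) s≤m) ⟨
    3 * (card (power S n) * ((suc u + e) * share m (suc u + e)))
      ≡⟨ ring (card (power S n)) (suc u + e) (share m (suc u + e)) ⟩
    3 * (card (power S n) * share m (suc u + e)) * (suc u + e) ∎)
    where
    open ≤-Reasoning
    u = ∑ (uniform n) (𝟙 ∘ mask)
    F = ∑ (power S n) (λ ω → share m (suc u + e ∸ actives mask ω))
    ring : ∀ a s h → 3 * (a * (s * h)) ≡ 3 * (a * h) * s
    ring = solve 3 (λ a s h → con 3 :* (a :* (s :* h)) := con 3 :* (a :* h) :* s) refl

any : (Fin n → Bool) → Bool
any {zero}  P = false
any {suc n} P = P zero ∨ any (P ∘ suc)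

any⁺ : (P : Fin n → Bool) (i : Fin n) → P i ≡ true → any P ≡ true
any⁺ P zero    p rewrite p = refl
any⁺ P (suc i) p rewrite any⁺ (P ∘ suc) i p = ∨-zeroʳ (P zero)

any⁻ : (P : Fin n → Bool) → any P ≡ true → ∃[ i ] P i ≡ true
any⁻ {suc n} P p with P zero in eq
... | true  = zero , eq
... | false with i , q ← any⁻ (P ∘ suc) p = suc i , q

any-none : (P : Fin n → Bool) → any P ≡ false → ∀ i → P i ≡ false
any-none P none i with P i in eq
... | false = refl
... | true with () ← trans (sym (any⁺ P i eq)) none

any-cong : {P Q : Fin n → Bool} → (∀ i → P i ≡ Q i) → any P ≡ any Q
any-cong {zero}  P≗Q = refl
any-cong {suc n} P≗Q = cong₂ _∨_ (P≗Q zero) (any-cong (P≗Q ∘ suc))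

𝟙-any : (P : Fin n → Bool) → 𝟙 (any P) ≤ ∑ (uniform n) (𝟙 ∘ P)
𝟙-any P with any P in eq
... | false = z≤n
... | true with i , p ← any⁻ P eq = ≤-trans (≤-reflexive (cong 𝟙 (sym p))) (term≤∑ (𝟙 ∘ P) i)

∧⁻ : ∀ {a b} → a ∧ b ≡ true → a ≡ true × b ≡ true
∧⁻ {true} {true} _ = refl , refl

-- One colour trial

EdgeSet : ℕ → Set
EdgeSet n = Fin n → Fin n → Bool

State : ℕ → ℕ → Set
State n κ = Vec (Maybe (Fin κ)) n

isOpen : Maybe (Fin κ) → Bool
isOpen nothing  = true
isOpen (just _) = false

hasColour : Maybe (Fin κ) → Fin κ → Bool
hasColour nothing  c = false
hasColour (just d) c = d == c

used : EdgeSet n → State n κ → Fin n → Fin κ → Bool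
used e σ v c = any (λ u → e v u ∧ hasColour (lookup σ u) c)

-- A neighbour blocks `v` by holding the same tentative colour, even if that neighbour is itself
-- rejected. Each party can thus decide its clashes from its own edges and the public colours,
-- without knowing who is accepted.
clash : EdgeSet n → State n κ → (Fin n → Bool) → (Fin n → Fin κ) → Fin n → Bool
clash e σ act τ v = any (λ u → e v u ∧ (isOpen (lookup σ u) ∧ (act u ∧ (τ u == τ v))))

permits : EdgeSet n → State n κ → (Fin n → Bool) → (Fin n → Fin κ) → Fin n → Bool
permits e σ act τ v = not (used e σ v (τ v)) ∧ not (clash e σ act τ v)

assign : Bool → Fin κ → Maybe (Fin κ) → Maybe (Fin κ)
assign b     c (just d) = just d
assign true  c nothing  = just c
assign false c nothing  = nothing

update : State n κ → (Fin n → Bool) → (Fin n → Fin κ) → State n κ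
update σ ok τ = tabulate (λ v → assign (ok v) (τ v) (lookup σ v))

update-cong : (σ : State n κ) {ok ok′ : Fin n → Bool} {τ τ′ : Fin n → Fin κ} →
              (∀ v → lookup σ v ≡ nothing → ok v ≡ ok′ v) →
                (∀ v → lookup σ v ≡ nothing → τ v ≡ τ′ v) →
              ∀ v → assign (ok v) (τ v) (lookup σ v) ≡ assign (ok′ v) (τ′ v) (lookup σ v)
update-cong σ ok≗ τ≗ v with lookup σ v in eq
... | just _  = refl
... | nothing = cong₂ (λ b c → assign b c nothing) (ok≗ v eq) (τ≗ v eq)

Partial : EdgeSet n → State n κ → Set
Partial e σ = ∀ {u v c d} → e u v ≡ true → lookup σ u ≡ just c → lookup σ v ≡ just d → c ≢ d

module Step (n Δ g L : ℕ) where

  open Trees (suc Δ) g public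

  Seed : Set
  Seed = Fin 2 × Tree L

  seeds : Space Seed
  seeds = uniform 2 ⊗ trees L

  active : Seed → Bool
  active (zero  , _) = true
  active (suc _ , _) = false

  tentative : (e₁ e₂ : EdgeSet n) → State n (suc Δ) → Vec Seed n → Fin n → Fin (suc Δ)
  tentative e₁ e₂ σ ω v = find L (used e₁ σ v) (used e₂ σ v) (proj₂ (lookup ω v))

  accepted : (e₁ e₂ : EdgeSet n) → State n (suc Δ) → Vec Seed n → Fin n → Bool
  accepted e₁ e₂ σ ω v = active (lookup ω v) ∧
    (permits e₁ σ (active ∘ lookup ω) (tentative e₁ e₂ σ ω) v ∧ permits e₂ σ (active ∘ lookup ω)
      (tentative e₁ e₂ σ ω) v)

  step : (e₁ e₂ : EdgeSet n) → State n (suc Δ) → Vec Seed n → State n (suc Δ)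
  step e₁ e₂ σ ω = update σ (accepted e₁ e₂ σ ω) (tentative e₁ e₂ σ ω)

  active-fair : ∀ f → ∑ seeds (f ∘ active) ≡ card (trees L) * (f false + f true)
  active-fair f = begin
    ∑ seeds (f ∘ active)
      ≡⟨ ∑-⊗ (uniform 2) (trees L) (f ∘ active) ⟩
    ∑ (uniform 2) (λ b → ∑ (trees L) (λ t → f (active (b , t))))
      ≡⟨ trans (∑-suc _) (cong (∑ (trees L) (λ _ → f true) +_) (trans (∑-suc _)
           (cong (∑ (trees L) (λ _ → f false) +_) (∑-empty _)))) ⟩
    ∑ (trees L) (λ _ → f true) + (∑ (trees L) (λ _ → f false) + 0)
      ≡⟨ cong₂ (λ a b → a + (b + 0)) (∑-const (trees L) (f true)) (∑-const (trees L) (f false)) ⟩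
    card (trees L) * f true + (card (trees L) * f false + 0)
      ≡⟨ ring (card (trees L)) (f true) (f false) ⟩
    card (trees L) * (f false + f true) ∎
    where
    open ≡-Reasoning
    ring : ∀ N a b → N * a + (N * b + 0) ≡ N * (b + a)
    ring = solve 3 (λ N a b → N :* a :+ (N :* b :+ con 0) := N :* (b :+ a)) refl

-- Invariants of a trial: properness and slack

record Instance (n Δ : ℕ) (e₁ e₂ : EdgeSet n) : Set where
  field
    symmetricʳ : ∀ u v → e₁ u v ∨ e₂ u v ≡ true → e₁ v u ∨ e₂ v u ≡ true
    loopless₁  : ∀ v → e₁ v v ≡ false
    loopless₂  : ∀ v → e₂ v v ≡ false
    disjoint   : ∀ u v → 𝟙 (e₁ u v) + 𝟙 (e₂ u v) ≤ 𝟙 (e₁ u v ∨ e₂ u v)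
    degree≤    : ∀ v → ∑ (uniform n) (λ u → 𝟙 (e₁ v u ∨ e₂ v u)) ≤ Δ

module Analysis {n Δ g L : ℕ} {e₁ e₂ : EdgeSet n} (I : Instance n Δ e₁ e₂) where

  open Instance I
  open Step n Δ g L

  private
    m = suc Δ
    N = card (trees L)
    Ω = power seeds n

  edge : EdgeSet n
  edge u v = e₁ u v ∨ e₂ u v

  edge⁻ : ∀ {u v} → edge u v ≡ true → e₁ u v ≡ true ⊎ e₂ u v ≡ true
  edge⁻ {u} {v} uv with e₁ u v
  ... | true  = inj₁ refl
  ... | false = inj₂ uv

  stepped : State n m → Vec Seed n → State n m
  stepped = step e₁ e₂

  τ : State n m → Vec Seed n → Fin n → Fin m
  τ = tentative e₁ e₂

  unused : ∀ (e : EdgeSet n) (σ : State n m) act (t : Fin n → Fin m) v →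
           permits e σ act t v ≡ true →
           ∀ u → e v u ≡ true → hasColour (lookup σ u) (t v) ≡ false
  unused e σ act t v p u vu with used e σ v (t v) in eq
  ... | false = trans (cong (_∧ hasColour (lookup σ u) (t v)) (sym vu)) (any-none _ eq u)

  unclashed : ∀ (e : EdgeSet n) (σ : State n m) act (t : Fin n → Fin m) v →
              permits e σ act t v ≡ true →
              ∀ u → e v u ≡ true → lookup σ u ≡ nothing → act u ≡ true → (t u == t v) ≡ false
  unclashed e σ act t v p u vu σu au with used e σ v (t v) | clash e σ act t v in eq
  ... | false | false =
    trans (cong₂ _∧_ (sym vu) (cong₂ _∧_ (sym (cong isOpen σu)) (cong (_∧ (t u == t v)) (sym au))))
    (any-none _ eq u)

  accepted⁻ : ∀ σ ω v → accepted e₁ e₂ σ ω v ≡ true →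
              active (lookup ω v) ≡ true × permits e₁ σ (active ∘ lookup ω) (τ σ ω) v ≡ true
                × permits e₂ σ (active ∘ lookup ω) (τ σ ω) v ≡ true
  accepted⁻ σ ω v acc with active (lookup ω v) | acc
  ... | true | acc′ = refl , ∧⁻ {permits e₁ σ (active ∘ lookup ω) (τ σ ω) v} acc′

  data Source (σ : State n m) (ω : Vec Seed n) (v : Fin n) (c : Fin m) : Set where
    old : lookup σ v ≡ just c → Source σ ω v c
    new : lookup σ v ≡ nothing → accepted e₁ e₂ σ ω v ≡ true → τ σ ω v ≡ c → Source σ ω v c

  source : ∀ σ ω v {c} → lookup (stepped σ ω) v ≡ just c → Source σ ω v c
  source σ ω v eq = go (lookup σ v) (accepted e₁ e₂ σ ω v) refl refl
    (trans (sym (lookup∘tabulate (λ v → assign (accepted e₁ e₂ σ ω v) (τ σ ω v) (lookup σ v)) v))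
      eq)
    where
    go : ∀ {c} s b → lookup σ v ≡ s → accepted e₁ e₂ σ ω v ≡ b → assign b (τ σ ω v) s ≡ just c →
         Source σ ω v c
    go (just d) b     σv acc refl = old σv
    go nothing  true  σv acc refl = new σv acc refl

  step-old : ∀ σ ω v {c} → lookup σ v ≡ just c → lookup (stepped σ ω) v ≡ just c
  step-old σ ω v σv =
    trans (lookup∘tabulate _ v) (cong (assign (accepted e₁ e₂ σ ω v) (τ σ ω v)) σv)

  step-partial : ∀ σ ω → Partial edge σ → Partial edge (stepped σ ω)
  step-partial σ ω P {u} {v} uv su sv = go (source σ ω u su) (source σ ω v sv)
    where
    new-old : ∀ {u v c} → edge u v ≡ true → accepted e₁ e₂ σ ω u ≡ true → lookup σ v ≡ just c →
              c ≢ τ σ ω u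
    new-old {u} {v} {c} uv acc σv c≡ with edge⁻ uv | proj₂ (accepted⁻ σ ω u acc)
    ... | inj₁ uv₁ | p₁ , p₂ = case trans (sym (unused e₁ σ (active ∘ lookup ω) (τ σ ω) u p₁ v uv₁))
      (trans (cong (λ s → hasColour s (τ σ ω u)) σv)
      (subst (λ d → (d == τ σ ω u) ≡ true) (sym c≡) (==-refl (τ σ ω u)))) of λ ()
    ... | inj₂ uv₂ | p₁ , p₂ = case trans (sym (unused e₂ σ (active ∘ lookup ω) (τ σ ω) u p₂ v uv₂))
      (trans (cong (λ s → hasColour s (τ σ ω u)) σv)
      (subst (λ d → (d == τ σ ω u) ≡ true) (sym c≡) (==-refl (τ σ ω u)))) of λ ()
    new-new : ∀ {u v} → edge u v ≡ true → accepted e₁ e₂ σ ω u ≡ true →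
              accepted e₁ e₂ σ ω v ≡ true →
              lookup σ v ≡ nothing → τ σ ω v ≢ τ σ ω u
    new-new {u} {v} uv acc acc′ σv eq with edge⁻ uv | proj₂ (accepted⁻ σ ω u acc)
    ... | inj₁ uv₁ | p₁ , p₂ =
      case trans (sym (unclashed e₁ σ (active ∘ lookup ω) (τ σ ω) u p₁ v uv₁ σv
      (proj₁ (accepted⁻ σ ω v acc′)))) (trans (cong (_== τ σ ω u) eq) (==-refl (τ σ ω u))) of λ ()
    ... | inj₂ uv₂ | p₁ , p₂ =
      case trans (sym (unclashed e₂ σ (active ∘ lookup ω) (τ σ ω) u p₂ v uv₂ σv
      (proj₁ (accepted⁻ σ ω v acc′)))) (trans (cong (_== τ σ ω u) eq) (==-refl (τ σ ω u))) of λ ()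
    go : ∀ {c d} → Source σ ω u c → Source σ ω v d → c ≢ d
    go (old σu)        (old σv)          = P uv σu σv
    go (old σu)        (new σv acc refl) = new-old (symmetricʳ u v uv) acc σu
    go (new σu acc refl) (old σv)        = new-old uv acc σv ∘ sym
    go (new σu acc refl) (new σv acc′ refl) = new-new uv acc acc′ σv ∘ sym

  openAt : State n m → Fin n → Bool
  openAt σ v = isOpen (lookup σ v)

  colouredNbrs openNbrs slack : State n m → Fin n → ℕ
  colouredNbrs σ v = ∑ (uniform n) (λ u → 𝟙 (edge v u ∧ not (openAt σ u)))
  openNbrs     σ v = ∑ (uniform n) (λ u → 𝟙 (edge v u ∧ openAt σ u))
  slack        σ v = m ∸ colouredNbrs σ v

  openMask : State n m → Fin n → Fin n → Bool
  openMask σ v u = edge v u ∧ openAt σ u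

  coloured+open : ∀ σ v → colouredNbrs σ v + openNbrs σ v ≤ Δ
  coloured+open σ v = ≤-trans (≤-reflexive (trans (sym (∑-+ (uniform n) _ _))
    (∑-cong (uniform n) (λ u → split (edge v u) (openAt σ u))))) (degree≤ v)
    where
    split : ∀ a b → 𝟙 (a ∧ not b) + 𝟙 (a ∧ b) ≡ 𝟙 a
    split false b     = refl
    split true  false = refl
    split true  true  = refl

  coloured+slack : ∀ σ v → colouredNbrs σ v + slack σ v ≡ m
  coloured+slack σ v =
    m+[n∸m]≡n (≤-trans (m≤m+n _ (openNbrs σ v)) (≤-trans (coloured+open σ v) (n≤1+n Δ)))

  -- The place where one colour more than the degree is used. The strictness keeps the slack
  -- positive even if all open neighbours get coloured, so its reciprocal is always meaningful.
  open<slack : ∀ σ v → openNbrs σ v < slack σ v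
  open<slack σ v = +-cancelˡ-≤ (colouredNbrs σ v) _ _ (≤-trans (≤-reflexive (+-suc _ _))
    (≤-trans (s≤s (coloured+open σ v)) (≤-reflexive (sym (coloured+slack σ v)))))

  slack≤m : ∀ σ v → slack σ v ≤ m
  slack≤m σ v = m∸n≤m m (colouredNbrs σ v)

  1≤slack : ∀ σ v → 1 ≤ slack σ v
  1≤slack σ v = ≤-trans (s≤s z≤n) (open<slack σ v)

  used-total : ∀ (e : EdgeSet n) (σ : State n m) v →
               ∑ (uniform m) (𝟙 ∘ used e σ v) ≤ ∑ (uniform n) (λ u → 𝟙 (e v u ∧ not (openAt σ u)))
  used-total e σ v = begin
    ∑ (uniform m) (𝟙 ∘ used e σ v)
      ≤⟨ ∑-mono (uniform m) (λ c → 𝟙-any _) ⟩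
    ∑ (uniform m) (λ c → ∑ (uniform n) (λ u → 𝟙 (e v u ∧ hasColour (lookup σ u) c)))
      ≡⟨ ∑-swap (uniform m) (uniform n) _ ⟩
    ∑ (uniform n) (λ u → ∑ (uniform m) (λ c → 𝟙 (e v u ∧ hasColour (lookup σ u) c)))
      ≤⟨ ∑-mono (uniform n) (λ u → one (e v u) (lookup σ u)) ⟩
    ∑ (uniform n) (λ u → 𝟙 (e v u ∧ not (openAt σ u))) ∎
    where
    open ≤-Reasoning
    none : ∑ (uniform m) (λ _ → 0) ≤ 0
    none = ≤-reflexive (trans (∑-const (uniform m) 0) (*-zeroʳ m))
    one : ∀ a s → ∑ (uniform m) (λ c → 𝟙 (a ∧ hasColour s c)) ≤ 𝟙 (a ∧ not (isOpen s))
    one false s        = none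
    one true  nothing  = none
    one true  (just d) = ≤-reflexive (sum-== d)

  -- A colour forbidden by both parties counts twice, yet the total fits: it is charged to coloured
  -- neighbours rather than to colours, and each neighbour is joined to `v` by an edge of one party
  -- only. This is what lets the parties add their counts instead of computing a union.
  room : ∀ σ v → ∑ (uniform m) (λ c → 𝟙 (used e₁ σ v c) + 𝟙 (used e₂ σ v c)) + slack σ v ≤ m
  room σ v = ≤-trans (+-monoˡ-≤ (slack σ v) (begin
    ∑ (uniform m) (λ c → 𝟙 (used e₁ σ v c) + 𝟙 (used e₂ σ v c))
      ≡⟨ ∑-+ (uniform m) _ _ ⟩
    ∑ (uniform m) (𝟙 ∘ used e₁ σ v) + ∑ (uniform m) (𝟙 ∘ used e₂ σ v)
      ≤⟨ +-mono-≤ (used-total e₁ σ v) (used-total e₂ σ v) ⟩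
    ∑ (uniform n) (λ u → 𝟙 (e₁ v u ∧ not (openAt σ u))) + ∑ (uniform n) (λ u →
      𝟙 (e₂ v u ∧ not (openAt σ u)))
      ≡⟨ ∑-+ (uniform n) _ _ ⟨
    ∑ (uniform n) (λ u → 𝟙 (e₁ v u ∧ not (openAt σ u)) + 𝟙 (e₂ v u ∧ not (openAt σ u)))
      ≤⟨ ∑-mono (uniform n) (λ u → distribute (e₁ v u) (e₂ v u) (not (openAt σ u)) (disjoint v u)) ⟩
    colouredNbrs σ v ∎)) (≤-reflexive (coloured+slack σ v))
    where
    open ≤-Reasoning
    distribute : ∀ a b c → 𝟙 a + 𝟙 b ≤ 𝟙 (a ∨ b) → 𝟙 (a ∧ c) + 𝟙 (b ∧ c) ≤ 𝟙 ((a ∨ b) ∧ c)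
    distribute false b c h = ≤-refl
    distribute true false c h = ≤-reflexive (+-identityʳ _)
    distribute true true c (s≤s ())

  -- Acceptances at different vertices are correlated through the trees; bounding the loss of slack
  -- by the activity coins alone leaves a sum of independent variables.
  slack-drop : ∀ σ ω v →
               slack σ v ∸ actives seeds active N active-fair (openMask σ v) ω ≤ slack (stepped σ ω)
               v
  slack-drop σ ω v = ≤-trans (≤-reflexive (∸-+-assoc m (colouredNbrs σ v) α)) (∸-monoʳ-≤ m (begin
    colouredNbrs (stepped σ ω) v
      ≤⟨ ∑-mono (uniform n) pointwise ⟩
    ∑ (uniform n) (λ u → 𝟙 (edge v u ∧ not (openAt σ u)) + 𝟙 (openMask σ v u ∧ active (lookup ω u)))
      ≡⟨ ∑-+ (uniform n) _ _ ⟩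
    colouredNbrs σ v + α ∎))
    where
    open ≤-Reasoning
    α = actives seeds active N active-fair (openMask σ v) ω
    pointwise : ∀ u → 𝟙 (edge v u ∧ not (openAt (stepped σ ω) u)) ≤
                      𝟙 (edge v u ∧ not (openAt σ u)) + 𝟙 (openMask σ v u ∧ active (lookup ω u))
    pointwise u rewrite lookup∘tabulate (λ v → assign (accepted e₁ e₂ σ ω v) (τ σ ω v) (lookup σ v))
      u
      with edge v u | lookup σ u | active (lookup ω u)
    ... | false | _       | _ = z≤n
    ... | true  | just _  | _ = s≤s z≤n
    ... | true  | nothing | false = z≤n
    ... | true  | nothing | true  = 𝟙≤1 _

  share-step : ∀ σ v →
               ∑ Ω (λ ω → share m (slack (stepped σ ω) v)) ≤ 3 * (card Ω * share m (slack σ v))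
  share-step σ v = ≤-trans
    (∑-mono Ω (λ ω → share-antitone m (m<n⇒0<n∸m (≤-<-trans (α≤ ω) (open<slack σ v)))
    (slack-drop σ ω v)))
    (harmonic-share seeds active N active-fair n (openMask σ v) (slack σ v) (open<slack σ v)
      (slack≤m σ v))
    where
    α≤ : ∀ ω → actives seeds active N active-fair (openMask σ v) ω ≤ openNbrs σ v
    α≤ ω = ∑-mono (uniform n) (λ u → shrink (openMask σ v u) (active (lookup ω u)))
      where
      shrink : ∀ a b → 𝟙 (a ∧ b) ≤ 𝟙 a
      shrink false b = z≤n
      shrink true  b = 𝟙≤1 b

-- The probability that a vertex stays uncoloured

power-nonZero : (S : Space X) → NonZero (card S) → ∀ n → NonZero (card (power S n))
power-nonZero S nz zero    = _
power-nonZero S nz (suc n) = m*n≢0 (card S) (card (power S n)) {{nz}} {{power-nonZero S nz n}}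

trees-nonZero : ∀ m .{{_ : NonZero m}} g ℓ → NonZero (card (Trees.trees m g ℓ))
trees-nonZero (suc m) g zero    = _
trees-nonZero m       g (suc ℓ) = power-nonZero (Trees.trees m g ℓ) (trees-nonZero m g ℓ) (suc g)

module Decay {n Δ g L : ℕ} {e₁ e₂ : EdgeSet n} (I : Instance n Δ e₁ e₂)
             (K : ℕ) {{K≢0 : NonZero K}} (K² : K * K ≡ suc g ^ L) where

  open Instance I
  open Step n Δ g L
  open Analysis {n} {Δ} {g} {L} I

  private
    m = suc Δ
    N = card (trees L)
    Ω = power seeds n
    instance
      N≢0 : NonZero N
      N≢0 = trees-nonZero m g L

  module _ (σ : State n m) (v : Fin n) (σv : lookup σ v ≡ nothing) where

    private
      s = slack σ v
      x = used e₁ σ v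
      y = used e₂ σ v
      bad = ∑ (trees L) (𝟙 ∘ overfull L x y)
      rem : Vec Seed n → ℕ
      rem ω = 𝟙 (openAt (stepped σ ω) v)
      α : Vec Seed n → ℕ
      α = actives seeds active N active-fair (openMask σ v)

    rejected : ∀ ω t → active (lookup ω v) ≡ true → accepted e₁ e₂ σ ω v ≡ false →
               overfull L x y t ≡ false → τ σ ω v ≡ find L x y t →
               ∃[ u ] openMask σ v u ∧ active (lookup ω u) ≡ true × τ σ ω u ≡ find L x y t
    rejected ω t act rej ok τv = go _ _ refl refl
      where
      free : x (find L x y t) ≡ false × y (find L x y t) ≡ false
      free = ¬overfull⇒allowed L x y t ok
      clash₁ = clash e₁ σ (active ∘ lookup ω) (τ σ ω) v
      clash₂ = clash e₂ σ (active ∘ lookup ω) (τ σ ω) v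
      some : ∀ (e : EdgeSet n) → (∀ u → e v u ≡ true → edge v u ≡ true) →
             clash e σ (active ∘ lookup ω) (τ σ ω) v ≡ true →
             ∃[ u ] openMask σ v u ∧ active (lookup ω u) ≡ true × τ σ ω u ≡ find L x y t
      some e e⇒ eq with u , p ← any⁻ _ eq =
        u , ∧-true (∧-true (e⇒ u (proj₁ (∧⁻ p))) (proj₁ (∧⁻ (proj₂ (∧⁻ {e v u} p)))))
          (proj₁ (∧⁻ (proj₂ (∧⁻ {openAt σ u} (proj₂ (∧⁻ {e v u} p)))))) ,
        trans (==⇒≡ (proj₂ (∧⁻ {active (lookup ω u)}
          (proj₂ (∧⁻ {openAt σ u} (proj₂ (∧⁻ {e v u} p))))))) τv
      accepts : clash₁ ≡ false → clash₂ ≡ false → accepted e₁ e₂ σ ω v ≡ true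
      accepts c₁ c₂ = ∧-true act (∧-true
        (∧-true (cong not (trans (cong x τv) (proj₁ free))) (cong not c₁))
        (∧-true (cong not (trans (cong y τv) (proj₂ free))) (cong not c₂)))
      go : ∀ b₁ b₂ → clash₁ ≡ b₁ → clash₂ ≡ b₂ →
           ∃[ u ] openMask σ v u ∧ active (lookup ω u) ≡ true × τ σ ω u ≡ find L x y t
      go true  _     c₁ c₂ = some e₁ (λ u p → cong (_∨ e₂ v u) p) c₁
      go false true  c₁ c₂ = some e₂ (λ u p → trans (cong (e₁ v u ∨_) p) (∨-zeroʳ _)) c₂
      go false false c₁ c₂ with () ← trans (sym rej) (accepts c₁ c₂)

    -- The first factor does not involve `t` and comes out of the sum over trees. The test `allowed`
    -- makes the bound valid for every colour of `u`, including one that `v` could find only by a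
    -- failed search.
    hit : Vec Seed n → Fin n → Tree L → ℕ
    hit ω u t = 𝟙 (openMask σ v u ∧ active (lookup ω u)) * 𝟙
      (allowed x y (τ σ ω u) ∧ (find L x y t == τ σ ω u))

    remains≤ : ∀ ω t → rem (ω [ v ]≔ (zero , t)) ≤ 𝟙 (overfull L x y t) + ∑ (uniform n) (λ u →
               hit ω u t)
    remains≤ ω t = go _ _ refl refl
      where
      ω′ = ω [ v ]≔ (zero , t)
      seedv : lookup ω′ v ≡ (zero , t)
      seedv = lookup∘update v ω (zero , t)
      rem≡ : ∀ {b} → accepted e₁ e₂ σ ω′ v ≡ b → rem ω′ ≡ 𝟙 (isOpen (assign b (τ σ ω′ v) nothing))
      rem≡ eq = cong (𝟙 ∘ isOpen)
        (trans (lookup∘tabulate _ v) (cong₂ (λ b s → assign b (τ σ ω′ v) s) eq σv))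
      go : ∀ b₁ b₂ → overfull L x y t ≡ b₁ → accepted e₁ e₂ σ ω′ v ≡ b₂ →
           rem ω′ ≤ 𝟙 (overfull L x y t) + ∑ (uniform n) (λ u → hit ω u t)
      go b₁    true  ov acc = ≤-trans (≤-reflexive (rem≡ acc)) z≤n
      go true  false ov acc = ≤-trans (𝟙≤1 _) (≤-trans (≤-reflexive (cong 𝟙 (sym ov))) (m≤m+n _ _))
      go false false ov acc
        with u , p , q ← rejected ω′ t (cong active seedv) acc ov (cong (find L x y ∘ proj₂) seedv)
          =
        ≤-trans (𝟙≤1 _) (≤-trans (≤-reflexive (sym hit≡1))
          (≤-trans (term≤∑ (λ u → hit ω u t) u) (m≤n+m _ _)))
        where
        -- Since there are no loops, the colour found by `u` does not change when the seed of `v` is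
        -- redrawn.
        u≢v : u ≢ v
        u≢v refl with edge⁻ (proj₁ (∧⁻ (proj₁ (∧⁻ p))))
        ... | inj₁ vv = case trans (sym (loopless₁ v)) vv of λ ()
        ... | inj₂ vv = case trans (sym (loopless₂ v)) vv of λ ()
        seedu : lookup ω′ u ≡ lookup ω u
        seedu = lookup∘update′ u≢v ω (zero , t)
        τu : τ σ ω u ≡ find L x y t
        τu = trans (cong (find L (used e₁ σ u) (used e₂ σ u) ∘ proj₂) (sym seedu)) q
        free = ¬overfull⇒allowed L x y t ov
        hit≡1 : hit ω u t ≡ 1
        hit≡1 = cong₂ (λ a b → 𝟙 a * 𝟙 b)
          (trans (cong (λ z → openMask σ v u ∧ active z) (sym seedu)) p)
          (∧-true (trans (cong (allowed x y) τu)
            (∧-true (cong not (proj₁ free)) (cong not (proj₂ free))))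
                  (trans (cong (find L x y t ==_) τu) (==-refl (find L x y t))))

    hits-bound : ∀ c → s * ∑ (trees L) (λ t → 𝟙 (allowed x y c ∧ (find L x y t == c))) ≤ N
    hits-bound c with allowed x y c in eq
    ... | true  = hits-≤ L x y s c eq (room⇒allowed x y s (room σ v))
    ... | false = ≤-trans
      (≤-reflexive (trans (cong (s *_) (trans (∑-const (trees L) 0) (*-zeroʳ N))) (*-zeroʳ s))) z≤n

    -- While the tree of `v` varies, the colour of each neighbour is a constant. Hence each active
    -- open neighbour blocks at most a fraction `1/s` of the trees of `v`, whatever the distribution
    -- of the neighbours' colours.
    active-remains : ∀ ω → s * ∑ (trees L) (λ t → rem (ω [ v ]≔ (zero , t))) ≤ s * bad + α ω * N
    active-remains ω = begin
      s * ∑ (trees L) (λ t → rem (ω [ v ]≔ (zero , t)))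
        ≤⟨ *-monoʳ-≤ s (∑-mono (trees L) (remains≤ ω)) ⟩
      s * ∑ (trees L) (λ t → 𝟙 (overfull L x y t) + ∑ (uniform n) (λ u → hit ω u t))
        ≡⟨ cong (s *_) (trans (∑-+ (trees L) _ _) (cong (bad +_) (∑-swap (trees L) (uniform n) _)))
             ⟩
      s * (bad + ∑ (uniform n) (λ u → ∑ (trees L) (hit ω u)))
        ≡⟨ trans (*-distribˡ-+ s bad _) (cong (s * bad +_) (sym (∑-* (uniform n) s _))) ⟩
      s * bad + ∑ (uniform n) (λ u → s * ∑ (trees L) (hit ω u))
        ≤⟨ +-monoʳ-≤ (s * bad) (∑-mono (uniform n) pointwise) ⟩
      s * bad + ∑ (uniform n) (λ u → N * 𝟙 (openMask σ v u ∧ active (lookup ω u)))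
        ≡⟨ cong (s * bad +_) (trans (∑-* (uniform n) N _) (*-comm N _)) ⟩
      s * bad + α ω * N ∎
      where
      open ≤-Reasoning
      ring : ∀ s a h → s * (a * h) ≡ a * (s * h)
      ring = solve 3 (λ s a h → s :* (a :* h) := a :* (s :* h)) refl
      pointwise : ∀ u → s * ∑ (trees L) (hit ω u) ≤ N * 𝟙 (openMask σ v u ∧ active (lookup ω u))
      pointwise u = begin
        s * ∑ (trees L) (hit ω u)
          ≡⟨ trans (cong (s *_) (∑-* (trees L) a _)) (ring s a _) ⟩
        a * (s * ∑ (trees L) (λ t → 𝟙 (allowed x y (τ σ ω u) ∧ (find L x y t == τ σ ω u))))
          ≤⟨ *-monoʳ-≤ a (hits-bound (τ σ ω u)) ⟩
        a * N
          ≡⟨ *-comm a N ⟩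
        N * a ∎
        where a = 𝟙 (openMask σ v u ∧ active (lookup ω u))

    inactive-remains : ∀ ω → ∑ (trees L) (λ t → rem (ω [ v ]≔ (suc zero , t))) ≤ N
    inactive-remains ω =
      ≤-trans (∑-mono (trees L) (λ t → 𝟙≤1 _))
      (≤-reflexive (trans (∑-const (trees L) 1) (*-identityʳ N)))

    resampled : ∀ ω → s * ∑ seeds (λ z → rem (ω [ v ]≔ z)) ≤ s * N + s * bad + α ω * N
    resampled ω = begin
      s * ∑ seeds (λ z → rem (ω [ v ]≔ z))
        ≡⟨ cong (s *_) (trans (∑-⊗ (uniform 2) (trees L) _)
             (trans (∑-suc _) (cong (A +_) (trans (∑-suc _) (cong (B +_) (∑-empty _)))))) ⟩
      s * (A + (B + 0))
        ≡⟨ ring s A B ⟩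
      s * B + s * A
        ≤⟨ +-mono-≤ (*-monoʳ-≤ s (inactive-remains ω)) (active-remains ω) ⟩
      s * N + (s * bad + α ω * N)
        ≡⟨ +-assoc (s * N) (s * bad) (α ω * N) ⟨
      s * N + s * bad + α ω * N ∎
      where
      open ≤-Reasoning
      A = ∑ (trees L) (λ t → rem (ω [ v ]≔ (zero , t)))
      B = ∑ (trees L) (λ t → rem (ω [ v ]≔ (suc zero , t)))
      ring : ∀ s A B → s * (A + (B + 0)) ≡ s * B + s * A
      ring = solve 3 (λ s A B → s :* (A :+ (B :+ con 0)) := s :* B :+ s :* A) refl

    mean-actives : N * 2 * ∑ Ω α ≡ card Ω * (N * openNbrs σ v)
    mean-actives = begin
      N * 2 * ∑ Ω α
        ≡⟨ cong (N * 2 *_) (∑-swap Ω (uniform n) _) ⟩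
      N * 2 * ∑ (uniform n) (λ u → ∑ Ω (λ ω → 𝟙 (openMask σ v u ∧ active (lookup ω u))))
        ≡⟨ ∑-* (uniform n) (N * 2) _ ⟨
      ∑ (uniform n) (λ u → N * 2 * ∑ Ω (λ ω → 𝟙 (openMask σ v u ∧ active (lookup ω u))))
        ≡⟨ ∑-cong (uniform n) single ⟩
      ∑ (uniform n) (λ u → card Ω * N * 𝟙 (openMask σ v u))
        ≡⟨ trans (∑-* (uniform n) (card Ω * N) _) (*-assoc (card Ω) N _) ⟩
      card Ω * (N * openNbrs σ v) ∎
      where
      open ≡-Reasoning
      half : ∀ b → 𝟙 (b ∧ false) + 𝟙 (b ∧ true) ≡ 𝟙 b
      half false = refl
      half true  = refl
      single : ∀ u → N * 2 * ∑ Ω (λ ω → 𝟙 (openMask σ v u ∧ active (lookup ω u))) ≡ card Ω * N * 𝟙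
               (openMask σ v u)
      single u = begin
        N * 2 * ∑ Ω (λ ω → 𝟙 (openMask σ v u ∧ active (lookup ω u)))
          ≡⟨ cong (_* ∑ Ω (λ ω → 𝟙 (openMask σ v u ∧ active (lookup ω u))))
               (fair-card seeds active N active-fair) ⟨
        card seeds * ∑ Ω (λ ω → 𝟙 (openMask σ v u ∧ active (lookup ω u)))
          ≡⟨ marginal seeds u (λ z → 𝟙 (openMask σ v u ∧ active z)) ⟩
        card Ω * ∑ seeds (λ z → 𝟙 (openMask σ v u ∧ active z))
          ≡⟨ cong (card Ω *_) (trans (active-fair (λ b → 𝟙 (openMask σ v u ∧ b)))
               (cong (N *_) (half (openMask σ v u)))) ⟩
        card Ω * (N * 𝟙 (openMask σ v u))
          ≡⟨ *-assoc (card Ω) N _ ⟨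
        card Ω * N * 𝟙 (openMask σ v u) ∎

    -- The bound is `1/2 + 1/2 * (bad/N + 1/2)`, multiplied by `4 * N`: the first half is
    -- inactivity, and the inner one bounds the mean number of active open neighbours divided by
    -- `s`.
    remain-bad : 4 * N * ∑ Ω rem ≤ card Ω * (3 * N + 2 * bad)
    remain-bad = *-cancelˡ-≤ s {{>-nonZero (1≤slack σ v)}} (begin
      s * (4 * N * R)
        ≡⟨ ring₁ s N R ⟩
      2 * (s * (N * 2 * R))
        ≡⟨ cong (λ a → 2 * (s * (a * R))) (fair-card seeds active N active-fair) ⟨
      2 * (s * (card seeds * R))
        ≡⟨ cong (λ a → 2 * (s * a)) (resample seeds v rem) ⟩
      2 * (s * ∑ Ω (λ ω → ∑ seeds (λ z → rem (ω [ v ]≔ z))))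
        ≡⟨ cong (2 *_) (∑-* Ω s _) ⟨
      2 * ∑ Ω (λ ω → s * ∑ seeds (λ z → rem (ω [ v ]≔ z)))
        ≤⟨ *-monoʳ-≤ 2 (∑-mono Ω resampled) ⟩
      2 * ∑ Ω (λ ω → s * N + s * bad + α ω * N)
        ≡⟨ cong (2 *_) (trans (∑-+ Ω _ _)
             (cong₂ _+_ (∑-const Ω _) (trans (∑-cong Ω (λ ω → *-comm (α ω) N)) (∑-* Ω N α)))) ⟩
      2 * (card Ω * (s * N + s * bad) + N * ∑ Ω α)
        ≡⟨ ring₂ (card Ω) s N bad (∑ Ω α) ⟩
      2 * (card Ω * (s * N + s * bad)) + N * 2 * ∑ Ω α
        ≡⟨ cong (2 * (card Ω * (s * N + s * bad)) +_) mean-actives ⟩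
      2 * (card Ω * (s * N + s * bad)) + card Ω * (N * openNbrs σ v)
        ≤⟨ +-monoʳ-≤ (2 * (card Ω * (s * N + s * bad)))
             (*-monoʳ-≤ (card Ω) (*-monoʳ-≤ N (<⇒≤ (open<slack σ v)))) ⟩
      2 * (card Ω * (s * N + s * bad)) + card Ω * (N * s)
        ≡⟨ ring₃ (card Ω) s N bad ⟩
      s * (card Ω * (3 * N + 2 * bad)) ∎)
      where
      open ≤-Reasoning
      R = ∑ Ω rem
      ring₁ : ∀ s N R → s * (4 * N * R) ≡ 2 * (s * (N * 2 * R))
      ring₁ = solve 3 (λ s N R → s :* (con 4 :* N :* R) := con 2 :* (s :* (N :* con 2 :* R))) refl
      ring₂ : ∀ z s N b a →
              2 * (z * (s * N + s * b) + N * a) ≡ 2 * (z * (s * N + s * b)) + N * 2 * a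
      ring₂ = solve 5 (λ z s N b a → con 2 :* (z :* (s :* N :+ s :* b) :+ N :* a) :=
        con 2 :* (z :* (s :* N :+ s :* b)) :+ N :* con 2 :* a) refl
      ring₃ : ∀ z s N b → 2 * (z * (s * N + s * b)) + z * (N * s) ≡ s * (z * (3 * N + 2 * b))
      ring₃ = solve 4 (λ z s N b → con 2 :* (z :* (s :* N :+ s :* b)) :+ z :* (N :* s) :=
        s :* (z :* (con 3 :* N :+ con 2 :* b))) refl

    -- The failure probability `2m/(K s)` is rewritten by means of `share m s`, which stands for
    -- `m !/s`. The bound is then linear in the two components of the potential.
    remain-rare : 4 * K * (m ! * ∑ Ω rem) ≤ card Ω * (3 * (K * m !) + 4 * (m * share m s))
    remain-rare = *-cancelˡ-≤ N (begin
      N * (4 * K * (m ! * R))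
        ≡⟨ ring₁ N K (m !) R ⟩
      K * m ! * (4 * N * R)
        ≤⟨ *-monoʳ-≤ (K * m !) remain-bad ⟩
      K * m ! * (card Ω * (3 * N + 2 * bad))
        ≡⟨ ring₂ K (m !) (card Ω) N bad ⟩
      card Ω * (3 * (K * m !) * N + 2 * (bad * K * m !))
        ≡⟨ cong (λ h → card Ω * (3 * (K * m !) * N + 2 * (bad * K * h)))
             (*-share (1≤slack σ v) (slack≤m σ v)) ⟨
      card Ω * (3 * (K * m !) * N + 2 * (bad * K * (s * share m s)))
        ≡⟨ cong (λ a → card Ω * (3 * (K * m !) * N + 2 * a)) (ring₃ bad K s (share m s)) ⟩
      card Ω * (3 * (K * m !) * N + 2 * (bad * (K * s) * share m s))
        ≤⟨ *-monoʳ-≤ (card Ω)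
             (+-monoʳ-≤ (3 * (K * m !) * N)
             (*-monoʳ-≤ 2 (*-monoˡ-≤ (share m s) (overfull-rare L x y s K K² (room σ v))))) ⟩
      card Ω * (3 * (K * m !) * N + 2 * (N * (2 * m) * share m s))
        ≡⟨ ring₄ (card Ω) (K * m !) N m (share m s) ⟩
      N * (card Ω * (3 * (K * m !) + 4 * (m * share m s))) ∎)
      where
      open ≤-Reasoning
      R = ∑ Ω rem
      ring₁ : ∀ N K H R → N * (4 * K * (H * R)) ≡ K * H * (4 * N * R)
      ring₁ = solve 4 (λ N K H R → N :* (con 4 :* K :* (H :* R)) := K :* H :* (con 4 :* N :* R))
        refl
      ring₂ : ∀ K H z N b → K * H * (z * (3 * N + 2 * b)) ≡ z * (3 * (K * H) * N + 2 * (b * K * H))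
      ring₂ = solve 5 (λ K H z N b → K :* H :* (z :* (con 3 :* N :+ con 2 :* b)) :=
        z :* (con 3 :* (K :* H) :* N :+ con 2 :* (b :* K :* H))) refl
      ring₃ : ∀ b K s h → b * K * (s * h) ≡ b * (K * s) * h
      ring₃ = solve 4 (λ b K s h → b :* K :* (s :* h) := b :* (K :* s) :* h) refl
      ring₄ : ∀ z A N m h →
              z * (3 * A * N + 2 * (N * (2 * m) * h)) ≡ N * (z * (3 * A + 4 * (m * h)))
      ring₄ = solve 5 (λ z A N m h → z :* (con 3 :* A :* N :+ con 2 :* (N :* (con 2 :* m) :* h)) :=
        N :* (z :* (con 3 :* A :+ con 4 :* (m :* h)))) refl

  potential : ℕ → ℕ → State n m → Fin n → ℕ
  potential a b σ v = 𝟙 (openAt σ v) * (a * m ! + b * share m (slack σ v))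

  -- The hypotheses compare coefficients. In the constant part, `a` pays for this trial and for
  -- remaining open with probability `3/4`. In the part with `1/s`, `b` pays for the tripling of the
  -- reciprocal and for `a′ * m / K`, which failed searches transfer from the constant part.
  potential-step : ∀ w a b a′ b′ → 4 * w + 3 * a′ ≤ 4 * a → a′ * m + 3 * (K * b′) ≤ K * b → ∀ σ v →
                   ∑ Ω (λ ω → 𝟙 (openAt σ v) * (w * m !) + potential a′ b′ (stepped σ ω) v) ≤ card Ω
                     * potential a b σ v
  potential-step w a b a′ b′ ha hb σ v = go (lookup σ v) refl
    where
    open ≤-Reasoning
    H = m !
    z = card Ω
    go : ∀ s → lookup σ v ≡ s →
         ∑ Ω (λ ω → 𝟙 (openAt σ v) * (w * m !) + potential a′ b′ (stepped σ ω) v) ≤ card Ω *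
           potential a b σ v
    go (just c) σv = ≤-trans
      (≤-reflexive (trans (∑-cong Ω vanishes) (trans (∑-const Ω 0) (*-zeroʳ z)))) z≤n
      where
      vanishes : ∀ ω → 𝟙 (openAt σ v) * (w * m !) + potential a′ b′ (stepped σ ω) v ≡ 0
      vanishes ω = cong₂ (λ s t →
        𝟙 (isOpen s) * (w * m !) + 𝟙 (isOpen t) * (a′ * m ! + b′ * share m (slack (stepped σ ω) v)))
                         σv (step-old σ ω v σv)
    go nothing σv = *-cancelˡ-≤ (4 * K) {{m*n≢0 4 K}} (begin
      4 * K * ∑ Ω (λ ω → 𝟙 (openAt σ v) * (w * H) + potential a′ b′ (stepped σ ω) v)
        ≤⟨ *-monoʳ-≤ (4 * K) (∑-mono Ω pointwise) ⟩
      4 * K * ∑ Ω (λ ω → w * H + (a′ * H * rem ω + b′ * share′ ω))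
        ≡⟨ cong (4 * K *_) (trans (∑-+ Ω _ _)
             (cong₂ _+_ (∑-const Ω _)
             (trans (∑-+ Ω _ _) (cong₂ _+_ (∑-* Ω (a′ * H) rem) (∑-* Ω b′ share′))))) ⟩
      4 * K * (z * (w * H) + (a′ * H * ∑ Ω rem + b′ * ∑ Ω share′))
        ≡⟨ ring₁ K z w H a′ b′ (∑ Ω rem) (∑ Ω share′) ⟩
      4 * K * (z * (w * H)) + (a′ * (4 * K * (H * ∑ Ω rem)) + 4 * K * b′ * ∑ Ω share′)
        ≤⟨ +-monoʳ-≤ (4 * K * (z * (w * H)))
             (+-mono-≤ (*-monoʳ-≤ a′ (remain-rare σ v σv))
             (*-monoʳ-≤ (4 * K * b′) (share-step σ v))) ⟩
      4 * K * (z * (w * H)) + (a′ * (z * (3 * (K * H) + 4 * (m * h))) + 4 * K * b′ * (3 * (z * h)))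
        ≡⟨ ring₂ K z w H a′ b′ m h ⟩
      z * (K * H * (4 * w + 3 * a′) + 4 * h * (a′ * m + 3 * (K * b′)))
        ≤⟨ *-monoʳ-≤ z (+-mono-≤ (*-monoʳ-≤ (K * H) ha) (*-monoʳ-≤ (4 * h) hb)) ⟩
      z * (K * H * (4 * a) + 4 * h * (K * b))
        ≡⟨ ring₃ z K H a h b ⟩
      4 * K * (z * (1 * (a * H + b * h)))
        ≡⟨ cong (λ s → 4 * K * (z * (𝟙 (isOpen s) * (a * H + b * h)))) σv ⟨
      4 * K * (z * potential a b σ v) ∎)
      where
      h = share m (slack σ v)
      rem = λ ω → 𝟙 (openAt (stepped σ ω) v)
      share′ = λ ω → share m (slack (stepped σ ω) v)
      -- The indicator in front of the new reciprocal is dropped, so the correlation between staying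
      -- open and losing slack never has to be studied.
      pointwise : ∀ ω → 𝟙 (openAt σ v) * (w * H) + potential a′ b′ (stepped σ ω) v ≤ w * H +
                  (a′ * H * rem ω + b′ * share′ ω)
      pointwise ω = +-mono-≤
        (≤-trans (*-monoˡ-≤ (w * H) (𝟙≤1 (openAt σ v))) (≤-reflexive (*-identityˡ _))) (begin
        rem ω * (a′ * H + b′ * share′ ω)          ≡⟨ *-distribˡ-+ (rem ω) _ _ ⟩
        rem ω * (a′ * H) + rem ω * (b′ * share′ ω) ≤⟨ +-mono-≤ (≤-reflexive (*-comm (rem ω) _))
          (≤-trans (*-monoˡ-≤ (b′ * share′ ω) (𝟙≤1 (openAt (stepped σ ω) v)))
          (≤-reflexive (*-identityˡ _))) ⟩
        a′ * H * rem ω + b′ * share′ ω ∎)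
      ring₁ : ∀ K z w H a b R S →
              4 * K * (z * (w * H) + (a * H * R + b * S)) ≡ 4 * K * (z * (w * H)) +
              (a * (4 * K * (H * R)) + 4 * K * b * S)
      ring₁ = solve 8 (λ K z w H a b R S → con 4 :* K :* (z :* (w :* H) :+ (a :* H :* R :+ b :* S))
        := con 4 :* K :* (z :* (w :* H)) :+ (a :* (con 4 :* K :* (H :* R)) :+ con 4 :* K :* b :* S))
        refl
      ring₂ : ∀ K z w H a b m h →
              4 * K * (z * (w * H)) + (a * (z * (3 * (K * H) + 4 * (m * h))) + 4 * K * b *
              (3 * (z * h))) ≡ z * (K * H * (4 * w + 3 * a) + 4 * h * (a * m + 3 * (K * b)))
      ring₂ = solve 8 (λ K z w H a b m h →
        con 4 :* K :* (z :* (w :* H)) :+ (a :* (z :* (con 3 :* (K :* H) :+ con 4 :* (m :* h))) :+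
        con 4 :* K :* b :* (con 3 :* (z :* h))) :=
        z :* (K :* H :* (con 4 :* w :+ con 3 :* a) :+ con 4 :* h :* (a :* m :+ con 3 :* (K :* b))))
        refl
      ring₃ : ∀ z K H a h b →
              z * (K * H * (4 * a) + 4 * h * (K * b)) ≡ 4 * K * (z * (1 * (a * H + b * h)))
      ring₃ = solve 6 (λ z K H a h b → z :* (K :* H :* (con 4 :* a) :+ con 4 :* h :* (K :* b)) :=
        con 4 :* K :* (z :* (con 1 :* (a :* H :+ b :* h)))) refl

-- Protocols with a publicly known result

-- The length of each message is determined by the transcript so far, which makes messages
-- prefix-free. The result is a function of the transcript alone, so the two outputs agree.
data Program (U V X : Set) : Set where
  return   : X → Program U V X
  exchange : ∀ ℓ → (U → Vec Bool ℓ) → (V → Vec Bool ℓ) →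
             (Vec Bool ℓ → Vec Bool ℓ → Program U V X) → Program U V X

value : Program U V X → U → V → X
value (return r)            x y = r
value (exchange ℓ f g next) x y = value (next (f x) (g y)) x y

cost : Program U V X → U → V → ℕ
cost (return r)            x y = 0
cost (exchange ℓ f g next) x y = ℓ + ℓ + cost (next (f x) (g y)) x y

depth : Program U V X → U → V → ℕ
depth (return r)            x y = 0
depth (exchange ℓ f g next) x y = suc (depth (next (f x) (g y)) x y)

infixl 1 _>>=_
_>>=_ : Program U V X → (X → Program U V Y) → Program U V Y
return r            >>= k = k r
exchange ℓ f g next >>= k = exchange ℓ f g (λ a b → next a b >>= k)

value->>= : (P : Program U V X) (k : X → Program U V Y) → ∀ x y →
            value (P >>= k) x y ≡ value (k (value P x y)) x y
value->>= (return r)            k x y = refl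
value->>= (exchange ℓ f g next) k x y = value->>= (next (f x) (g y)) k x y

cost->>= : (P : Program U V X) (k : X → Program U V Y) → ∀ x y →
           cost (P >>= k) x y ≡ cost P x y + cost (k (value P x y)) x y
cost->>= (return r)            k x y = refl
cost->>= (exchange ℓ f g next) k x y =
  trans (cong (ℓ + ℓ +_) (cost->>= (next (f x) (g y)) k x y)) (sym (+-assoc (ℓ + ℓ) _ _))

depth->>= : (P : Program U V X) (k : X → Program U V Y) → ∀ x y →
            depth (P >>= k) x y ≡ depth P x y + depth (k (value P x y)) x y
depth->>= (return r)            k x y = refl
depth->>= (exchange ℓ f g next) k x y = cong suc (depth->>= (next (f x) (g y)) k x y)

-- Padding and truncation make the function total; honest messages have length `ℓ` and undergo
-- neither.
fromBits : ∀ ℓ → List Bool → Vec Bool ℓ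
fromBits zero    bs       = []
fromBits (suc ℓ) []       = false ∷ fromBits ℓ []
fromBits (suc ℓ) (b ∷ bs) = b ∷ fromBits ℓ bs

fromBits-toList : (bs : Vec Bool k) → fromBits k (toList bs) ≡ bs
fromBits-toList []       = refl
fromBits-toList (b ∷ bs) = cong (b ∷_) (fromBits-toList bs)

toList-prefix : (as bs : Vec Bool k) → Prefix _≡_ (toList as) (toList bs) → toList as ≡ toList bs
toList-prefix []       []       []       = refl
toList-prefix (a ∷ as) (b ∷ bs) (p ∷ ps) = cong₂ _∷_ p (toList-prefix as bs ps)

compile : Program U V X → Protocol U V X
compile (return r)            = output (λ _ → r) (λ _ → r)
compile (exchange ℓ f g next) = round (toList ∘ f) (toList ∘ g)
  (λ x y → toList-prefix (f x) (f y)) (λ x y → toList-prefix (g x) (g y))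
  (λ as bs → compile (next (fromBits ℓ as) (fromBits ℓ bs)))

outputAlice-compile : (P : Program U V X) → ∀ x y → outputAlice (compile P) x y ≡ value P x y
outputAlice-compile (return r)            x y = refl
outputAlice-compile (exchange ℓ f g next) x y
  rewrite fromBits-toList (f x) | fromBits-toList (g y) = outputAlice-compile (next (f x) (g y)) x y

outputBob-compile : (P : Program U V X) → ∀ x y → outputBob (compile P) x y ≡ value P x y
outputBob-compile (return r)            x y = refl
outputBob-compile (exchange ℓ f g next) x y
  rewrite fromBits-toList (f x) | fromBits-toList (g y) = outputBob-compile (next (f x) (g y)) x y

rounds-compile : (P : Program U V X) → ∀ x y → rounds (compile P) x y ≡ depth P x y
rounds-compile (return r)            x y = refl
rounds-compile (exchange ℓ f g next) x y
  rewrite fromBits-toList (f x) | fromBits-toList (g y) =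
    cong suc (rounds-compile (next (f x) (g y)) x y)

bits-compile : (P : Program U V X) → ∀ x y → bits (compile P) x y ≡ cost P x y
bits-compile (return r)            x y = refl
bits-compile (exchange ℓ f g next) x y
  rewrite fromBits-toList (f x) | fromBits-toList (g y) =
  cong₂ _+_ (cong₂ _+_ (length-toList (f x)) (length-toList (g y)))
    (bits-compile (next (f x) (g y)) x y)

-- Encodings

width : (Fin k → ℕ) → ℕ
width {zero}  w = 0
width {suc k} w = w zero + width (w ∘ suc)

width≡∑ : (w : Fin k → ℕ) → width w ≡ ∑ (uniform k) w
width≡∑ {zero}  w = sym (∑-empty w)
width≡∑ {suc k} w = trans (cong (w zero +_) (width≡∑ (w ∘ suc))) (sym (∑-suc w))

pack : {w : Fin k → ℕ} → (∀ i → Vec Bool (w i)) → Vec Bool (width w)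
pack {zero}  f = []
pack {suc k} f = f zero Vec.++ pack (f ∘ suc)

unpack : (w : Fin k → ℕ) → Vec Bool (width w) → ∀ i → Vec Bool (w i)
unpack w bs zero    = Vec.take (w zero) bs
unpack w bs (suc i) = unpack (w ∘ suc) (Vec.drop (w zero) bs) i

take-++ : (as : Vec X k) (bs : Vec X n) → Vec.take k (as Vec.++ bs) ≡ as
take-++ []       bs = refl
take-++ (a ∷ as) bs = cong (a ∷_) (take-++ as bs)

drop-++ : (as : Vec X k) (bs : Vec X n) → Vec.drop k (as Vec.++ bs) ≡ bs
drop-++ []       bs = refl
drop-++ (a ∷ as) bs = drop-++ as bs

unpack-pack : (w : Fin k → ℕ) (f : ∀ i → Vec Bool (w i)) → ∀ i → unpack w (pack f) i ≡ f i
unpack-pack w f zero    = take-++ (f zero) _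
unpack-pack w f (suc i) = trans (cong (λ bs → unpack (w ∘ suc) bs i) (drop-++ (f zero) _))
  (unpack-pack (w ∘ suc) (f ∘ suc) i)

odd : ℕ → Bool
odd 0             = false
odd 1             = true
odd (suc (suc x)) = odd x

binary : ∀ ℓ → ℕ → Vec Bool ℓ
binary zero    x = []
binary (suc ℓ) x = odd x ∷ binary ℓ ⌊ x /2⌋

number : Vec Bool k → ℕ
number []       = 0
number (b ∷ bs) = 𝟙 b + 2 * number bs

odd+2*half : ∀ x → 𝟙 (odd x) + 2 * ⌊ x /2⌋ ≡ x
odd+2*half 0             = refl
odd+2*half 1             = refl
odd+2*half (suc (suc x)) = trans (ring (𝟙 (odd x)) ⌊ x /2⌋) (cong (2 +_) (odd+2*half x))
  where
  ring : ∀ a h → a + 2 * (1 + h) ≡ 2 + (a + 2 * h)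
  ring = solve 2 (λ a h → a :+ con 2 :* (con 1 :+ h) := con 2 :+ (a :+ con 2 :* h)) refl

number-binary : ∀ ℓ x → x < 2 ^ ℓ → number (binary ℓ x) ≡ x
number-binary zero    zero    _  = refl
number-binary zero    (suc x) (s≤s ())
number-binary (suc ℓ) x       lt = trans (cong (λ h → 𝟙 (odd x) + 2 * h)
  (number-binary ℓ ⌊ x /2⌋
    (*-cancelˡ-< 2 _ _ (≤-<-trans (≤-trans (m≤n+m _ (𝟙 (odd x))) (≤-reflexive (odd+2*half x)))
    lt))))
  (odd+2*half x)

openCount : State n κ → ℕ
openCount {n} σ = ∑ (uniform n) (λ v → 𝟙 (isOpen (lookup σ v)))

blockSize : ℕ → Maybe X → ℕ
blockSize w nothing  = w
blockSize w (just _) = 0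

block : ∀ {w} (s : Maybe X) → Vec Bool w → Vec Bool (blockSize w s)
block nothing  bs = bs
block (just _) bs = []

-- Coloured vertices send no bits. The default read in their place is harmless, because what is
-- decoded matters at open vertices only.
unblock : ∀ {w} (s : Maybe X) → Vec Bool (blockSize w s) → Vec Bool w
unblock     nothing  bs = bs
unblock {w = w} (just _) bs = Vec.replicate w false

module _ (σ : State n κ) (w : ℕ) where

  encode : (Fin n → Vec Bool w) → Vec Bool (width (λ v → blockSize w (lookup σ v)))
  encode f = pack (λ v → block (lookup σ v) (f v))

  decode : Vec Bool (width (λ v → blockSize w (lookup σ v))) → Fin n → Vec Bool w
  decode bs v = unblock (lookup σ v) (unpack (λ v → blockSize w (lookup σ v)) bs v)

  decode-encode : ∀ f v → lookup σ v ≡ nothing → decode (encode f) v ≡ f v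
  decode-encode f v σv =
    trans (cong (unblock (lookup σ v)) (unpack-pack (λ v → blockSize w (lookup σ v)) _ v))
    (go (lookup σ v) σv)
    where
    go : ∀ s → s ≡ nothing → unblock s (block s (f v)) ≡ f v
    go nothing refl = refl

  exchangeOpen : (U → Fin n → Vec Bool w) → (V → Fin n → Vec Bool w) →
                 ((Fin n → Vec Bool w) → (Fin n → Vec Bool w) → Program U V X) → Program U V X
  exchangeOpen f g next = exchange (width (λ v → blockSize w (lookup σ v))) (encode ∘ f)
    (encode ∘ g)
    (λ a b → next (decode a) (decode b))

  open-width : width (λ v → blockSize w (lookup σ v)) ≡ w * openCount σ
  open-width = trans (width≡∑ _) (trans (∑-cong (uniform n) (λ v → go (lookup σ v)))
    (∑-* (uniform n) w _))
    where
    go : ∀ s → blockSize w s ≡ w * 𝟙 (isOpen s)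
    go nothing  = sym (*-identityʳ w)
    go (just _) = sym (*-zeroʳ w)

-- A trial as a program

edges : Graph n → EdgeSet n
edges E v u = lookup (neighbours E v) u

-- The program determines the right tentative colours only at open vertices. The guard `isOpen` in
-- `clash` hides whatever it holds elsewhere.
clash-cong : ∀ (e : EdgeSet n) (σ : State n κ) act {τ τ′ : Fin n → Fin κ} →
             (∀ v → lookup σ v ≡ nothing → τ v ≡ τ′ v) →
             ∀ v → lookup σ v ≡ nothing → clash e σ act τ v ≡ clash e σ act τ′ v
clash-cong e σ act {τ} {τ′} τ≗τ′ v σv = any-cong (λ u → cong (e v u ∧_) (go u (lookup σ u) refl))
  where
  go : ∀ u s → lookup σ u ≡ s →
       isOpen s ∧ (act u ∧ (τ u == τ v)) ≡ isOpen s ∧ (act u ∧ (τ′ u == τ′ v))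
  go u (just _) σu = refl
  go u nothing  σu = cong (act u ∧_) (cong₂ _==_ (τ≗τ′ u σu) (τ≗τ′ v σv))

permits-cong : ∀ (e : EdgeSet n) (σ : State n κ) act {τ τ′ : Fin n → Fin κ} →
               (∀ v → lookup σ v ≡ nothing → τ v ≡ τ′ v) →
               ∀ v → lookup σ v ≡ nothing → permits e σ act τ v ≡ permits e σ act τ′ v
permits-cong e σ act τ≗τ′ v σv =
  cong₂ (λ a b → not a ∧ not b) (cong (used e σ v) (τ≗τ′ v σv)) (clash-cong e σ act τ≗τ′ v σv)

-- β bits for each count.
module TrialProgram (n Δ g L β : ℕ) where

  open Step n Δ g L

  private
    m = suc Δ
    W = width {suc g} (λ _ → β)

  counts : ∀ ℓ → Graph n → State n m → Vec (Tree (suc ℓ)) n → Fin n → Vec Bool W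
  counts ℓ E σ ts v =
    pack (λ i → binary β (count ℓ (𝟙 ∘ used (edges E) σ v) (lookup (lookup ts v) i)))

  pick : ℕ → Vec Bool W → Vec Bool W → Fin (suc g)
  pick ℓ as bs = choose (λ i → number (unpack (λ _ → β) as i) + number (unpack (λ _ → β) bs i) <ᵇ
    suc g ^ ℓ)

  search : ∀ ℓ → State n m → Vec (Tree ℓ) n → Program (Graph n) (Graph n) (Vec (Fin m) n)
  search zero    σ ts = return ts
  search (suc ℓ) σ ts = exchangeOpen σ W (λ E → counts ℓ E σ ts) (λ E → counts ℓ E σ ts)
    (λ a b → search ℓ σ (tabulate (λ v → lookup (lookup ts v) (pick ℓ (a v) (b v)))))

  verify : State n m → Vec Seed n → Vec (Fin m) n → Program (Graph n) (Graph n) (State n m)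
  verify σ ω cs = exchangeOpen σ 1 (λ E v → ok E v ∷ []) (λ E v → ok E v ∷ [])
    (λ a b → return (update σ (λ v → active (lookup ω v) ∧ (Vec.head (a v) ∧ Vec.head (b v)))
      (lookup cs)))
    where
    ok : Graph n → Fin n → Bool
    ok E = permits (edges E) σ (active ∘ lookup ω) (lookup cs)

  trial : State n m → Vec Seed n → Program (Graph n) (Graph n) (State n m)
  trial σ ω = search L σ (Vec.map proj₂ ω) >>= verify σ ω

  weight : ℕ
  weight = 2 * (L * (suc g * β) + 1)

  W≡ : W ≡ suc g * β
  W≡ = trans (width≡∑ {suc g} _) (∑-const (uniform (suc g)) β)

  search-cost : ∀ ℓ σ ts E₁ E₂ → cost (search ℓ σ ts) E₁ E₂ ≡ ℓ * (2 * (suc g * β * openCount σ))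
  search-cost zero    σ ts E₁ E₂ = refl
  search-cost (suc ℓ) σ ts E₁ E₂ = cong₂ _+_
    (trans (cong₂ _+_ eq eq) (ring (suc g * β * openCount σ)))
    (search-cost ℓ σ _ E₁ E₂)
    where
    eq = trans (open-width σ W) (cong (_* openCount σ) W≡)
    ring : ∀ a → a + a ≡ 2 * a
    ring = solve 1 (λ a → a :+ a := con 2 :* a) refl

  search-depth : ∀ ℓ σ ts E₁ E₂ → depth (search ℓ σ ts) E₁ E₂ ≡ ℓ
  search-depth zero    σ ts E₁ E₂ = refl
  search-depth (suc ℓ) σ ts E₁ E₂ = cong suc (search-depth ℓ σ _ E₁ E₂)

  trial-cost : ∀ σ ω E₁ E₂ → cost (trial σ ω) E₁ E₂ ≡ weight * openCount σ
  trial-cost σ ω E₁ E₂ = begin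
    cost (trial σ ω) E₁ E₂
      ≡⟨ cost->>= (search L σ (Vec.map proj₂ ω)) (verify σ ω) E₁ E₂ ⟩
    cost (search L σ (Vec.map proj₂ ω)) E₁ E₂ + (q + q + 0)
      ≡⟨ cong₂ (λ a b → a + (b + b + 0)) (search-cost L σ (Vec.map proj₂ ω) E₁ E₂) (open-width σ 1)
           ⟩
    L * (2 * (suc g * β * openCount σ)) + (1 * openCount σ + 1 * openCount σ + 0)
      ≡⟨ ring L (suc g * β) (openCount σ) ⟩
    weight * openCount σ ∎
    where
    open ≡-Reasoning
    q = width (λ v → blockSize 1 (lookup σ v))
    ring : ∀ L w c → L * (2 * (w * c)) + (1 * c + 1 * c + 0) ≡ 2 * (L * w + 1) * c
    ring = solve 3 (λ L w c → L :* (con 2 :* (w :* c)) :+ (con 1 :* c :+ con 1 :* c :+ con 0) :=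
      con 2 :* (L :* w :+ con 1) :* c) refl

  trial-depth : ∀ σ ω E₁ E₂ → depth (trial σ ω) E₁ E₂ ≡ suc L
  trial-depth σ ω E₁ E₂ = trans (depth->>= (search L σ (Vec.map proj₂ ω)) (verify σ ω) E₁ E₂)
    (trans (+-comm _ 1) (cong suc (search-depth L σ (Vec.map proj₂ ω) E₁ E₂)))

  module _ (fits : suc g ^ L < 2 ^ β) (E₁ E₂ : Graph n) where

    search-value : ∀ ℓ → ℓ ≤ L → ∀ σ ts v → lookup σ v ≡ nothing →
                   lookup (value (search ℓ σ ts) E₁ E₂) v ≡ find ℓ (used (edges E₁) σ v)
                     (used (edges E₂) σ v) (lookup ts v)
    search-value zero    _   σ ts v σv = refl
    search-value (suc ℓ) ℓ<L σ ts v σv = begin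
      lookup (value (search ℓ σ ts′) E₁ E₂) v
        ≡⟨ search-value ℓ (≤-trans (n≤1+n ℓ) ℓ<L) σ ts′ v σv ⟩
      find ℓ x y (lookup ts′ v)
        ≡⟨ cong (find ℓ x y) (lookup∘tabulate _ v) ⟩
      find ℓ x y (lookup (lookup ts v) (pick ℓ (received E₁) (received E₂)))
        ≡⟨ cong (find ℓ x y ∘ lookup (lookup ts v))
             (cong₂ (pick ℓ) (decode-encode σ W (counts ℓ E₁ σ ts) v σv)
             (decode-encode σ W (counts ℓ E₂ σ ts) v σv)) ⟩
      find ℓ x y (lookup (lookup ts v) (pick ℓ (counts ℓ E₁ σ ts v) (counts ℓ E₂ σ ts v)))
        ≡⟨ cong (find ℓ x y ∘ lookup (lookup ts v))
             (choose-cong (λ i → cong (_<ᵇ suc g ^ ℓ) (cong₂ _+_ (exact E₁ i) (exact E₂ i)))) ⟩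
      find ℓ x y (lookup (lookup ts v) (choose (below ℓ x y (lookup ts v)))) ∎
      where
      open ≡-Reasoning
      x = used (edges E₁) σ v
      y = used (edges E₂) σ v
      received : Graph n → Vec Bool W
      received E = decode σ W (encode σ W (counts ℓ E σ ts)) v
      ts′ = tabulate (λ v →
        lookup (lookup ts v) (pick ℓ (decode σ W (encode σ W (counts ℓ E₁ σ ts)) v)
        (decode σ W (encode σ W (counts ℓ E₂ σ ts)) v)))
      exact : ∀ E i → number (unpack (λ _ → β) (counts ℓ E σ ts v) i) ≡ count ℓ
              (𝟙 ∘ used (edges E) σ v) (lookup (lookup ts v) i)
      exact E i = trans (cong number
        (unpack-pack (λ _ → β) (λ i →
        binary β (count ℓ (𝟙 ∘ used (edges E) σ v) (lookup (lookup ts v) i))) i)) (number-binary β _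
        -- A count never exceeds the number of leaves of its subtree, so `β` bits hold it without
        -- overflow.
        (≤-<-trans (count-≤ ℓ _ (𝟙≤1 ∘ used (edges E) σ v) _)
          (≤-<-trans (^-monoʳ-≤ (suc g) (≤-trans (n≤1+n ℓ) ℓ<L)) fits)))

    trial-value : ∀ σ ω → value (trial σ ω) E₁ E₂ ≡ step (edges E₁) (edges E₂) σ ω
    trial-value σ ω = trans (value->>= (search L σ (Vec.map proj₂ ω)) (verify σ ω) E₁ E₂)
      (tabulate-cong (update-cong σ ok≗ cs≗))
      where
      cs = value (search L σ (Vec.map proj₂ ω)) E₁ E₂
      act = active ∘ lookup ω
      cs≗ : ∀ v → lookup σ v ≡ nothing → lookup cs v ≡ tentative (edges E₁) (edges E₂) σ ω v
      cs≗ v σv = trans (search-value L ≤-refl σ (Vec.map proj₂ ω) v σv)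
        (cong (find L (used (edges E₁) σ v) (used (edges E₂) σ v)) (lookup-map v proj₂ ω))
      sent : ∀ E v → lookup σ v ≡ nothing →
             Vec.head (decode σ 1 (encode σ 1 (λ v → permits (edges E) σ act (lookup cs) v ∷ [])) v)
             ≡ permits (edges E) σ act (tentative (edges E₁) (edges E₂) σ ω) v
      sent E v σv = trans
        (cong Vec.head (decode-encode σ 1 (λ v → permits (edges E) σ act (lookup cs) v ∷ []) v σv))
                          (permits-cong (edges E) σ act cs≗ v σv)
      ok≗ : ∀ v → lookup σ v ≡ nothing → _ ≡ accepted (edges E₁) (edges E₂) σ ω v
      ok≗ v σv = cong (act v ∧_) (cong₂ _∧_ (sent E₁ v σv) (sent E₂ v σv))

-- Neighbourhoods as lists of names

listing : (Fin n → Bool) → List (Fin n)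
listing {zero}  P = []
listing {suc n} P = if P zero then zero ∷ rest else rest
  where rest = List.map suc (listing (P ∘ suc))

length-listing : (P : Fin n → Bool) → length (listing P) ≡ ∑ (uniform n) (𝟙 ∘ P)
length-listing {zero}  P = sym (∑-empty _)
length-listing {suc n} P = trans (go (P zero)) (sym (∑-suc (𝟙 ∘ P)))
  where
  rest = List.map suc (listing (P ∘ suc))
  eq : length rest ≡ ∑ (uniform n) (𝟙 ∘ P ∘ suc)
  eq = trans (length-map suc (listing (P ∘ suc))) (length-listing (P ∘ suc))
  go : ∀ b → length (if b then zero ∷ rest else rest) ≡ 𝟙 b + ∑ (uniform n) (𝟙 ∘ P ∘ suc)
  go true  = cong suc eq
  go false = eq

∈-listing⁺ : (P : Fin n → Bool) (i : Fin n) → P i ≡ true → i ∈ listing P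
∈-listing⁺ P zero    p rewrite p = here refl
∈-listing⁺ P (suc i) p with P zero | ∈-map⁺ suc (∈-listing⁺ (P ∘ suc) i p)
... | true  | i∈ = there i∈
... | false | i∈ = i∈

∈-listing⁻ : (P : Fin n → Bool) (i : Fin n) → i ∈ listing P → P i ≡ true
∈-listing⁻ {suc n} P i i∈ with P zero in eq
∈-listing⁻ P zero    (here refl) | true = eq
∈-listing⁻ P i       (there i∈) | true with j , j∈ , refl ← ∈-map⁻ suc i∈ =
  ∈-listing⁻ (P ∘ suc) j j∈
∈-listing⁻ P i       i∈ | false with j , j∈ , refl ← ∈-map⁻ suc i∈ = ∈-listing⁻ (P ∘ suc) j j∈

entry : X → List X → Fin k → X
entry d []       i       = d
entry d (x ∷ xs) zero    = x
entry d (x ∷ xs) (suc i) = entry d xs i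

entry⁺ : (d : X) (xs : List X) {x : X} → length xs ≤ k → x ∈ xs → ∃[ i ] entry {k = k} d xs i ≡ x
entry⁺ d (x ∷ xs) (s≤s le) (here refl) = zero , refl
entry⁺ d (x ∷ xs) (s≤s le) (there x∈) with i , eq ← entry⁺ d xs le x∈ = suc i , eq

entry⁻ : (d : X) (xs : List X) (i : Fin k) → entry d xs i ∈ xs ⊎ entry d xs i ≡ d
entry⁻ d []       i    = inj₂ refl
entry⁻ d (x ∷ xs) zero = inj₁ (here refl)
entry⁻ d (x ∷ xs) (suc i) with entry⁻ d xs i
... | inj₁ ∈xs = inj₁ (there ∈xs)
... | inj₂ ≡d  = inj₂ ≡d

Bool-ext : ∀ {a b} → (a ≡ true → b ≡ true) → (b ≡ true → a ≡ true) → a ≡ b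
Bool-ext {false} {false} f g = refl
Bool-ext {true}  {true}  f g = refl
Bool-ext {false} {true}  f g = g refl
Bool-ext {true}  {false} f g = sym (f refl)

-- Greedy completion

greedyColour : EdgeSet n → State n (suc κ) → Fin n → Fin (suc κ)
greedyColour e σ v = choose (not ∘ used e σ v)

fill : EdgeSet n → List (Fin n) → State n (suc κ) → State n (suc κ)
fill e []       σ = σ
fill e (v ∷ vs) σ with lookup σ v
... | just _  = fill e vs σ
... | nothing = fill e vs (σ [ v ]≔ just (greedyColour e σ v))

module Greedy {n Δ : ℕ} {e₁ e₂ : EdgeSet n} (I : Instance n Δ e₁ e₂) (known : EdgeSet n) where

  open Instance I
  -- The quantities taken from here depend on the graph and the state only, so the branching and the
  -- depth are set to placeholders.
  open Analysis {n} {Δ} {0} {0} I using (edge; edge⁻; used-total; openAt)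

  -- Edges between two coloured vertices may remain unknown. That is enough: only open vertices are
  -- still to be coloured, and of two adjacent ones the later sees the colour of the earlier.
  -- Colouring a vertex only weakens the requirement.
  Knows : State n (suc Δ) → Set
  Knows σ = ∀ v → lookup σ v ≡ nothing → ∀ u → known v u ≡ edge v u

  unused-exists : (P : Fin (suc Δ) → Bool) → ∑ (uniform (suc Δ)) (𝟙 ∘ P) ≤ Δ →
                  ∃[ c ] not (P c) ≡ true
  unused-exists P le with any (not ∘ P) in eq
  ... | true  = any⁻ (not ∘ P) eq
  ... | false = contradiction (≤-trans (≤-reflexive (sym total)) le) (<⇒≱ (n<1+n Δ))
    where
    all : ∀ c → P c ≡ true
    all c with P c | any-none (not ∘ P) eq c
    ... | true | _ = refl
    total : ∑ (uniform (suc Δ)) (𝟙 ∘ P) ≡ suc Δ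
    total = trans (∑-cong (uniform (suc Δ)) (λ c → cong 𝟙 (all c)))
      (trans (∑-const (uniform (suc Δ)) 1) (*-identityʳ _))

  greedy-unused : ∀ σ v → Knows σ → lookup σ v ≡ nothing → ∀ u → edge v u ≡ true →
                  hasColour (lookup σ u) (greedyColour known σ v) ≡ false
  greedy-unused σ v K σv u vu with used known σ v (greedyColour known σ v) in eq
  ... | true  = case trans (sym (cong not eq)) (choose-sound (not ∘ used known σ v) (proj₁ free)
    (proj₂ free)) of λ ()
    where
    few : ∑ (uniform (suc Δ)) (𝟙 ∘ used known σ v) ≤ Δ
    few = ≤-trans (used-total known σ v) (≤-trans (∑-mono (uniform n) (λ u →
      ≤-trans (≤-reflexive (cong (λ b → 𝟙 (b ∧ not (openAt σ u))) (K v σv u)))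
        (shrink (edge v u) _))) (degree≤ v))
      where
      shrink : ∀ a b → 𝟙 (a ∧ b) ≤ 𝟙 a
      shrink false b = z≤n
      shrink true  b = 𝟙≤1 b
    free = unused-exists (used known σ v) few
  ... | false = trans (cong (_∧ hasColour (lookup σ u) (greedyColour known σ v))
    (sym (trans (K v σv u) vu))) (any-none _ eq u)

  Partial-extend : ∀ σ v → Knows σ → Partial edge σ → lookup σ v ≡ nothing →
                   Partial edge (σ [ v ]≔ just (greedyColour known σ v))
  Partial-extend σ v K P σv {a} {b} ab sa sb = go (a ≟ v) (b ≟ v)
    where
    c₀ = greedyColour known σ v
    σ′ = σ [ v ]≔ just c₀
    at-v : ∀ {c} → lookup σ′ v ≡ just c → c ≡ c₀
    at-v eq = just-injective (trans (sym eq) (lookup∘update v σ (just c₀)))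
    old : ∀ {u s} → u ≢ v → lookup σ′ u ≡ s → lookup σ u ≡ s
    old u≢v eq = trans (sym (lookup∘update′ u≢v σ (just c₀))) eq
    loop : edge v v ≢ true
    loop vv with edge⁻ vv
    ... | inj₁ vv₁ = case trans (sym (loopless₁ v)) vv₁ of λ ()
    ... | inj₂ vv₂ = case trans (sym (loopless₂ v)) vv₂ of λ ()
    fresh : ∀ {u c} → edge v u ≡ true → lookup σ u ≡ just c → c ≢ c₀
    fresh {u} vu σu refl = case trans (sym (greedy-unused σ v K σv u vu))
      (trans (cong (λ s → hasColour s c₀) σu) (==-refl c₀)) of λ ()
    go : _ → _ → _
    go (yes refl) (yes refl) = contradiction ab loop
    go (yes refl) (no b≢v)   = λ c≡d → fresh ab (old b≢v sb) (trans (sym c≡d) (at-v sa))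
    go (no a≢v)   (yes refl) = λ c≡d → fresh (symmetricʳ a b ab) (old a≢v sa) (trans c≡d (at-v sb))
    go (no a≢v)   (no b≢v)   = P ab (old a≢v sa) (old b≢v sb)

  Knows-extend : ∀ σ v c → Knows σ → Knows (σ [ v ]≔ just c)
  Knows-extend σ v c K u σu with u ≟ v
  ... | yes refl = case trans (sym (lookup∘update v σ (just c))) σu of λ ()
  ... | no u≢v   = K u (trans (sym (lookup∘update′ u≢v σ (just c))) σu)

  fill-partial : ∀ vs σ → Knows σ → Partial edge σ → Partial edge (fill known vs σ)
  fill-partial []       σ K P = P
  fill-partial (v ∷ vs) σ K P with lookup σ v in σv
  ... | just _  = fill-partial vs σ K P
  ... | nothing = fill-partial vs (σ [ v ]≔ just (greedyColour known σ v))
                    (Knows-extend σ v (greedyColour known σ v) K) (Partial-extend σ v K P σv)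

  Coloured : State n (suc Δ) → Fin n → Set
  Coloured σ v = ∃[ c ] lookup σ v ≡ just c

  Coloured-extend : ∀ (σ : State n (suc Δ)) v c u → Coloured σ u → Coloured (σ [ v ]≔ just c) u
  Coloured-extend σ v c u (d , σu) with u ≟ v
  ... | yes refl = c , lookup∘update v σ (just c)
  ... | no u≢v   = d , trans (lookup∘update′ u≢v σ (just c)) σu

  fill-keeps : ∀ vs σ u → Coloured σ u → Coloured (fill known vs σ) u
  fill-keeps []       σ u σu = σu
  fill-keeps (v ∷ vs) σ u σu with lookup σ v
  ... | just _  = fill-keeps vs σ u σu
  ... | nothing = fill-keeps vs (σ [ v ]≔ just (greedyColour known σ v)) u
    (Coloured-extend σ v (greedyColour known σ v) u σu)

  fill-colours : ∀ vs σ u → u ∈ vs → Coloured (fill known vs σ) u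
  fill-colours (v ∷ vs) σ u (there u∈) with lookup σ v
  ... | just _  = fill-colours vs σ u u∈
  ... | nothing = fill-colours vs (σ [ v ]≔ just (greedyColour known σ v)) u u∈
  fill-colours (v ∷ vs) σ u (here refl) with lookup σ v in σv
  ... | just c  = fill-keeps vs σ v (c , σv)
  ... | nothing = fill-keeps vs (σ [ v ]≔ just (greedyColour known σ v)) v
    (greedyColour known σ v , lookup∘update v σ _)

  colouring : State n (suc Δ) → Coloring n (suc Δ)
  colouring σ v = fromMaybe zero (lookup (fill known (allFin n) σ) v)

  colouring-proper : ∀ σ → Knows σ → Partial edge σ → ∀ {u v} → edge u v ≡ true →
                     colouring σ u ≢ colouring σ v
  colouring-proper σ K P {u} {v} uv
    with c , σu ← fill-colours (allFin n) σ u (∈-allFin u)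
       | d , σv ← fill-colours (allFin n) σ v (∈-allFin v)
    rewrite σu | σv = fill-partial (allFin n) σ K P uv σu σv

-- The last round

-- ι bits for the name of a vertex.
module Finish (n Δ ι : ℕ) where

  private
    m = suc Δ
    W = width {Δ} (λ _ → ι)

  -- The neighbours of v, padded with v itself.
  names : EdgeSet n → Fin n → Vec Bool W
  names e v = pack {Δ} (λ i → binary ι (toℕ (entry v (listing (e v)) i)))

  -- The last conjunct removes the padding; no genuine neighbour is lost, as `v` is never its own.
  named : Vec Bool W → EdgeSet n
  named bs v u = any {Δ} (λ i → number (unpack (λ _ → ι) bs i) ≡ᵇ toℕ u) ∧ not (u == v)

  finish : State n m → Program (Graph n) (Graph n) (Coloring n m)
  finish σ = exchangeOpen σ W (names ∘ edges) (names ∘ edges)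
    (λ a b → return (λ v →
      fromMaybe zero (lookup (fill (λ v u → named (a v) v u ∨ named (b v) v u) (allFin n) σ) v)))

  finish-weight : ℕ
  finish-weight = 2 * (Δ * ι)

  finish-cost : ∀ σ E₁ E₂ → cost (finish σ) E₁ E₂ ≡ finish-weight * openCount σ
  finish-cost σ E₁ E₂ =
    trans (cong (λ q → q + q + 0) (trans (open-width σ W) (cong (_* openCount σ) W≡)))
    (ring (Δ * ι) (openCount σ))
    where
    W≡ : W ≡ Δ * ι
    W≡ = trans (width≡∑ {Δ} _) (∑-const (uniform Δ) ι)
    ring : ∀ w c → w * c + w * c + 0 ≡ 2 * w * c
    ring = solve 2 (λ w c → w :* c :+ w :* c :+ con 0 := con 2 :* w :* c) refl

  named-names : n ≤ 2 ^ ι → ∀ (e : EdgeSet n) v u → e v v ≡ false →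
                ∑ (uniform n) (𝟙 ∘ e v) ≤ Δ → named (names e v) v u ≡ e v u
  named-names n≤ e v u vv few = Bool-ext sound complete
    where
    read : ∀ i → number (unpack (λ _ → ι) (names e v) i) ≡ toℕ (entry v (listing (e v)) i)
    read i = trans (cong number
      (unpack-pack (λ _ → ι) (λ i → binary ι (toℕ (entry v (listing (e v)) i))) i))
                   (number-binary ι _ (<-≤-trans (toℕ<n (entry v (listing (e v)) i)) n≤))
    sound : named (names e v) v u ≡ true → e v u ≡ true
    sound p with ∧⁻ {any {Δ} (λ i → number (unpack (λ _ → ι) (names e v) i) ≡ᵇ toℕ u)} p
    ... | q , u≠v with i , r ← any⁻ _ q = go (entry⁻ v (listing (e v)) i)
      where
      u≡ : entry v (listing (e v)) i ≡ u
      u≡ = toℕ-injective (trans (sym (read i)) (≡ᵇ⇒≡ _ _ (true⇒T r)))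
      go : _ → e v u ≡ true
      go (inj₁ ∈l) = ∈-listing⁻ (e v) u (subst (_∈ listing (e v)) u≡ ∈l)
      go (inj₂ ≡v) = case trans (sym u≠v)
        (cong not (trans (cong (u ==_) (trans (sym ≡v) u≡)) (==-refl u))) of λ ()
    complete : e v u ≡ true → named (names e v) v u ≡ true
    complete vu with i , eq ← entry⁺ {k = Δ} v (listing (e v))
      (≤-trans (≤-reflexive (length-listing (e v))) few) (∈-listing⁺ (e v) u vu) =
      ∧-true (any⁺ _ i (T⇒true (≡⇒≡ᵇ _ _ (trans (read i) (cong toℕ eq)))))
             (cong not (dec-false (u ≟ v) λ { refl → case trans (sym vv) vu of λ () }))

  finish-proper : n ≤ 2 ^ ι → ∀ E₁ E₂ → (I : Instance n Δ (edges E₁) (edges E₂)) → ∀ σ →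
                  Partial (λ u v → edges E₁ u v ∨ edges E₂ u v) σ →
                  ∀ {u v} → edges E₁ u v ∨ edges E₂ u v ≡ true →
                  value (finish σ) E₁ E₂ u ≢ value (finish σ) E₁ E₂ v
  finish-proper n≤ E₁ E₂ I σ P = colouring-proper σ knows P
    where
    open Instance I
    received : Graph n → Fin n → Vec Bool W
    received E = decode σ W (encode σ W (names (edges E)))
    open Greedy I (λ v u → named (received E₁ v) v u ∨ named (received E₂ v) v u)
    knows : Knows σ
    knows v σv u = cong₂ _∨_
      (trans (cong (λ bs → named bs v u) (decode-encode σ W (names (edges E₁)) v σv))
        (named-names n≤ (edges E₁) v u (loopless₁ v)
        (≤-trans (∑-mono (uniform n) (λ u → left (edges E₁ v u) _)) (degree≤ v))))
      (trans (cong (λ bs → named bs v u) (decode-encode σ W (names (edges E₂)) v σv))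
        (named-names n≤ (edges E₂) v u (loopless₂ v)
        (≤-trans (∑-mono (uniform n) (λ u → right (edges E₁ v u) _)) (degree≤ v))))
      where
      left : ∀ a b → 𝟙 a ≤ 𝟙 (a ∨ b)
      left false b = z≤n
      left true  b = ≤-refl
      right : ∀ a b → 𝟙 b ≤ 𝟙 (a ∨ b)
      right false b = ≤-refl
      right true  b = 𝟙≤1 b

-- Trial j costs w j bits per open vertex, its search fails with probability
-- at most 2m/(K j · slack), and finishing costs z bits per open vertex.  A
-- vertex of slack s with the trials js ahead of it is then charged
-- (a + b/s)/Q bits.
data Admissible (m Q z : ℕ) (w K : ℕ → ℕ) : List ℕ → ℕ → ℕ → Set where
  []  : ∀ {a b} → Q * z ≤ a → Admissible m Q z w K [] a b
  _∷_ : ∀ {j js a b a′ b′} → 4 * (Q * w j) + 3 * a′ ≤ 4 * a × a′ * m + 3 * (K j * b′) ≤ K j * b →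
        Admissible m Q z w K js a′ b′ → Admissible m Q z w K (j ∷ js) a b

-- The whole protocol and its expected cost

module Run (n Δ L ι : ℕ) (g β : ℕ → ℕ) where

  private
    m = suc Δ

  open Finish n Δ ι

  trialSeeds : ∀ j → Space (Vec (Step.Seed n Δ (g j) L) n)
  trialSeeds j = power (Step.seeds n Δ (g j) L) n

  Seeds : List ℕ → Set
  Seeds []       = ⊤
  Seeds (j ∷ js) = Vec (Step.Seed n Δ (g j) L) n × Seeds js

  seedSpace : ∀ js → Space (Seeds js)
  seedSpace []       = point tt
  seedSpace (j ∷ js) = trialSeeds j ⊗ seedSpace js

  trialSeeds-nonZero : ∀ j → NonZero (card (trialSeeds j))
  trialSeeds-nonZero j = power-nonZero (Step.seeds n Δ (g j) L)
    (m*n≢0 2 (card (Trees.trees m (g j) L)) {{_}} {{trees-nonZero m (g j) L}}) n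

  seedSpace-nonZero : ∀ js → NonZero (card (seedSpace js))
  seedSpace-nonZero []       = _
  seedSpace-nonZero (j ∷ js) = m*n≢0 (card (trialSeeds j)) (card (seedSpace js))
    {{trialSeeds-nonZero j}} {{seedSpace-nonZero js}}

  run : ∀ js → Seeds js → State n m → Program (Graph n) (Graph n) (Coloring n m)
  run []       _        σ = finish σ
  run (j ∷ js) (ω , ωs) σ = TrialProgram.trial n Δ (g j) L (β j) σ ω >>= run js ωs

  run-depth : ∀ js ωs σ E₁ E₂ → depth (run js ωs σ) E₁ E₂ ≡ length js * suc L + 1
  run-depth []       ωs       σ E₁ E₂ = refl
  run-depth (j ∷ js) (ω , ωs) σ E₁ E₂ =
    trans (depth->>= (TrialProgram.trial n Δ (g j) L (β j) σ ω) (run js ωs) E₁ E₂)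
    (trans (cong₂ _+_ (TrialProgram.trial-depth n Δ (g j) L (β j) σ ω E₁ E₂)
      (run-depth js ωs _ E₁ E₂))
           (sym (+-assoc (suc L) (length js * suc L) 1)))

  weight : ℕ → ℕ
  weight j = TrialProgram.weight n Δ (g j) L (β j)

  module _ (fits : ∀ j → suc (g j) ^ L < 2 ^ β j) (E₁ E₂ : Graph n)
                   (I : Instance n Δ (edges E₁) (edges E₂)) where

    private
      e₁ = edges E₁
      e₂ = edges E₂

    after : ∀ j → State n m → Vec (Step.Seed n Δ (g j) L) n → State n m
    after j = Step.step n Δ (g j) L e₁ e₂

    run-value : ∀ j js ω ωs σ →
                value (run (j ∷ js) (ω , ωs) σ) E₁ E₂ ≡ value (run js ωs (after j σ ω)) E₁ E₂
    run-value j js ω ωs σ =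
      trans (value->>= (TrialProgram.trial n Δ (g j) L (β j) σ ω) (run js ωs) E₁ E₂)
      (cong (λ σ → value (run js ωs σ) E₁ E₂) (TrialProgram.trial-value n Δ (g j) L (β j) (fits j)
        E₁ E₂ σ ω))

    run-cost : ∀ j js ω ωs σ →
               cost (run (j ∷ js) (ω , ωs) σ) E₁ E₂ ≡ weight j * openCount σ + cost
               (run js ωs (after j σ ω)) E₁ E₂
    run-cost j js ω ωs σ =
      trans (cost->>= (TrialProgram.trial n Δ (g j) L (β j) σ ω) (run js ωs) E₁ E₂)
      (cong₂ _+_ (TrialProgram.trial-cost n Δ (g j) L (β j) σ ω E₁ E₂)
        (cong (λ σ → cost (run js ωs σ) E₁ E₂) (TrialProgram.trial-value n Δ (g j) L (β j) (fits j)
          E₁ E₂ σ ω)))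

    run-proper : n ≤ 2 ^ ι → ∀ js ωs σ → Partial (λ u v → e₁ u v ∨ e₂ u v) σ → ∀ {u v} →
                 e₁ u v ∨ e₂ u v ≡ true →
                 value (run js ωs σ) E₁ E₂ u ≢ value (run js ωs σ) E₁ E₂ v
    run-proper n≤ []       ωs       σ P uv = finish-proper n≤ E₁ E₂ I σ P uv
    run-proper n≤ (j ∷ js) (ω , ωs) σ P {u} {v} uv rewrite run-value j js ω ωs σ =
      run-proper n≤ js ωs (after j σ ω) (Analysis.step-partial {g = g j} {L = L} I σ ω P) uv

    module _ (Q : ℕ) (K : ℕ → ℕ) (K≢0 : ∀ j → NonZero (K j)) (K² : ∀ j → K j * K j ≡ suc (g j) ^ L)
                  where

      open Analysis {n} {Δ} {0} {0} I using (openAt; slack)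

      potential : ℕ → ℕ → State n m → Fin n → ℕ
      potential a b σ v = 𝟙 (openAt σ v) * (a * m ! + b * share m (slack σ v))

      totalPotential : ℕ → ℕ → State n m → ℕ
      totalPotential a b σ = ∑ (uniform n) (potential a b σ)

      -- The potential is a supermartingale that pays as it falls: from every state, the cost of a
      -- trial plus the mean potential after it is at most the potential before it. Seeds of
      -- successive trials are independent, so these bounds compose along the schedule.
      run-expected : ∀ js a b → Admissible m Q finish-weight weight K js a b → ∀ σ →
                     ∑ (seedSpace js) (λ ωs → m ! * Q * cost (run js ωs σ) E₁ E₂) ≤ card
                       (seedSpace js) * totalPotential a b σ
      run-expected [] a b ([] Qz≤a) σ = begin
        ∑ (point tt) (λ ωs → m ! * Q * cost (finish σ) E₁ E₂)
          ≡⟨ trans (∑-point tt _) (cong (m ! * Q *_) (finish-cost σ E₁ E₂)) ⟩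
        m ! * Q * (finish-weight * openCount σ)
          ≡⟨ ring (m !) Q finish-weight (openCount σ) ⟩
        Q * finish-weight * m ! * openCount σ
          ≤⟨ *-monoˡ-≤ (openCount σ) (*-monoˡ-≤ (m !) Qz≤a) ⟩
        a * m ! * openCount σ
          ≡⟨ ∑-* (uniform n) (a * m !) _ ⟨
        ∑ (uniform n) (λ v → a * m ! * 𝟙 (openAt σ v))
          ≤⟨ ∑-mono (uniform n) (λ v →
               ≤-trans (≤-reflexive (*-comm (a * m !) _))
               (*-monoʳ-≤ (𝟙 (openAt σ v)) (m≤m+n (a * m !) _))) ⟩
        totalPotential a b σ
          ≡⟨ *-identityˡ _ ⟨
        1 * totalPotential a b σ ∎
        where
        open ≤-Reasoning
        ring : ∀ H Q z c → H * Q * (z * c) ≡ Q * z * H * c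
        ring = solve 4 (λ H Q z c → H :* Q :* (z :* c) := Q :* z :* H :* c) refl
      run-expected (j ∷ js) a b (_∷_ {a′ = a′} {b′ = b′} (ha , hb) adm) σ = begin
        ∑ (seedSpace (j ∷ js)) (λ ωs → m ! * Q * cost (run (j ∷ js) ωs σ) E₁ E₂)
          ≡⟨ trans (∑-⊗ Ω S _)
               (∑-cong Ω (λ ω → ∑-cong S (λ ωs → trans (cong (m ! * Q *_) (run-cost j js ω ωs σ))
               (*-distribˡ-+ (m ! * Q) _ _)))) ⟩
        ∑ Ω (λ ω → ∑ S (λ ωs → m ! * Q * (weight j * openCount σ) + m ! * Q * cost
          (run js ωs (after j σ ω)) E₁ E₂))
          ≡⟨ ∑-cong Ω (λ ω → trans (∑-+ S _ _)
               (cong (_+ ∑ S (λ ωs → m ! * Q * cost (run js ωs (after j σ ω)) E₁ E₂))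
               (∑-const S _))) ⟩
        ∑ Ω (λ ω → card S * (m ! * Q * (weight j * openCount σ)) + ∑ S (λ ωs →
          m ! * Q * cost (run js ωs (after j σ ω)) E₁ E₂))
          ≤⟨ ∑-mono Ω (λ ω → +-mono-≤ (≤-reflexive (cong (card S *_) (spread (m !) Q (weight j))))
               (run-expected js a′ b′ adm (after j σ ω))) ⟩
        ∑ Ω (λ ω → card S * ∑ (uniform n) (λ v → 𝟙 (openAt σ v) * (Q * weight j * m !)) + card S *
          totalPotential a′ b′ (after j σ ω))
          ≡⟨ trans (∑-cong Ω (λ ω →
               trans (sym (*-distribˡ-+ (card S) _ _))
               (cong (card S *_) (sym (∑-+ (uniform n) _ _))))) (∑-* Ω (card S) _) ⟩
        card S * ∑ Ω (λ ω →
          ∑ (uniform n) (λ v → 𝟙 (openAt σ v) * (Q * weight j * m !) + potential a′ b′ (after j σ ω)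
          v))
          ≡⟨ cong (card S *_) (∑-swap Ω (uniform n) _) ⟩
        card S * ∑ (uniform n) (λ v →
          ∑ Ω (λ ω → 𝟙 (openAt σ v) * (Q * weight j * m !) + potential a′ b′ (after j σ ω) v))
          ≤⟨ *-monoʳ-≤ (card S)
               (∑-mono (uniform n) (potential-step (Q * weight j) a b a′ b′ ha hb σ)) ⟩
        card S * ∑ (uniform n) (λ v → card Ω * potential a b σ v)
          ≡⟨ cong (card S *_) (∑-* (uniform n) (card Ω) _) ⟩
        card S * (card Ω * totalPotential a b σ)
          ≡⟨ ring (card S) (card Ω) (totalPotential a b σ) ⟩
        card Ω * card S * totalPotential a b σ ∎
        where
        open ≤-Reasoning
        open Decay {n} {Δ} {g j} {L} I (K j) {{K≢0 j}} (K² j) using (potential-step)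
        Ω = trialSeeds j
        S = seedSpace js
        ring : ∀ s z p → s * (z * p) ≡ z * s * p
        ring = solve 3 (λ s z p → s :* (z :* p) := z :* s :* p) refl
        spread : ∀ H Q w → H * Q * (w * openCount σ) ≡ ∑ (uniform n) (λ v →
                 𝟙 (openAt σ v) * (Q * w * H))
        spread H Q w = trans (ring′ H Q w (openCount σ))
          (trans (sym (∑-* (uniform n) (Q * w * H) _))
          (∑-cong (uniform n) (λ v → *-comm (Q * w * H) _)))
          where
          ring′ : ∀ H Q w c → H * Q * (w * c) ≡ Q * w * H * c
          ring′ = solve 4 (λ H Q w c → H :* Q :* (w :* c) := Q :* w :* H :* c) refl

-- The schedule of trials

admissible-mono : ∀ {m Q z w K js a b c d} → a ≤ c → b ≤ d → Admissible m Q z w K js a b →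
                  Admissible m Q z w K js c d
admissible-mono a≤c b≤d ([] Qz≤a) = [] (≤-trans Qz≤a a≤c)
admissible-mono {K = K} a≤c b≤d (_∷_ {j = j} (ha , hb) adm) =
  (≤-trans ha (*-monoʳ-≤ 4 a≤c) , ≤-trans hb (*-monoʳ-≤ (K j) b≤d)) ∷ adm

1≤^ : ∀ b .{{_ : NonZero b}} t → 1 ≤ b ^ t
1≤^ b t = >-nonZero⁻¹ (b ^ t) {{m^n≢0 b t}}

-- One trial turns the charge 8e into 7e, as long as a trial costs at most e.
admissible-replicate : ∀ {m Q z w K js j} t e b y → Q * w j ≤ e → m * (8 ^ t * e) ≤ K j * y →
                       Admissible m Q z w K js (8 ^ t * e) b →
                       Admissible m Q z w K (replicate t j ++ js) (7 ^ t * e) (4 ^ t * (b + y))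
admissible-replicate zero e b y we my adm =
  admissible-mono ≤-refl (≤-trans (m≤m+n b y) (≤-reflexive (sym (+-identityʳ (b + y))))) adm
admissible-replicate {m} {Q} {z} {w} {K} {js} {j} (suc t) e b y we my adm = (ha , hb) ∷
  admissible-replicate t (8 * e) b y (≤-trans we (m≤n*m e 8)) (subst (λ x → m * x ≤ K j * y) eq my)
    (subst (λ x → Admissible m Q z w K js x b) eq adm)
  where
  open ≤-Reasoning
  eq : 8 ^ suc t * e ≡ 8 ^ t * (8 * e)
  eq = ring (8 ^ t) e
    where
    ring : ∀ p e → 8 * p * e ≡ p * (8 * e)
    ring = solve 2 (λ p e → con 8 :* p :* e := p :* (con 8 :* e)) refl
  ha : 4 * (Q * w j) + 3 * (7 ^ t * (8 * e)) ≤ 4 * (7 ^ suc t * e)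
  ha = begin
    4 * (Q * w j) + 3 * (7 ^ t * (8 * e))
      ≤⟨ +-monoˡ-≤ (3 * (7 ^ t * (8 * e)))
           (*-monoʳ-≤ 4 (≤-trans we
           (≤-trans (≤-reflexive (sym (*-identityˡ e))) (*-monoˡ-≤ e (1≤^ 7 t))))) ⟩
    4 * (7 ^ t * e) + 3 * (7 ^ t * (8 * e))
      ≡⟨ ring (7 ^ t) e ⟩
    4 * (7 ^ suc t * e) ∎
    where
    ring : ∀ p e → 4 * (p * e) + 3 * (p * (8 * e)) ≡ 4 * (7 * p * e)
    ring = solve 2 (λ p e → con 4 :* (p :* e) :+ con 3 :* (p :* (con 8 :* e)) :=
      con 4 :* (con 7 :* p :* e)) refl
  -- The factor `4 = 3 + 1`: three parts cover the growth of the reciprocal, and one covers the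
  -- charge transferred by failed searches, for which `y` is reserved.
  hb : 7 ^ t * (8 * e) * m + 3 * (K j * (4 ^ t * (b + y))) ≤ K j * (4 ^ suc t * (b + y))
  hb = begin
    7 ^ t * (8 * e) * m + 3 * (K j * (4 ^ t * (b + y)))
      ≤⟨ +-monoˡ-≤ (3 * (K j * (4 ^ t * (b + y)))) (begin
        7 ^ t * (8 * e) * m        ≤⟨ *-monoˡ-≤ m (*-monoˡ-≤ (8 * e) (^-monoˡ-≤ t (n≤1+n 7))) ⟩
        8 ^ t * (8 * e) * m        ≡⟨ trans (*-comm _ m) (cong (m *_) (sym eq)) ⟩
        m * (8 ^ suc t * e)        ≤⟨ my ⟩
        K j * y                    ≤⟨ *-monoʳ-≤ (K j) (m≤n+m y b) ⟩
        K j * (b + y)              ≡⟨ cong (K j *_) (*-identityˡ (b + y)) ⟨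
        K j * (1 * (b + y))        ≤⟨ *-monoʳ-≤ (K j) (*-monoˡ-≤ (b + y) (1≤^ 4 t)) ⟩
        K j * (4 ^ t * (b + y))    ∎) ⟩
    K j * (4 ^ t * (b + y)) + 3 * (K j * (4 ^ t * (b + y)))
      ≡⟨ ring (K j) (4 ^ t) (b + y) ⟩
    K j * (4 ^ suc t * (b + y)) ∎
    where
    ring : ∀ k p x → k * (p * x) + 3 * (k * (p * x)) ≡ k * (4 * p * x)
    ring = solve 3 (λ k p x → k :* (p :* x) :+ con 3 :* (k :* (p :* x)) := k :* (con 4 :* p :* x))
      refl

stages : (M j i : ℕ) → List ℕ
stages M j zero    = []
stages M j (suc i) = replicate M j ++ stages M (suc j) i

length-stages : ∀ M j i → length (stages M j i) ≡ M * i
length-stages M j zero    = sym (*-zeroʳ M)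
length-stages M j (suc i) = trans (length-++ (replicate M j))
  (trans (cong₂ _+_ (length-replicate M) (length-stages M (suc j) i)) (sym (*-suc M i)))

module _ {m z P E D M : ℕ} {{_ : NonZero P}} {w : ℕ → ℕ} (w≤ : ∀ j → w j ≤ E * 4 ^ j)
         (shrink : 7 ^ M * 4 ≤ 8 ^ M) (absorb : 4 ^ M * (D * 4 + 8 ^ M * E * P) ≤ D * P) where

  -- Divided by `Q`, the charges at the start of stage `j` are `7^M * E * 4^j` and
  -- `D * m * (4/P)^j`. By `shrink`, the decay at rate `7/8` over `M` trials outweighs the fourfold
  -- cost of the next stage. By `absorb`, the factor `P` by which `K` grows per stage outweighs the
  -- growth `4^M` of the reciprocal part within a stage. `Q` is the same for all stages because
  -- `j + i` is.
  admissible-stages : ∀ i j → z ≤ E * 4 ^ (j + i) →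
                      Admissible m (P ^ (j + i)) z w (P ^_) (stages M j i)
                        (7 ^ M * (P ^ (j + i) * (E * 4 ^ j))) (D * m * 4 ^ j * P ^ i)
  admissible-stages zero j z≤ rewrite +-identityʳ j = [] (≤-trans (*-monoʳ-≤ (P ^ j) z≤)
    (≤-trans (≤-reflexive (sym (*-identityˡ _))) (*-monoˡ-≤ (P ^ j * (E * 4 ^ j)) (1≤^ 7 M))))
  admissible-stages (suc i) j z≤ = admissible-mono ≤-refl b≤
    (admissible-replicate M e b y (*-monoʳ-≤ Q (w≤ j)) (≤-reflexive my)
      (admissible-mono a≤ ≤-refl
        (subst (λ q → Admissible m (P ^ q) z w (P ^_) (stages M (suc j) i)
        (7 ^ M * (P ^ q * (E * 4 ^ suc j))) b) (sym (+-suc j i))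
        (admissible-stages i (suc j) (subst (λ q → z ≤ E * 4 ^ q) (+-suc j i) z≤)))))
    where
    open ≤-Reasoning
    Q = P ^ (j + suc i)
    e = Q * (E * 4 ^ j)
    b = D * m * 4 ^ suc j * P ^ i
    y = m * (8 ^ M * (E * 4 ^ j)) * P ^ suc i
    a≤ : 7 ^ M * (Q * (E * 4 ^ suc j)) ≤ 8 ^ M * e
    a≤ = ≤-trans (≤-reflexive (ring (7 ^ M) Q E (4 ^ j))) (*-monoˡ-≤ e shrink)
      where
      ring : ∀ s q E f → s * (q * (E * (4 * f))) ≡ s * 4 * (q * (E * f))
      ring = solve 4 (λ s q E f → s :* (q :* (E :* (con 4 :* f))) := s :* con 4 :* (q :* (E :* f)))
        refl
    my : m * (8 ^ M * e) ≡ P ^ j * y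
    my = trans (cong (λ q → m * (8 ^ M * (q * (E * 4 ^ j)))) (^-distribˡ-+-* P j (suc i)))
               (ring m (8 ^ M) (P ^ j) (P ^ suc i) (E * 4 ^ j))
      where
      ring : ∀ m s p q f → m * (s * (p * q * f)) ≡ p * (m * (s * f) * q)
      ring = solve 5 (λ m s p q f → m :* (s :* (p :* q :* f)) := p :* (m :* (s :* f) :* q)) refl
    b≤ : 4 ^ M * (b + y) ≤ D * m * 4 ^ j * P ^ suc i
    b≤ = begin
      4 ^ M * (b + y)
        ≡⟨ ring₁ (4 ^ M) D m (4 ^ j) (P ^ i) (8 ^ M) E P ⟩
      m * 4 ^ j * P ^ i * (4 ^ M * (D * 4 + 8 ^ M * E * P))
        ≤⟨ *-monoʳ-≤ (m * 4 ^ j * P ^ i) absorb ⟩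
      m * 4 ^ j * P ^ i * (D * P)
        ≡⟨ ring₂ m (4 ^ j) (P ^ i) D P ⟩
      D * m * 4 ^ j * P ^ suc i ∎
      where
      ring₁ : ∀ x D m f p s E P →
              x * (D * m * (4 * f) * p + m * (s * (E * f)) * (P * p)) ≡ m * f * p *
              (x * (D * 4 + s * E * P))
      ring₁ = solve 8 (λ x D m f p s E P →
        x :* (D :* m :* (con 4 :* f) :* p :+ m :* (s :* (E :* f)) :* (P :* p)) :=
        m :* f :* p :* (x :* (D :* con 4 :+ s :* E :* P))) refl
      ring₂ : ∀ m f p D P → m * f * p * (D * P) ≡ D * m * f * (P * p)
      ring₂ = solve 5 (λ m f p D P → m :* f :* p :* (D :* P) := D :* m :* f :* (P :* p)) refl

n<2^1+⌊log₂n⌋ : ∀ n → n < 2 ^ suc ⌊log₂ n ⌋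
n<2^1+⌊log₂n⌋ = <-rec _ go
  where
  go : ∀ n → (∀ {i} → i < n → i < 2 ^ suc ⌊log₂ i ⌋) → n < 2 ^ suc ⌊log₂ n ⌋
  go 0 rec = s≤s z≤n
  go 1 rec = s≤s (s≤s z≤n)
  go n@(suc (suc k)) rec = begin-strict
    n                            ≡⟨ odd+2*half n ⟨
    𝟙 (odd n) + 2 * h            ≤⟨ +-monoˡ-≤ (2 * h) (𝟙≤1 (odd n)) ⟩
    1 + 2 * h                    <⟨ n<1+n _ ⟩
    2 + 2 * h                    ≡⟨ *-suc 2 h ⟨
    2 * suc h                    ≤⟨ *-monoʳ-≤ 2 (rec (⌊n/2⌋<n (suc k))) ⟩
    2 * 2 ^ suc ⌊log₂ h ⌋        ≡⟨ cong (λ l → 2 * 2 ^ l)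
      (trans (cong suc (⌊log₂⌊n/2⌋⌋≡⌊log₂n⌋∸1 n)) (m+[n∸m]≡n {1} 1≤log)) ⟩
    2 * 2 ^ ⌊log₂ n ⌋            ∎
    where
    open ≤-Reasoning
    h = ⌊ n /2⌋
    1≤log : 1 ≤ ⌊log₂ n ⌋
    1≤log = ≤-trans (≤-reflexive (sym (⌊log₂[2^n]⌋≡n 1))) (⌊log₂⌋-mono-≤ {2} {n} (s≤s (s≤s z≤n)))

-- Inputs and expectations

∣p∣≡∑ : (p : Subset n) → ∣ p ∣ ≡ ∑ (uniform n) (𝟙 ∘ lookup p)
∣p∣≡∑ []            = sym (∑-empty _)
∣p∣≡∑ (true  ∷ p) = trans (cong suc (∣p∣≡∑ p)) (sym (∑-suc _))
∣p∣≡∑ (false ∷ p) = trans (∣p∣≡∑ p) (sym (∑-suc _))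

degree≤maxDegree : (G : Graph n) (v : Fin n) → degree G v ≤ maxDegree G
degree≤maxDegree G v = All.lookup (xs≤max 0 (List.map (degree G) (allFin _)))
  (∈-map⁺ (degree G) (∈-allFin v))

edges-∪ : {G E₁ E₂ : Graph n} → EdgePartition G E₁ E₂ → ∀ v u →
          edges G v u ≡ edges E₁ v u ∨ edges E₂ v u
edges-∪ {E₁ = E₁} {E₂} p v u = trans (cong (λ s → lookup s u) (EdgePartition.covers p v))
  (lookup-zipWith _∨_ u (neighbours E₁ v) (neighbours E₂ v))

edges-loopless : (E : Graph n) (v : Fin n) → edges E v v ≡ false
edges-loopless E v with edges E v v in eq
... | false = refl
... | true with () ← loopless E (lookup⇒[]= v (neighbours E v) eq)

partition-instance : ∀ {Δ} {G E₁ E₂ : Graph n} → maxDegree G ≤ Δ → EdgePartition G E₁ E₂ →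
                     Instance n Δ (edges E₁) (edges E₂)
partition-instance {n = n} {Δ} {G} {E₁} {E₂} max≤ p = record
  { symmetricʳ = λ u v uv →
    trans (sym (union v u))
    ([]=⇒lookup (symmetric G (lookup⇒[]= v (neighbours G u) (trans (union u v) uv))))
  ; loopless₁  = edges-loopless E₁
  ; loopless₂  = edges-loopless E₂
  ; disjoint   = apart
  ; degree≤    = λ v →
    ≤-trans (≤-reflexive
    (sym (trans (∣p∣≡∑ (neighbours G v)) (∑-cong (uniform n) (λ u → cong 𝟙 (union v u))))))
                         (≤-trans (degree≤maxDegree G v) max≤) }
  where
  union : ∀ v u → edges G v u ≡ edges E₁ v u ∨ edges E₂ v u
  union = edges-∪ p
  apart : ∀ u v → 𝟙 (edges E₁ u v) + 𝟙 (edges E₂ u v) ≤ 𝟙 (edges E₁ u v ∨ edges E₂ u v)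
  apart u v with edges E₁ u v in eq₁ | edges E₂ u v in eq₂
  ... | false | b     = ≤-refl
  ... | true  | false = ≤-refl
  ... | true  | true with () ← EdgePartition.disjoint p u
    (v , x∈p∩q⁺ (lookup⇒[]= v (neighbours E₁ u) eq₁ , lookup⇒[]= v (neighbours E₂ u) eq₂))

𝔼-≤ : .{{_ : NonZero k}} (f : Fin k → ℕ) (c : ℕ) → ∑ (uniform k) f ≤ k * c → 𝔼 f ≤ℚ ℤ.+ c / 1
𝔼-≤ {suc k} f c le =
  ℚ.toℚᵘ-cancel-≤ (ℚᵘ.≤-respˡ-≃ (ℚᵘ.≃-sym (ℚ.toℚᵘ-fromℚᵘ p))
  (ℚᵘ.≤-respʳ-≃ (ℚᵘ.≃-sym (ℚ.toℚᵘ-fromℚᵘ q))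
  (ℚᵘ.*≤* (subst₂ ℤ._≤_ (ℤ.pos-* total 1) (ℤ.pos-* c (suc k)) (ℤ.+≤+ (begin
    total * 1            ≡⟨ trans (*-identityʳ _) (sym (∑-uniform f)) ⟩
    ∑ (uniform (suc k)) f ≤⟨ le ⟩
    suc k * c            ≡⟨ *-comm (suc k) c ⟩
    c * suc k            ∎))))))
  where
  open ≤-Reasoning
  total = sum f
  p = ℚᵘ.mkℚᵘ (ℤ.+ total) k
  q = ℚᵘ.mkℚᵘ (ℤ.+ c) 0

-- Choice of parameters and final bounds

unit-^ : ∀ j → suc (pred (2 ^ j)) ≡ 2 ^ j
unit-^ j = suc-pred (2 ^ j) {{m^n≢0 2 j}}

n<2^n : ∀ n → n < 2 ^ n
n<2^n zero    = s≤s z≤n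
n<2^n (suc n) = ≤-trans (+-mono-≤ (1≤^ 2 n) (n<2^n n))
  (≤-reflexive (cong (λ x → 2 ^ n + x) (sym (+-identityʳ (2 ^ n)))))

^-*-comm : ∀ a j k → (a ^ j) ^ k ≡ (a ^ k) ^ j
^-*-comm a j k = trans (^-*-assoc a j k) (trans (cong (a ^_) (*-comm j k)) (sym (^-*-assoc a k j)))

square-^ : ∀ a j → a ^ j * a ^ j ≡ (a * a) ^ j
square-^ a zero    = refl
square-^ a (suc j) = trans (ring a (a ^ j)) (cong (a * a *_) (square-^ a j))
  where
  ring : ∀ a p → a * p * (a * p) ≡ a * a * (p * p)
  ring = solve 2 (λ a p → a :* p :* (a :* p) := a :* a :* (p :* p)) refl

-- A trial of stage j has branching 2^j and depth L, hence P^(2j) leaves, and its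
-- search fails with probability at most 2m/(P^j · slack).
module Assembly (L M P E D : ℕ) (P≢0 : NonZero P) (P² : P * P ≡ 2 ^ L)
    (E≥ : 2 * (L * suc L + 1) ≤ E)
                (shrink : 7 ^ M * 4 ≤ 8 ^ M) (absorb : 4 ^ M * (D * 4 + 8 ^ M * E * P) ≤ D * P)
                          where

  branching countBits : ℕ → ℕ
  branching j = pred (2 ^ j)
  countBits j = suc (j * L)

  logΔ logLog : ℕ → ℕ
  logΔ Δ   = ⌊log₂ suc Δ ⌋
  logLog n = 1 ⊔ ⌊log₂ ⌊log₂ n ⌋ ⌋

  -- Each summand is rounded up so that its power of two exceeds `Δ`, respectively `⌊log₂ n ⌋`.
  -- Sending the names then costs, per open vertex, no more than the bound for a trial of the next
  -- stage.
  stageCount : ℕ → ℕ → ℕ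
  stageCount n Δ = suc (logΔ Δ) + suc (logLog n)

  schedule : ℕ → ℕ → List ℕ
  schedule n Δ = stages M 0 (stageCount n Δ)

  module _ (n Δ : ℕ) where
    open Run n Δ L (suc ⌊log₂ n ⌋) branching countBits public

  blank : ∀ n Δ → State n (suc Δ)
  blank n Δ = Vec.replicate n nothing

  protocolFor : ∀ n Δ → RandomizedProtocol (Graph n) (Graph n) (Coloring n (suc Δ))
  -- For `Δ = 0` the bound on the rounds is 0, since `⌊log₂ 1 ⌋ = 0`, so nothing may be sent;
  -- without edges any colouring is proper.
  protocolFor n zero = record { size = 1 ; protocol = λ _ → compile (return (λ _ → zero)) }
  protocolFor n Δ@(suc _) = record
    { size     = card (seedSpace n Δ (schedule n Δ))
    ; nonEmpty = seedSpace-nonZero n Δ (schedule n Δ)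
    ; protocol = λ i → compile (run n Δ (schedule n Δ) (at (seedSpace n Δ (schedule n Δ)) i)
      (blank n Δ))
    }

  fits : ∀ j → suc (branching j) ^ L < 2 ^ countBits j
  fits j rewrite unit-^ j | ^-*-assoc 2 j L = ^-monoʳ-< 2 (s≤s (s≤s z≤n)) (n<1+n (j * L))

  leaves : ∀ j → P ^ j * P ^ j ≡ suc (branching j) ^ L
  leaves j rewrite unit-^ j = trans (square-^ P j) (trans (cong (_^ j) P²) (^-*-comm 2 L j))

  4^≡ : ∀ j → 4 ^ j ≡ 2 ^ j * 2 ^ j
  4^≡ j = sym (square-^ 2 j)

  -- One factor `2 ^ j` of `4 ^ j` is the branching; the other generously covers the `suc (j * L)`
  -- bits of a count.
  weight≤ : ∀ n Δ j → weight n Δ j ≤ E * 4 ^ j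
  weight≤ n Δ j = begin
    2 * (L * (suc (branching j) * suc (j * L)) + 1)
      ≡⟨ cong (λ t → 2 * (L * (t * suc (j * L)) + 1)) (unit-^ j) ⟩
    2 * (L * (2 ^ j * suc (j * L)) + 1)
      ≤⟨ *-monoʳ-≤ 2 (+-mono-≤ (*-monoʳ-≤ L (*-monoʳ-≤ (2 ^ j) bits≤)) (1≤^ 4 j)) ⟩
    2 * (L * (2 ^ j * (2 ^ j * suc L)) + 4 ^ j)
      ≡⟨ cong (λ f → 2 * (L * (2 ^ j * (2 ^ j * suc L)) + f)) (4^≡ j) ⟩
    2 * (L * (2 ^ j * (2 ^ j * suc L)) + 2 ^ j * 2 ^ j)
      ≡⟨ ring L (2 ^ j) (suc L) ⟩
    2 * (L * suc L + 1) * (2 ^ j * 2 ^ j)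
      ≤⟨ *-monoˡ-≤ (2 ^ j * 2 ^ j) E≥ ⟩
    E * (2 ^ j * 2 ^ j)
      ≡⟨ cong (E *_) (4^≡ j) ⟨
    E * 4 ^ j ∎
    where
    open ≤-Reasoning
    ring : ∀ L t l → 2 * (L * (t * (t * l)) + t * t) ≡ 2 * (L * l + 1) * (t * t)
    ring = solve 3 (λ L t l → con 2 :* (L :* (t :* (t :* l)) :+ t :* t) :=
      con 2 :* (L :* l :+ con 1) :* (t :* t)) refl
    bits≤ : suc (j * L) ≤ 2 ^ j * suc L
    bits≤ = ≤-trans (+-mono-≤ (1≤^ 2 j) (*-monoˡ-≤ L (<⇒≤ (n<2^n j))))
      (≤-reflexive (sym (*-suc (2 ^ j) L)))

  finish≤ : ∀ n Δ → 2 * (Δ * suc ⌊log₂ n ⌋) ≤ E * 4 ^ stageCount n Δ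
  finish≤ n Δ = *-mono-≤ 2≤E (begin
    Δ * suc ⌊log₂ n ⌋
      ≤⟨ *-mono-≤ (≤-trans (n≤1+n Δ) (<⇒≤ (n<2^1+⌊log₂n⌋ (suc Δ)))) name≤ ⟩
    2 ^ suc (logΔ Δ) * 2 ^ suc (logLog n)
      ≡⟨ ^-distribˡ-+-* 2 (suc (logΔ Δ)) (suc (logLog n)) ⟨
    2 ^ stageCount n Δ
      ≤⟨ ^-monoˡ-≤ (stageCount n Δ) (s≤s (s≤s z≤n)) ⟩
    4 ^ stageCount n Δ ∎)
    where
    open ≤-Reasoning
    2≤E : 2 ≤ E
    2≤E = ≤-trans (*-monoʳ-≤ 2 (m≤n+m 1 (L * suc L))) E≥
    name≤ : suc ⌊log₂ n ⌋ ≤ 2 ^ suc (logLog n)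
    name≤ = ≤-trans (n<2^1+⌊log₂n⌋ ⌊log₂ n ⌋) (^-monoʳ-≤ 2 (s≤s (m≤n⊔m 1 ⌊log₂ ⌊log₂ n ⌋ ⌋)))

  -- `K₁` is the charge `(a + b/s)/Q` of a vertex at the outset, where `s = Δ + 1`. In `K₂`, a stage
  -- has `M` trials of `suc L` rounds each (the descent and the check of clashes), 4 bounds the
  -- number of stages by the product of the logarithms, and 1 is the last round.
  K₁ K₂ : ℕ
  K₁ = 7 ^ M * E + D
  K₂ = M * 4 * suc L + 1

  module _ {n Δ : ℕ} {G E₁ E₂ : Graph n} (max≡ : maxDegree G ≡ Δ) (part : EdgePartition G E₁ E₂)
                  where

    inst : Instance n Δ (edges E₁) (edges E₂)
    inst = partition-instance (≤-reflexive max≡) part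

    edge-∪ : ∀ {u v} → v ∈ₛ neighbours G u → edges E₁ u v ∨ edges E₂ u v ≡ true
    edge-∪ {u} {v} uv = trans (sym (edges-∪ part u v)) ([]=⇒lookup uv)

    blank-partial : Partial (λ u v → edges E₁ u v ∨ edges E₂ u v) (blank n Δ)
    blank-partial {u} _ σu _ = case trans (sym (lookup-replicate u nothing)) σu of λ ()

    expected : let S = seedSpace n Δ (schedule n Δ) in
               ∑ S (λ ωs → cost (run n Δ (schedule n Δ) ωs (blank n Δ)) E₁ E₂) ≤ card S * (K₁ * n)
    expected = *-cancelˡ-≤ (m ! * Q) {{m*n≢0 (m !) Q {{m !≢0}} {{m^n≢0 P R {{P≢0}}}}}} (begin
      m ! * Q * ∑ S (λ ωs → cost (run n Δ js ωs σ₀) E₁ E₂)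
        ≡⟨ ∑-* S (m ! * Q) _ ⟨
      ∑ S (λ ωs → m ! * Q * cost (run n Δ js ωs σ₀) E₁ E₂)
        ≤⟨ run-expected n Δ fits E₁ E₂ inst Q (P ^_) (λ j → m^n≢0 P j {{P≢0}}) leaves js a b adm σ₀
             ⟩
      card S * ∑ (uniform n) (λ v → 𝟙 (isOpen (lookup σ₀ v)) * (a * m ! + b * share m (slack σ₀ v)))
        ≤⟨ *-monoʳ-≤ (card S) (∑-mono (uniform n) pointwise) ⟩
      card S * ∑ (uniform n) (λ _ → m ! * Q * K₁)
        ≡⟨ cong (card S *_) (∑-const (uniform n) _) ⟩
      card S * (n * (m ! * Q * K₁))
        ≡⟨ ring (card S) n (m ! * Q) K₁ ⟩
      m ! * Q * (card S * (K₁ * n)) ∎)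
      where
      open ≤-Reasoning
      open Analysis {n} {Δ} {0} {0} inst using (slack; colouredNbrs)
      m = suc Δ
      R = stageCount n Δ
      Q = P ^ R
      js = schedule n Δ
      S = seedSpace n Δ js
      σ₀ = blank n Δ
      a = 7 ^ M * (Q * (E * 4 ^ 0))
      b = D * m * 4 ^ 0 * P ^ R
      adm : Admissible m Q (2 * (Δ * suc ⌊log₂ n ⌋)) (weight n Δ) (P ^_) js a b
      adm = admissible-stages {D = D} {{P≢0}} (weight≤ n Δ) shrink absorb R 0 (finish≤ n Δ)
      slack≡ : ∀ v → slack σ₀ v ≡ m
      slack≡ v = cong (m ∸_)
        (trans (∑-cong (uniform n) zeroes) (trans (∑-const (uniform n) 0) (*-zeroʳ n)))
        where
        zeroes : ∀ u → 𝟙 ((edges E₁ v u ∨ edges E₂ v u) ∧ not (isOpen (lookup σ₀ u))) ≡ 0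
        zeroes u rewrite lookup-replicate u (nothing {A = Fin m}) | ∧-zeroʳ
          (edges E₁ v u ∨ edges E₂ v u) = refl
      ring₁ : ∀ s Q E H D m h →
              1 * (s * (Q * (E * 1)) * H + D * m * 1 * Q * h) ≡ s * E * (H * Q) + D * Q * (m * h)
      ring₁ = solve 7 (λ s Q E H D m h →
        con 1 :* (s :* (Q :* (E :* con 1)) :* H :+ D :* m :* con 1 :* Q :* h) :=
        s :* E :* (H :* Q) :+ D :* Q :* (m :* h)) refl
      ring₂ : ∀ s H Q D → s * (H * Q) + D * Q * H ≡ H * Q * (s + D)
      ring₂ = solve 4 (λ s H Q D → s :* (H :* Q) :+ D :* Q :* H := H :* Q :* (s :+ D)) refl
      pointwise : ∀ v → 𝟙 (isOpen (lookup σ₀ v)) * (a * m ! + b * share m (slack σ₀ v)) ≤ m ! * Q *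
                  K₁
      pointwise v = begin
        𝟙 (isOpen (lookup σ₀ v)) * (a * m ! + b * share m (slack σ₀ v))
          ≤⟨ *-monoˡ-≤ _ (𝟙≤1 (isOpen (lookup σ₀ v))) ⟩
        1 * (a * m ! + b * share m (slack σ₀ v))
          ≡⟨ cong (λ s → 1 * (a * m ! + b * share m s)) (slack≡ v) ⟩
        1 * (a * m ! + b * share m m)
          ≡⟨ ring₁ (7 ^ M) Q E (m !) D m (share m m) ⟩
        7 ^ M * E * (m ! * Q) + D * Q * (m * share m m)
          ≡⟨ cong (λ h → 7 ^ M * E * (m ! * Q) + D * Q * h) (*-share {m} {m} (s≤s z≤n) ≤-refl) ⟩
        7 ^ M * E * (m ! * Q) + D * Q * m !
          ≡⟨ ring₂ (7 ^ M * E) (m !) Q D ⟩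
        m ! * Q * K₁ ∎
      ring : ∀ s n h k → s * (n * (h * k)) ≡ h * (s * (k * n))
      ring = solve 4 (λ s n h k → s :* (n :* (h :* k)) := h :* (s :* (k :* n))) refl

    rounds≤ : 1 ≤ Δ → length (schedule n Δ) * suc L + 1 ≤ K₂ * (logLog n * logΔ Δ)
    rounds≤ 1≤Δ = begin
      length (schedule n Δ) * suc L + 1
        ≡⟨ cong (λ l → l * suc L + 1) (length-stages M 0 (stageCount n Δ)) ⟩
      M * stageCount n Δ * suc L + 1
        ≤⟨ +-mono-≤ (*-monoˡ-≤ (suc L)
             (*-monoʳ-≤ M (stages≤ (logΔ Δ) (logLog n) 1≤logΔ (m≤m⊔n 1 ⌊log₂ ⌊log₂ n ⌋ ⌋))))
             (*-mono-≤ (m≤m⊔n 1 ⌊log₂ ⌊log₂ n ⌋ ⌋) 1≤logΔ) ⟩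
      M * (4 * (logLog n * logΔ Δ)) * suc L + logLog n * logΔ Δ
        ≡⟨ ring M (logLog n * logΔ Δ) (suc L) ⟩
      K₂ * (logLog n * logΔ Δ) ∎
      where
      open ≤-Reasoning
      ring : ∀ M x l → M * (4 * x) * l + x ≡ (M * 4 * l + 1) * x
      ring = solve 3 (λ M x l → M :* (con 4 :* x) :* l :+ x := (M :* con 4 :* l :+ con 1) :* x) refl
      1≤logΔ : 1 ≤ logΔ Δ
      1≤logΔ = ≤-trans (≤-reflexive (sym (⌊log₂[2^n]⌋≡n 1))) (⌊log₂⌋-mono-≤ {2} {suc Δ} (s≤s 1≤Δ))
      -- The schedule has length proportional to a sum of logarithms; only here is it weakened to
      -- their product. The factor 4 is attained at `x = y = 1`.
      stages≤ : ∀ x y → 1 ≤ x → 1 ≤ y → suc x + suc y ≤ 4 * (y * x)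
      stages≤ (suc x) (suc y) _ _ = ≤-trans (m≤m+n _ (3 * x + 3 * y + 4 * (x * y)))
        (≤-reflexive (ring′ x y))
        where
        ring′ : ∀ x y → 2 + x + (2 + y) + (3 * x + 3 * y + 4 * (x * y)) ≡ 4 * ((1 + y) * (1 + x))
        ring′ = solve 2 (λ x y →
          con 2 :+ x :+ (con 2 :+ y) :+ (con 3 :* x :+ con 3 :* y :+ con 4 :* (x :* y)) :=
          con 4 :* ((con 1 :+ y) :* (con 1 :+ x))) refl

  protocolFor-correct : ∀ n Δ (G E₁ E₂ : Graph n) → maxDegree G ≡ Δ → EdgePartition G E₁ E₂ →
    (∀ ω → Solves G (protocol (protocolFor n Δ) ω) E₁ E₂)
    × expectedBits (protocolFor n Δ) E₁ E₂ ≤ℚ ℤ.+ (K₁ * n) / 1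
    × (∀ ω → rounds (protocol (protocolFor n Δ) ω) E₁ E₂ ≤ K₂ * (logLog n * logΔ Δ))
  protocolFor-correct n zero G E₁ E₂ max≡ part =
    (λ _ → (λ {u} {v} uv → contradiction (no-edge uv) λ ()) , λ _ → refl) ,
    𝔼-≤ (λ _ → 0) (K₁ * n) (≤-trans (≤-reflexive (∑-const (uniform 1) 0)) z≤n) ,
    λ _ → z≤n
    where
    no-edge : ∀ {u v} → v ∈ₛ neighbours G u → 1 ≤ 0
    no-edge {u} {v} uv = ≤-trans (≤-reflexive (cong 𝟙 (sym (edge-∪ max≡ part uv))))
      (≤-trans (term≤∑ _ v)
      (Instance.degree≤ (inst max≡ part) u))
  protocolFor-correct n Δ@(suc _) G E₁ E₂ max≡ part =
    (λ i → let ωs = at S i in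
      (λ {u} {v} uv → subst (λ c → c u ≢ c v) (sym (outputAlice-compile (program ωs) E₁ E₂))
        (run-proper n Δ fits E₁ E₂ (inst max≡ part) (<⇒≤ (n<2^1+⌊log₂n⌋ n)) js ωs (blank n Δ)
          (blank-partial max≡ part) (edge-∪ max≡ part uv))) ,
      λ v → cong (λ c → c v)
        (trans (outputAlice-compile (program ωs) E₁ E₂)
        (sym (outputBob-compile (program ωs) E₁ E₂)))) ,
    𝔼-≤ {{seedSpace-nonZero n Δ js}} (λ i → bits (compile (program (at S i))) E₁ E₂) (K₁ * n)
      (≤-trans (≤-reflexive (begin
      ∑ (uniform (card S)) (λ i → bits (compile (program (at S i))) E₁ E₂)
        ≡⟨ trans (∑-uniform _) (sym (∑≡sum S (λ ωs → bits (compile (program ωs)) E₁ E₂))) ⟩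
      ∑ S (λ ωs → bits (compile (program ωs)) E₁ E₂)
        ≡⟨ ∑-cong S (λ ωs → bits-compile (program ωs) E₁ E₂) ⟩
      ∑ S (λ ωs → cost (program ωs) E₁ E₂) ∎)) (expected max≡ part)) ,
    λ i → ≤-trans (≤-reflexive
      (trans (rounds-compile (program (at S i)) E₁ E₂)
      (run-depth n Δ js (at S i) (blank n Δ) E₁ E₂)))
                  (rounds≤ max≡ part (s≤s z≤n))
    where
    open ≡-Reasoning
    js = schedule n Δ
    S = seedSpace n Δ js
    program : Seeds n Δ js → Program (Graph n) (Graph n) (Coloring n (suc Δ))
    program ωs = run n Δ js ωs (blank n Δ)

-- Here (8/7)^12 ≥ 4, 4^12 · 4 / 2^27 = 1/2 (which makes absorb solvable for D),
-- 2^54 = (2^27)² and 5942 = 2 (54 · 55 + 1).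
open Assembly 54 12 (2 ^ 27) 5942 (2 * 4 ^ 12 * 8 ^ 12 * 5942) _ refl (≤ᵇ⇒≤ _ _ _) (≤ᵇ⇒≤ _ _ _)
  (≤ᵇ⇒≤ _ _ _)

open import Data.Integer.Base using (+_)

theorem1 : Σ[ R ∈ (∀ n Δ → RandomizedProtocol (Graph n) (Graph n) (Coloring n (suc Δ))) ]
    ∃[ K₁ ] ∃[ K₂ ]
    ∀ n Δ (G E₁ E₂ : Graph n) → maxDegree G ≡ Δ → EdgePartition G E₁ E₂ →
    (∀ ω → Solves G (protocol (R n Δ) ω) E₁ E₂)
    × expectedBits (R n Δ) E₁ E₂ ≤ℚ + (K₁ * n) / 1
    × (∀ ω → rounds (protocol (R n Δ) ω) E₁ E₂
    ≤ K₂ * ((1 ⊔ ⌊log₂ ⌊log₂ n ⌋ ⌋) * ⌊log₂ suc Δ ⌋))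
theorem1 = protocolFor , K₁ , K₂ , protocolFor-correct
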